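{- Let $\varepsilon>0$. There is a pseudopolynomial time EDF-schedulability test with speedup $2-1/m+\varepsilon$; that is, there is an algorithm, running in pseudopolynomial time, which given a sporadic DAG task system $\mathcal{T}$ and a number $m\ge 1$ of processors, either guarantees that $\mathcal{T}$ is EDF-schedulable on $m$ processors of speed $2-1/m+\varepsilon$, or proves that $\mathcal{T}$ is infeasible on $m$ processors of unit speed.
   Context: $\mathbb{N}$ denotes the positive integers, $\mathbb{N}_0=\mathbb{N}\cup\{0\}$. Sporadic DAG model: a task $\tau_i=(G_i,D_i,T_i)$ consists of a finite directed acyclic graph $G_i=(V_i,E_i)$ whose vertices $v$ (sequential jobs) have processing times $p_v\in\mathbb{N}$, a relative deadline $D_i\in\mathbb{N}$ and a period $T_i\in\mathbb{N}$. A release of a dag-job of $\tau_i$ at time $t\in\mathbb{N}_0$ means that one copy of each job $v\in V_i$ is released at time $t$, and all of these must complete by the absolute deadline $t+D_i$; if $(v,w)\in E_i$, then within the dag-job, job $v$ must complete before job $w$ may begin. Consecutive dag-job releases of $\tau_i$ are at least $T_i$ apart; there are no precedence constraints between different dag-jobs (also if $D_i>T_i$). A task system is a finite collection $\mathcal{T}=(\tau_1,\dots,\tau_n)$ of such tasks; it may generate any (possibly infinite) collection of dag-jobs obtained by letting each task independently release dag-jobs subject to the minimum separation. Schedules: the machine consists of identical parallel processors of speed $s$ (a job run for time $\delta$ on such a processor receives $s\delta$ units of processing). Preemption and migration are allowed; at any time a processor runs at most one job and a job runs on at most one processor. A job $j$ is available at time $t$ if it has been released by $t$, all of its predecessors are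 completed, and $j$ is not yet completed. A schedule is valid (feasible) if precedence constraints and release dates are respected and every job completes by its deadline. EDF (Earliest Deadline First): at any time, process the $m$ available jobs with minimum absolute deadline (all available jobs if there are fewer than $m$), ties broken arbitrarily. $\mathcal{T}$ is feasible on $m$ speed-$s$ processors if for every collection of dag-jobs it may generate there is a valid schedule on $m$ speed-$s$ processors; otherwise it is infeasible. $\mathcal{T}$ is EDF-schedulable on $m$ speed-$s$ processors if EDF meets all deadlines on $m$ speed-$s$ processors for every collection of dag-jobs it may generate. Pseudopolynomial time means time polynomial in the number of vertices and edges of the DAGs, the number of tasks, and the numerical values (not only their encoding lengths) of the parameters $p_v,D_i,T_i$, for the given $\varepsilon$. -}

module Defs where

open import Level using (Level; _⊔_) renaming (suc to lsuc)
open import Algebra.Bundles using (CommutativeRing)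
open import Algebra.Core using (Op₁)
open import Data.Bool.Base using (Bool; true; false; T; if_then_else_)
open import Data.Empty using (⊥)
open import Data.Fin.Base using (Fin; zero; toℕ)
open import Data.Fin.Properties using (any?)
  renaming (_≟_ to _≟ꟳ_)
open import Data.Fin.Subset using (Subset; _∈_; ∣_∣)
open import Data.List.Base as List using (List; length; lookup; tabulate)
open import Data.Maybe.Base using (Maybe; just; nothing)
import Data.Maybe.Properties as Maybe
open import Data.Nat.Base as ℕ using (ℕ; zero; suc; NonZero)
open import Data.Nat.ListAction using (sum)
open import Data.Nat.Properties using () renaming (_≟_ to _≟ℕ_)
open import Data.Product.Base using (∃; ∃₂; _×_; _,_; proj₁)
import Data.Product.Properties as Product
open import Data.Unit.Base using (⊤)
open import Data.Vec.Base as Vec using (Vec; _∷_)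
open import Relation.Binary.Bundles using (DecTotalOrder)
open import Relation.Binary.Construct.Closure.Transitive using (TransClosure)
open import Relation.Binary.Core using (Rel)
open import Relation.Binary.Definitions using (DecidableEquality)
open import Relation.Binary.PropositionalEquality.Core using (_≡_; refl)
open import Relation.Binary.Structures using (IsDecTotalOrder)
open import Relation.Nullary using (¬_; Dec; does)
import Relation.Nullary.Decidable.Core as Dec

import Algebra.Construct.NaturalChoice.Min as Min
import Algebra.Definitions.RawMonoid as RawMonoid

------------------------------------------------------------------------
-- Time and speed

-- ℝ is (classically) an instance, and so is ℚ.
record ArchimedeanOrderedField c ℓ₁ ℓ₂ : Set (lsuc (c ⊔ ℓ₁ ⊔ ℓ₂)) where
  infix 4 _≤_ _<_
  infix 8 _⁻¹

  field
    commutativeRing : CommutativeRing c ℓ₁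

  open CommutativeRing commutativeRing public

  field
    _≤_             : Rel Carrier ℓ₂
    isDecTotalOrder : IsDecTotalOrder _≈_ _≤_
    +-monoʳ-≤       : ∀ x {y z} → y ≤ z → x + y ≤ x + z
    *-nonNeg        : ∀ {x y} → 0# ≤ x → 0# ≤ y → 0# ≤ x * y
    0≉1             : ¬ 0# ≈ 1#
    -- Total for convenience; the value at 0# is irrelevant.
    _⁻¹             : Op₁ Carrier
    ⁻¹-inverseʳ     : ∀ {x} → ¬ x ≈ 0# → x * x ⁻¹ ≈ 1#

  open RawMonoid +-rawMonoid public using () renaming (_×_ to _·_)

  ι : ℕ → Carrier
  ι n = n · 1#

  field
    archimedean : ∀ x → ∃ λ n → x ≤ ι n

  decTotalOrder : DecTotalOrder c ℓ₁ ℓ₂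
  decTotalOrder = record { isDecTotalOrder = isDecTotalOrder }

  _<_ : Rel Carrier (ℓ₁ ⊔ ℓ₂)
  x < y = x ≤ y × ¬ x ≈ y

  open Min (DecTotalOrder.totalOrder decTotalOrder) public using (_⊓_)

------------------------------------------------------------------------
-- Sporadic DAG tasks

record Task : Set where
  field
    #vertices      : ℕ
    successors     : Fin #vertices → Subset #vertices
    processingTime : Fin #vertices → ℕ
    deadline       : ℕ
    period         : ℕ

  Edge : Rel (Fin #vertices) _
  Edge v w = w ∈ successors v

  field
    acyclic                : ∀ v → ¬ TransClosure Edge v v
    processingTime-nonZero : ∀ v → NonZero (processingTime v)
    deadline-nonZero       : NonZero deadline
    period-nonZero         : NonZero period

  #edges : ℕ
  #edges = sum (tabulate λ v → ∣ successors v ∣)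

open Task

TaskSystem : Set
TaskSystem = List Task

module _ (𝒯 : TaskSystem) where

  -- A set of release dates for every task.  As all periods are positive, a
  -- dag-job is determined by its task and its release date.
  record Releases : Set where
    field
      released  : Fin (length 𝒯) → ℕ → Bool
      separated : ∀ i {t u} → T (released i t) → T (released i u) → t ℕ.< u →
                  t ℕ.+ period (lookup 𝒯 i) ℕ.≤ u

  -- The copy of a vertex in the dag-job that its task releases at releaseDate.
  record Job : Set where
    constructor job
    field
      index       : Fin (length 𝒯)
      releaseDate : ℕ
      vertex      : Fin (#vertices (lookup 𝒯 index))

    work : ℕ
    work = processingTime (lookup 𝒯 index) vertex

    absoluteDeadline : ℕ
    absoluteDeadline = releaseDate ℕ.+ deadline (lookup 𝒯 index)

open Job

module _ {𝒯 : TaskSystem} where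

  infix 4 _≟_

  _≟_ : DecidableEquality (Job 𝒯)
  job i t v ≟ job i′ t′ v′ =
    Dec.map′ (λ { refl → refl }) (λ { refl → refl })
      (Product.≡-dec _≟ꟳ_ (Product.≡-dec _≟ℕ_ _≟ꟳ_) (i , t , v) (i′ , t′ , v′))

  Generated : Releases 𝒯 → Job 𝒯 → Set
  Generated R j = T (Releases.released R (index j) (releaseDate j))

  data Precedes : Rel (Job 𝒯) Level.zero where
    edge : ∀ {i t v w} → Edge (lookup 𝒯 i) v w →
           Precedes (job i t v) (job i t w)

------------------------------------------------------------------------
-- Schedules, feasibility and EDF

module Scheduling {c ℓ₁ ℓ₂} (𝕂 : ArchimedeanOrderedField c ℓ₁ ℓ₂) where

  open ArchimedeanOrderedField 𝕂
  private module Sum = RawMonoid +-rawMonoid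

  Time = Carrier

  -- A preemptive migratory schedule on m processors with finitely many context
  -- switches in bounded time: throughout [cut k , cut (suc k)), processor p
  -- runs run k p (nothing: p is idle).
  record Schedule (𝒯 : TaskSystem) (m : ℕ) : Set (c ⊔ ℓ₁ ⊔ ℓ₂) where
    field
      cut            : ℕ → Time
      cut-zero       : cut 0 ≈ 0#
      cut-increasing : ∀ k → cut k < cut (suc k)
      cut-unbounded  : ∀ t → ∃ λ k → t ≤ cut k
      run            : ℕ → Fin m → Maybe (Job 𝒯)
      run-injective  : ∀ k {p q j} → run k p ≡ just j → run k q ≡ just j → p ≡ q

    RunsAt : Fin m → Time → Job 𝒯 → Set (ℓ₁ ⊔ ℓ₂)
    RunsAt p t j =
      ∃ λ k → cut k ≤ t × t < cut (suc k) × run k p ≡ just j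

    Running : Time → Job 𝒯 → Set (ℓ₁ ⊔ ℓ₂)
    Running t j = ∃ λ p → RunsAt p t j

    runs? : ∀ k j → Dec (∃ λ p → run k p ≡ just j)
    runs? k j = any? λ p → Maybe.≡-dec _≟_ (run k p) (just j)

    -- The length of [cut k , cut (suc k)) ∩ [0 , t) if j runs in piece k.
    runningTime : Job 𝒯 → Time → ℕ → Time
    runningTime j t k =
      if does (runs? k j) then cut (suc k) ⊓ t - cut k ⊓ t else 0#

    -- The processing that j receives before t on processors of speed s.
    received : (s : Carrier) → Job 𝒯 → Time → Carrier
    received s j t =
      s * Sum.sum {proj₁ (cut-unbounded t)} λ k → runningTime j t (toℕ k)

  module _ {𝒯 : TaskSystem} {m : ℕ} (R : Releases 𝒯)
           (s : Carrier) (S : Schedule 𝒯 m) where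

    open Schedule S

    Completed : Time → Job 𝒯 → Set ℓ₂
    Completed t j = ι (work j) ≤ received s j t

    MeetsDeadlines : Set ℓ₂
    MeetsDeadlines = ∀ j → Generated R j → Completed (ι (absoluteDeadline j)) j

    record Ready (t : Time) (j : Job 𝒯) : Set ℓ₂ where
      field
        generated             : Generated R j
        released              : ι (releaseDate j) ≤ t
        predecessorsCompleted : ∀ {i} → Precedes i j → Completed t i

    Available : Time → Job 𝒯 → Set ℓ₂
    Available t j = Ready t j × ¬ Completed t j

    record Valid : Set (c ⊔ ℓ₁ ⊔ ℓ₂) where
      field
        running-ready  : ∀ {t j} → Running t j → Ready t j
        meetsDeadlines : MeetsDeadlines

    -- Whenever an available job is not running, all m processors run jobs whose
    -- deadlines are no later than its own; ties are broken arbitrarily, possibly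
    -- differently at different times.
    record EDF : Set (c ⊔ ℓ₁ ⊔ ℓ₂) where
      field
        running-available : ∀ {t j} → Running t j → Available t j
        earliest-deadline :
          ∀ {t j} → 0# ≤ t → Available t j → ¬ Running t j → ∀ p →
          ∃ λ i → RunsAt p t i × absoluteDeadline i ℕ.≤ absoluteDeadline j

  Feasible : TaskSystem → (m : ℕ) (s : Carrier) → Set (c ⊔ ℓ₁ ⊔ ℓ₂)
  Feasible 𝒯 m s = ∀ R → ∃ λ (S : Schedule 𝒯 m) → Valid R s S

  Infeasible : TaskSystem → (m : ℕ) (s : Carrier) → Set (c ⊔ ℓ₁ ⊔ ℓ₂)
  Infeasible 𝒯 m s = ¬ Feasible 𝒯 m s

  EDFSchedulable : TaskSystem → (m : ℕ) (s : Carrier) → Set (c ⊔ ℓ₁ ⊔ ℓ₂)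
  EDFSchedulable 𝒯 m s =
    ∀ R (S : Schedule 𝒯 m) → EDF R s S → MeetsDeadlines R s S

------------------------------------------------------------------------
-- Algorithms: Jones's WHILE language over binary trees

-- With the unit-cost semantics below, WHILE programs and Turing machines
-- simulate each other with polynomial overhead (N. D. Jones, Computability
-- and Complexity from a Programming Perspective, 1997).

infixr 5 _∙_

data Tree : Set where
  nil : Tree
  _∙_ : Tree → Tree → Tree

head tail : Tree → Tree
head nil     = nil
head (l ∙ r) = l
tail nil     = nil
tail (l ∙ r) = r

IsNode : Tree → Set
IsNode nil     = ⊥
IsNode (_ ∙ _) = ⊤

data Expr (n : ℕ) : Set where
  var   : Fin n → Expr n
  nil   : Expr n
  cons  : Expr n → Expr n → Expr n
  hd tl : Expr n → Expr n

infix  6 _≔_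
infixr 5 _⨾_

data Command (n : ℕ) : Set where
  skip     : Command n
  _≔_      : Fin n → Expr n → Command n
  _⨾_      : Command n → Command n → Command n
  cond     : Expr n → Command n → Command n → Command n
  while    : Expr n → Command n → Command n

Store : ℕ → Set
Store = Vec Tree

⟦_⟧ : ∀ {n} → Expr n → Store n → Tree
⟦ var x    ⟧ σ = Vec.lookup σ x
⟦ nil      ⟧ σ = nil
⟦ cons e f ⟧ σ = ⟦ e ⟧ σ ∙ ⟦ f ⟧ σ
⟦ hd e     ⟧ σ = head (⟦ e ⟧ σ)
⟦ tl e     ⟧ σ = tail (⟦ e ⟧ σ)

cost : ∀ {n} → Expr n → ℕ
cost (var x)    = 1
cost nil        = 1
cost (cons e f) = suc (cost e ℕ.+ cost f)
cost (hd e)     = suc (cost e)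
cost (tl e)     = suc (cost e)

infix 4 ⟨_,_⟩⇓[_]_

-- ⟨ C , σ ⟩⇓[ k ] τ: started in σ, C halts after k steps in τ.
data ⟨_,_⟩⇓[_]_ {n} : Command n → Store n → ℕ → Store n → Set where
  skip        : ∀ {σ} → ⟨ skip , σ ⟩⇓[ 1 ] σ
  assign      : ∀ {x e σ} →
                ⟨ x ≔ e , σ ⟩⇓[ suc (cost e) ] (σ Vec.[ x ]≔ ⟦ e ⟧ σ)
  seq         : ∀ {C D ρ σ τ k l} →
                ⟨ C , ρ ⟩⇓[ k ] σ → ⟨ D , σ ⟩⇓[ l ] τ →
                ⟨ C ⨾ D , ρ ⟩⇓[ k ℕ.+ l ] τ
  cond-true   : ∀ {e C D σ τ k} → IsNode (⟦ e ⟧ σ) → ⟨ C , σ ⟩⇓[ k ] τ →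
                ⟨ cond e C D , σ ⟩⇓[ suc (cost e) ℕ.+ k ] τ
  cond-false  : ∀ {e C D σ τ k} → ⟦ e ⟧ σ ≡ nil → ⟨ D , σ ⟩⇓[ k ] τ →
                ⟨ cond e C D , σ ⟩⇓[ suc (cost e) ℕ.+ k ] τ
  while-true  : ∀ {e C ρ σ τ k l} → IsNode (⟦ e ⟧ ρ) →
                ⟨ C , ρ ⟩⇓[ k ] σ → ⟨ while e C , σ ⟩⇓[ l ] τ →
                ⟨ while e C , ρ ⟩⇓[ suc (cost e) ℕ.+ (k ℕ.+ l) ] τ
  while-false : ∀ {e C σ} → ⟦ e ⟧ σ ≡ nil →
                ⟨ while e C , σ ⟩⇓[ suc (cost e) ] σ

-- Variable zero holds the input and the output.
record Program : Set where
  field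
    #auxiliary : ℕ
    body       : Command (suc #auxiliary)

initial : ∀ {n} → Tree → Store (suc n)
initial x = x ∷ Vec.replicate _ nil

HaltsWithin : Program → Tree → ℕ → Tree → Set
HaltsWithin P x b y =
  ∃₂ λ k σ → ⟨ Program.body P , initial x ⟩⇓[ k ] σ × k ℕ.≤ b × Vec.head σ ≡ y

------------------------------------------------------------------------
-- Encoding of instances

list : List Tree → Tree
list = List.foldr _∙_ nil

-- Numbers are in unary.
nat : ℕ → Tree
nat n = list (List.replicate n nil)

bool : Bool → Tree
bool false = nil
bool true  = nil ∙ nil

encodeTask : Task → Tree
encodeTask τ = nat (deadline τ) ∙ nat (period τ) ∙ list (tabulate encodeVertex)
  where
  encodeVertex : Fin (#vertices τ) → Tree
  encodeVertex v = nat (processingTime τ v) ∙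
                   list (List.map bool (Vec.toList (successors τ v)))

encode : TaskSystem → ℕ → Tree
encode 𝒯 m = nat m ∙ list (List.map encodeTask 𝒯)

taskSize : Task → ℕ
taskSize τ = #vertices τ ℕ.+ #edges τ ℕ.+ sum (tabulate (processingTime τ))
             ℕ.+ deadline τ ℕ.+ period τ

size : TaskSystem → ℕ
size 𝒯 = length 𝒯 ℕ.+ sum (List.map taskSize 𝒯)

-- The bound does not depend on m; as m is in unary, a program can inspect as
-- much of it as it needs.
PseudopolynomialTime : Program → Set
PseudopolynomialTime P =
  ∃₂ λ a d → ∀ 𝒯 m .{{_ : NonZero m}} →
  ∃ λ y → HaltsWithin P (encode 𝒯 m) (a ℕ.* suc (size 𝒯) ℕ.^ d) y

Accepts Rejects : Program → TaskSystem → ℕ → Set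
Accepts P 𝒯 m = ∃₂ λ b y → HaltsWithin P (encode 𝒯 m) b y × IsNode y
Rejects P 𝒯 m = ∃ λ b → HaltsWithin P (encode 𝒯 m) b nil

{-# OPTIONS --safe #-}

-- Let S∞ be the schedule that runs every job as soon as its predecessors are
-- completed, on infinitely many unit-speed processors.  No unit-speed schedule is
-- ever ahead of S∞ on any job.  Hence, when every task releases its dag-jobs as
-- late and as densely as possible before a common time, the work that S∞ does in
-- the last t time units before it has to be done then by every valid schedule; if
-- this demand exceeds m t, the system is infeasible.
--
-- Conversely, follow EDF until a time d and consider only jobs with deadline at
-- most d.  While some processor is not busy with such jobs, let a time θ grow at
-- the speed α of EDF, but never beyond the current time; otherwise let it rest.
-- Then S∞ at time θ is never ahead of EDF.  If t₀ is the last time at which θ was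
-- the current time, EDF does at least (α m - m + 1) (d - t₀) units of work during
-- [t₀ , d), and had no more left at t₀ than S∞.  For α = 2 - 1/m + ε this is
-- (1 + ε) m (d - t₀), so EDF meets its deadlines if the demand of length t never
-- exceeds (1 + ε) m t.
--
-- The demand is subadditive up to an additive constant C = Σ D (Σ p), so it is at
-- most (1 + ε) m t for all t once it is at most m t for all t up to the horizon
-- n C + 1, where n ε ≥ 1.  The test computes these finitely many demands.

module Submission where

open import Defs
open import Algebra.Bundles using (RawRing)
import Algebra.Construct.NaturalChoice.Min
open import Algebra.Definitions.RawMonoid using () renaming (sum to sumᵛ)
import Algebra.Properties.AbelianGroup
import Algebra.Properties.Ring
import Algebra.Properties.Semiring.Mult
import Algebra.Solver.Ring
open import Algebra.Solver.Ring.AlmostCommutativeRing using (_-Raw-AlmostCommutative⟶_; fromCommutativeRing)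
open import Data.Bool.Base using (Bool; true; false; T; if_then_else_; _∧_; _∨_)
open import Data.Bool.ListAction using (any)
import Data.Bool.Properties as Boolₚ
open import Data.Empty using (⊥-elim)
open import Data.Fin.Base using (Fin; zero; suc; toℕ)
open import Data.Fin.Patterns using (0F; 1F; 2F; 3F)
open import Data.Fin.Properties using (all?)
open import Data.List.Base as List using (List; []; _∷_; _++_; _∷ʳ_; length; allFin; concatMap; downFrom; foldl; reverse)
open import Data.List.Membership.Propositional as Membership using (_∈_)
import Data.List.Membership.Propositional.Properties as ∈ₚ
import Data.List.Properties as Listₚ
open import Data.List.Relation.Unary.All as All using (All; []; _∷_)
import Data.List.Relation.Unary.All.Properties as Allₚ
open import Data.List.Relation.Unary.AllPairs as AllPairs using (AllPairs; []; _∷_)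
import Data.List.Relation.Unary.AllPairs.Properties as AllPairsₚ
open import Data.List.Relation.Unary.Any using (here; there)
import Data.List.Relation.Unary.Any.Properties as Anyₚ
open import Data.List.Relation.Unary.Unique.Propositional using (Unique)
import Data.List.Relation.Unary.Unique.Propositional.Properties as Uniqueₚ
open import Data.Maybe.Base using (Maybe; just; nothing)
import Data.Maybe.Properties as Maybeₚ
open import Data.Nat.Base as ℕ using (ℕ; zero; suc; NonZero; z≤n; s≤s)
open import Data.Nat.Divisibility using (_∣_; _∣?_; _∣0; ∣-refl; ∣m∣n⇒∣m+n; ∣m+n∣m⇒∣n; ∣⇒≤)
open import Data.Nat.ListAction using (sum)
import Data.Nat.Properties as ℕₚ
import Data.Nat.Solver
open import Data.Product.Base using (∃; ∃₂; _×_; _,_; proj₁; proj₂)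
open import Data.Sum.Base as Sum using (_⊎_; inj₁; inj₂)
open import Data.Unit.Base using (tt)
open import Data.Vec.Base as Vec using (Vec; []; _∷_)
import Data.Vec.Properties as Vecₚ
open import Data.Vec.Relation.Unary.All as VecAll using ([]; _∷_) renaming (All to VecAll)
import Data.Vec.Relation.Unary.All.Properties as VecAllₚ
open import Function.Base using (_∘_; id; _|>_)
open import Function.Bundles using (Equivalence)
open import Level using (_⊔_; Lift; lift; lower)
open import Relation.Binary.Bundles using (DecTotalOrder)
open import Relation.Binary.Definitions using (tri<; tri≈; tri>)
open import Relation.Binary.PropositionalEquality as ≡ using (_≡_; _≢_)
import Relation.Binary.Reasoning.Setoid
open import Relation.Binary.Structures using (IsDecTotalOrder)
open import Relation.Nullary using (¬_; Dec; yes; no; does; isYes)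
open import Relation.Nullary.Decidable using (T?; toWitness; fromWitness)

-- The factor `α m - m + 1` arises as follows. Since t₀, let B be the time during which all
-- processors run jobs due by d, and N the remaining time. While at least one such job runs during
-- N, EDF does work at rate at least α and θ grows at rate α; if none runs, θ can jump to the
-- current time, where t₀ starts afresh. So the work is at least α m B + α N = α m (d - t₀) - (m -
-- 1) α N. As θ does not overtake the clock, α N ≤ d - t₀, which leaves (α m - m + 1) (d - t₀). At α
-- = 2 - 1/m this is m (d - t₀); the ε pays for checking only finitely many lengths.
--
-- An arbitrary ordered field offers no supremum that would yield t₀. Hence t₀ is carried along as
-- data of an invariant, and time is traversed in finitely many steps, cut at context switches and
-- at integers, between which both EDF and S∞ have constant rates. The program, in turn, needs a
-- proved time bound that does not depend on m; this is why m is kept apart from the trees that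
-- drive its loops.

-- Arithmetic in an ordered field

module OrderedField {c ℓ₁ ℓ₂} (𝕂 : ArchimedeanOrderedField c ℓ₁ ℓ₂) where

  open ArchimedeanOrderedField 𝕂
  open IsDecTotalOrder isDecTotalOrder public
    using (total; antisym; ≤-respˡ-≈; ≤-respʳ-≈)
    renaming (refl to ≤-refl; reflexive to ≤-reflexive; trans to ≤-trans;
              _≟_ to _≈?_; _≤?_ to _≤?_)

  private
    module Mult = Algebra.Properties.Semiring.Mult semiring
    module Neg = Algebra.Properties.Ring ring
    module Ab = Algebra.Properties.AbelianGroup +-abelianGroup
    module ≈-R = Relation.Binary.Reasoning.Setoid setoid

  ι-+ : ∀ a b → ι (a ℕ.+ b) ≈ ι a + ι b
  ι-+ a b = Mult.×-homo-+ 1# a b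

  ι-* : ∀ a b → ι (a ℕ.* b) ≈ ι a * ι b
  ι-* a b = Mult.×1-homo-* a b

  ι-suc : ∀ a → ι (suc a) ≈ ι a + 1#
  ι-suc a = +-comm _ _

  -- Differences a − b of natural numbers serve as the coefficients of the
  -- ring solver; the solver needs equal coefficients to be identical.
  reduce : ℕ × ℕ → ℕ × ℕ
  reduce (a , b) = a ℕ.∸ b , b ℕ.∸ a

  Coefficient : RawRing _ _
  Coefficient = record
    { Carrier = ℕ × ℕ
    ; _≈_ = _≡_
    ; _+_ = λ { (a , b) (c , d) → reduce (a ℕ.+ c , b ℕ.+ d) }
    ; _*_ = λ { (a , b) (c , d) → reduce (a ℕ.* c ℕ.+ b ℕ.* d , a ℕ.* d ℕ.+ b ℕ.* c) }
    ; -_ = λ { (a , b) → b , a }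
    ; 0# = 0 , 0
    ; 1# = 1 , 0
    }

  difference : ℕ × ℕ → Carrier
  difference (a , b) = ι a - ι b

  private
    module C = RawRing Coefficient

    interchange : ∀ x y z w → (x + y) + (z + w) ≈ (x + z) + (y + w)
    interchange x y z w = begin
      (x + y) + (z + w) ≈⟨ +-assoc x y _ ⟩
      x + (y + (z + w)) ≈⟨ +-congˡ (+-assoc y z w) ⟨
      x + ((y + z) + w) ≈⟨ +-congˡ (+-congʳ (+-comm y z)) ⟩
      x + ((z + y) + w) ≈⟨ +-congˡ (+-assoc z y w) ⟩
      x + (z + (y + w)) ≈⟨ +-assoc x z _ ⟨
      (x + z) + (y + w) ∎
      where open ≈-R

    difference-≈ : ∀ {a b c d} → a ℕ.+ d ≡ c ℕ.+ b → difference (a , b) ≈ difference (c , d)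
    difference-≈ {a} {b} {c} {d} eq = begin
      ι a - ι b                   ≈⟨ +-identityʳ _ ⟨
      (ι a - ι b) + 0#            ≈⟨ +-congˡ (-‿inverseʳ (ι d)) ⟨
      (ι a - ι b) + (ι d - ι d)   ≈⟨ interchange _ _ _ _ ⟩
      (ι a + ι d) + (- ι b - ι d) ≈⟨ +-congʳ (trans (sym (ι-+ a d)) (trans (reflexive (≡.cong ι eq)) (ι-+ c b))) ⟩
      (ι c + ι b) + (- ι b - ι d) ≈⟨ +-assoc _ _ _ ⟩
      ι c + (ι b + (- ι b - ι d)) ≈⟨ +-congˡ (+-assoc _ _ _) ⟨
      ι c + ((ι b - ι b) - ι d)   ≈⟨ +-congˡ (+-congʳ (-‿inverseʳ _)) ⟩
      ι c + (0# - ι d)            ≈⟨ +-congˡ (+-identityˡ _) ⟩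
      ι c - ι d                   ∎
      where open ≈-R

    difference-reduce : ∀ p → difference (reduce p) ≈ difference p
    difference-reduce (a , b) = difference-≈ {a ℕ.∸ b} {b ℕ.∸ a} {a} {b} (swap a b)
      where
      swap : ∀ a b → (a ℕ.∸ b) ℕ.+ b ≡ a ℕ.+ (b ℕ.∸ a)
      swap zero    b       = ≡.cong (ℕ._+ b) (ℕₚ.0∸n≡0 b)
      swap (suc a) zero    = ≡.refl
      swap (suc a) (suc b) = ≡.trans (ℕₚ.+-suc (a ℕ.∸ b) b) (≡.cong suc (swap a b))

    difference-+ : ∀ p q → difference (p C.+ q) ≈ difference p + difference q
    difference-+ (a , b) (c , d) = begin
      difference (reduce (a ℕ.+ c , b ℕ.+ d)) ≈⟨ difference-reduce (a ℕ.+ c , b ℕ.+ d) ⟩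
      ι (a ℕ.+ c) - ι (b ℕ.+ d)         ≈⟨ +-cong (ι-+ a c) (-‿cong (ι-+ b d)) ⟩
      (ι a + ι c) - (ι b + ι d)         ≈⟨ +-congˡ (Ab.⁻¹-∙-comm (ι b) (ι d)) ⟨
      (ι a + ι c) + (- ι b + - ι d)     ≈⟨ interchange _ _ _ _ ⟩
      (ι a - ι b) + (ι c - ι d)         ∎
      where open ≈-R

    difference-neg : ∀ p → difference (C.- p) ≈ - difference p
    difference-neg (a , b) = begin
      ι b - ι a           ≈⟨ +-congʳ (Ab.⁻¹-involutive (ι b)) ⟨
      - - ι b - ι a       ≈⟨ +-comm _ _ ⟩
      - ι a - - ι b       ≈⟨ Ab.⁻¹-∙-comm _ _ ⟩
      - (ι a - ι b)       ∎
      where open ≈-R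

    difference-* : ∀ p q → difference (p C.* q) ≈ difference p * difference q
    difference-* (a , b) (c , d) = begin
      difference (reduce (a ℕ.* c ℕ.+ b ℕ.* d , a ℕ.* d ℕ.+ b ℕ.* c))
        ≈⟨ difference-reduce (a ℕ.* c ℕ.+ b ℕ.* d , a ℕ.* d ℕ.+ b ℕ.* c) ⟩
      ι (a ℕ.* c ℕ.+ b ℕ.* d) - ι (a ℕ.* d ℕ.+ b ℕ.* c)
        ≈⟨ +-cong (trans (ι-+ (a ℕ.* c) _) (+-cong (ι-* a c) (ι-* b d)))
                  (-‿cong (trans (ι-+ (a ℕ.* d) _) (+-cong (ι-* a d) (ι-* b c)))) ⟩
      (ι a * ι c + ι b * ι d) - (ι a * ι d + ι b * ι c)
        ≈⟨ +-congˡ (Ab.⁻¹-∙-comm _ _) ⟨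
      (ι a * ι c + ι b * ι d) + (- (ι a * ι d) + - (ι b * ι c))
        ≈⟨ interchange _ _ _ _ ⟩
      (ι a * ι c + - (ι a * ι d)) + (ι b * ι d + - (ι b * ι c))
        ≈⟨ +-cong (minus (ι a) (ι c) (ι d)) (trans (minus (ι b) (ι d) (ι c)) swap) ⟩
      ι a * (ι c - ι d) + - ι b * (ι c - ι d)
        ≈⟨ distribʳ _ _ _ ⟨
      (ι a - ι b) * (ι c - ι d) ∎
      where
      open ≈-R
      minus : ∀ x y z → x * y + - (x * z) ≈ x * (y - z)
      minus x y z = trans (+-congˡ (Neg.-‿distribʳ-* x z)) (sym (distribˡ x y (- z)))
      swap : ι b * (ι d - ι c) ≈ - ι b * (ι c - ι d)
      swap = begin
        ι b * (ι d - ι c)     ≈⟨ *-congˡ (difference-neg (c , d)) ⟩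
        ι b * - (ι c - ι d)   ≈⟨ Neg.-‿distribʳ-* _ _ ⟨
        - (ι b * (ι c - ι d)) ≈⟨ Neg.-‿distribˡ-* _ _ ⟩
        - ι b * (ι c - ι d)   ∎

    -- Unlike difference, this is 0# at (0 , 0) and 1# at (1 , 0) by
    -- computation, as the solver needs for its constants.
    coefficient : ℕ × ℕ → Carrier
    coefficient (0 , 0) = 0#
    coefficient (1 , 0) = 1#
    coefficient p       = difference p

    coefficient≈ : ∀ p → coefficient p ≈ difference p
    coefficient≈ (0 , 0)             = sym (-‿inverseʳ 0#)
    coefficient≈ (1 , 0)             =
      sym (trans (+-congˡ Ab.ε⁻¹≈ε) (trans (+-identityʳ _) (+-identityʳ _)))
    coefficient≈ (suc (suc _) , 0)   = refl
    coefficient≈ (0 , suc _)         = refl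
    coefficient≈ (1 , suc _)         = refl
    coefficient≈ (suc (suc _) , suc _) = refl

    coefficient-≟ : ∀ p q → Maybe (coefficient p ≈ coefficient q)
    coefficient-≟ p@(a , b) q@(c , d) with a ℕ.+ d ℕₚ.≟ c ℕ.+ b
    ... | no _ = nothing
    ... | yes eq = just (trans (coefficient≈ p)
      (trans (difference-≈ {a} {b} {c} {d} eq) (sym (coefficient≈ q))))

    morphism : Coefficient -Raw-AlmostCommutative⟶ fromCommutativeRing commutativeRing
    morphism = record
      { ⟦_⟧ = coefficient
      ; +-homo = λ p q → trans (coefficient≈ (p C.+ q)) (trans (difference-+ p q)
                           (sym (+-cong (coefficient≈ p) (coefficient≈ q))))
      ; *-homo = λ p q → trans (coefficient≈ (p C.* q)) (trans (difference-* p q)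
                           (sym (*-cong (coefficient≈ p) (coefficient≈ q))))
      ; -‿homo = λ p → trans (coefficient≈ (C.- p)) (trans (difference-neg p)
                           (sym (-‿cong (coefficient≈ p))))
      ; 0-homo = refl
      ; 1-homo = refl
      }

  open Algebra.Solver.Ring Coefficient (fromCommutativeRing commutativeRing) morphism coefficient-≟ public
    using (solve; _:=_; _:+_; _:*_; _:-_; :-_; con; Polynomial)

  :1 :0 : ∀ {n} → Polynomial n
  :1 = con (1 , 0)
  :0 = con (0 , 0)

  module Min′ = Algebra.Construct.NaturalChoice.Min (DecTotalOrder.totalOrder decTotalOrder)

  ≈⇒≤ : ∀ {x y} → x ≈ y → x ≤ y
  ≈⇒≤ = ≤-reflexive

  +-monoˡ-≤ : ∀ z {x y} → x ≤ y → x + z ≤ y + z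
  +-monoˡ-≤ z {x} {y} x≤y =
    ≤-respˡ-≈ (+-comm z x) (≤-respʳ-≈ (+-comm z y) (+-monoʳ-≤ z x≤y))

  +-mono-≤ : ∀ {x y z w} → x ≤ y → z ≤ w → x + z ≤ y + w
  +-mono-≤ x≤y z≤w = ≤-trans (+-monoˡ-≤ _ x≤y) (+-monoʳ-≤ _ z≤w)

  ∸≥0 : ∀ {x y} → x ≤ y → 0# ≤ y - x
  ∸≥0 {x} x≤y = ≤-respˡ-≈ (-‿inverseʳ x) (+-monoˡ-≤ (- x) x≤y)

  -- An inequality x ≤ y is proved by exhibiting y - x as a nonnegative
  -- expression, the equality being left to the ring solver.
  certificate : ∀ {x y e} → 0# ≤ e → y - x ≈ e → x ≤ y
  certificate {x} {y} 0≤e y-x≈e =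
    ≤-respˡ-≈ (+-identityʳ x)
      (≤-respʳ-≈ (solve 2 (λ x y → x :+ (y :- x) := y) refl x y)
        (+-monoʳ-≤ x (≤-respʳ-≈ (sym y-x≈e) 0≤e)))

  infixl 6 _⊞_
  infixl 7 _⊠_

  _⊞_ : ∀ {x y} → 0# ≤ x → 0# ≤ y → 0# ≤ x + y
  0≤x ⊞ 0≤y = ≤-respˡ-≈ (+-identityʳ 0#) (+-mono-≤ 0≤x 0≤y)

  _⊠_ : ∀ {x y} → 0# ≤ x → 0# ≤ y → 0# ≤ x * y
  _⊠_ = *-nonNeg

  0≤1 : 0# ≤ 1#
  0≤1 with total 0# 1#
  ... | inj₁ 0≤1 = 0≤1
  ... | inj₂ 1≤0 = ≤-respʳ-≈ (solve 0 ((:0 :- :1) :* (:0 :- :1) := :1) refl)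
                     (∸≥0 1≤0 ⊠ ∸≥0 1≤0)

  1≰0 : ¬ 1# ≤ 0#
  1≰0 1≤0 = 0≉1 (antisym 0≤1 1≤0)

  ≰⇒≥ : ∀ {x y} → ¬ x ≤ y → y ≤ x
  ≰⇒≥ {x} {y} x≰y with total x y
  ... | inj₁ x≤y = ⊥-elim (x≰y x≤y)
  ... | inj₂ y≤x = y≤x

  <⇒≰ : ∀ {x y} → x < y → ¬ y ≤ x
  <⇒≰ (x≤y , x≉y) y≤x = x≉y (antisym x≤y y≤x)

  ≰⇒> : ∀ {x y} → ¬ x ≤ y → y < x
  ≰⇒> x≰y = ≰⇒≥ x≰y , λ y≈x → x≰y (≈⇒≤ (sym y≈x))

  <-≤-trans : ∀ {x y z} → x < y → y ≤ z → x < z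
  <-≤-trans x<y y≤z =
    ≤-trans (proj₁ x<y) y≤z , λ x≈z → <⇒≰ x<y (≤-respʳ-≈ (sym x≈z) y≤z)

  ι-nonNeg : ∀ n → 0# ≤ ι n
  ι-nonNeg zero    = ≤-refl
  ι-nonNeg (suc n) = 0≤1 ⊞ ι-nonNeg n

  ι-mono-≤ : ∀ {m n} → m ℕ.≤ n → ι m ≤ ι n
  ι-mono-≤ {n = n} ℕ.z≤n = ι-nonNeg n
  ι-mono-≤ (ℕ.s≤s m≤n)   = +-monoʳ-≤ 1# (ι-mono-≤ m≤n)

  -- Estimates made in the field, such as the capacity of a schedule, return to natural numbers
  -- through this.
  ι-cancel-≤ : ∀ {m n} → ι m ≤ ι n → m ℕ.≤ n
  ι-cancel-≤ {m} {n} ιm≤ιn with m ℕₚ.≤? n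
  ... | yes m≤n = m≤n
  ... | no  m≰n = ⊥-elim (1≰0 (certificate
    (∸≥0 ιm≤ιn ⊞ ∸≥0 (ι-mono-≤ (ℕₚ.≰⇒> m≰n)))
    (solve 2 (λ m n → :0 :- :1 := (n :- m) :+ (m :- (:1 :+ n))) refl (ι m) (ι n))))

  *-monoˡ-≤ : ∀ {x y z} → 0# ≤ z → x ≤ y → z * x ≤ z * y
  *-monoˡ-≤ {x} {y} {z} 0≤z x≤y = certificate (0≤z ⊠ ∸≥0 x≤y)
    (solve 3 (λ x y z → z :* y :- z :* x := z :* (y :- x)) refl x y z)

  >⇒≉0 : ∀ {x} → 0# < x → ¬ x ≈ 0#
  >⇒≉0 (_ , 0≉x) x≈0 = 0≉x (sym x≈0)

  ⁻¹-nonNeg : ∀ {x} → 0# < x → 0# ≤ x ⁻¹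
  ⁻¹-nonNeg {x} 0<x with total 0# (x ⁻¹)
  ... | inj₁ 0≤x⁻¹ = 0≤x⁻¹
  ... | inj₂ x⁻¹≤0 = ⊥-elim (1≰0 (≤-respˡ-≈ (⁻¹-inverseʳ (>⇒≉0 0<x))
    (≤-respʳ-≈ (zeroʳ x) (*-monoˡ-≤ (proj₁ 0<x) x⁻¹≤0))))

  *-cancelˡ-≤ : ∀ {x y z} → 0# < z → z * x ≤ z * y → x ≤ y
  *-cancelˡ-≤ {x} {y} {z} 0<z zx≤zy =
    ≤-respˡ-≈ (cancel x) (≤-respʳ-≈ (cancel y) (*-monoˡ-≤ (⁻¹-nonNeg 0<z) zx≤zy))
    where
    cancel : ∀ w → z ⁻¹ * (z * w) ≈ w
    cancel w = trans (sym (*-assoc _ _ _))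
      (trans (*-congʳ (trans (*-comm _ _) (⁻¹-inverseʳ (>⇒≉0 0<z)))) (*-identityˡ w))

-- Finite sums and counting

module Sums where

  open import Data.Nat.Base using (_+_; _*_; _≤_)

  sumOver : ∀ {a} {A : Set a} → List A → (A → ℕ) → ℕ
  sumOver xs f = sum (List.map f xs)

  module _ {a} {A : Set a} where

    sumOver-mono : ∀ (xs : List A) {f g} → (∀ x → f x ≤ g x) → sumOver xs f ≤ sumOver xs g
    sumOver-mono []       f≤g = z≤n
    sumOver-mono (x ∷ xs) f≤g = ℕₚ.+-mono-≤ (f≤g x) (sumOver-mono xs f≤g)

    sumOver-cong : ∀ (xs : List A) {f g} → (∀ x → f x ≡ g x) → sumOver xs f ≡ sumOver xs g
    sumOver-cong []       f≡g = ≡.refl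
    sumOver-cong (x ∷ xs) f≡g = ≡.cong₂ _+_ (f≡g x) (sumOver-cong xs f≡g)

    sumOver-+ : ∀ (xs : List A) f g → sumOver xs (λ x → f x + g x) ≡ sumOver xs f + sumOver xs g
    sumOver-+ []       f g = ≡.refl
    sumOver-+ (x ∷ xs) f g = ≡.trans (≡.cong (f x + g x +_) (sumOver-+ xs f g))
      (solve 4 (λ a b c d → (a :+ b) :+ (c :+ d) := (a :+ c) :+ (b :+ d)) ≡.refl
        (f x) (g x) (sumOver xs f) (sumOver xs g))
      where open Data.Nat.Solver.+-*-Solver

    sumOver-* : ∀ (xs : List A) c f → sumOver xs (λ x → c * f x) ≡ c * sumOver xs f
    sumOver-* []       c f = ≡.sym (ℕₚ.*-zeroʳ c)
    sumOver-* (x ∷ xs) c f = ≡.trans (≡.cong (c * f x +_) (sumOver-* xs c f))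
      (≡.sym (ℕₚ.*-distribˡ-+ c (f x) _))

    sumOver-++ : ∀ (xs ys : List A) f → sumOver (xs ++ ys) f ≡ sumOver xs f + sumOver ys f
    sumOver-++ []       ys f = ≡.refl
    sumOver-++ (x ∷ xs) ys f =
      ≡.trans (≡.cong (f x +_) (sumOver-++ xs ys f)) (≡.sym (ℕₚ.+-assoc (f x) _ _))

    sumOver≡0 : ∀ (xs : List A) f → sumOver xs f ≤ 0 → All (λ x → f x ≡ 0) xs
    sumOver≡0 []       f _ = []
    sumOver≡0 (x ∷ xs) f s≤0 =
      ℕₚ.n≤0⇒n≡0 (ℕₚ.≤-trans (ℕₚ.m≤m+n (f x) _) s≤0) ∷
      sumOver≡0 xs f (ℕₚ.≤-trans (ℕₚ.m≤n+m _ (f x)) s≤0)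

    sumOver-mono-All : ∀ {xs : List A} {f g} → All (λ x → f x ≤ g x) xs →
                       sumOver xs f ≤ sumOver xs g
    sumOver-mono-All []          = z≤n
    sumOver-mono-All (f≤g ∷ all) = ℕₚ.+-mono-≤ f≤g (sumOver-mono-All all)

  sumOver-concatMap : ∀ {a b} {A : Set a} {B : Set b} (g : A → List B) xs f →
                      sumOver (concatMap g xs) f ≡ sumOver xs (λ x → sumOver (g x) f)
  sumOver-concatMap g []       f = ≡.refl
  sumOver-concatMap g (x ∷ xs) f = ≡.trans (sumOver-++ (g x) (concatMap g xs) f)
    (≡.cong (sumOver (g x) f +_) (sumOver-concatMap g xs f))

module Counting where

  open import Data.Nat.Base using (_+_; _*_; _≤_)
  open Sums

  indicator : ∀ {p} {P : Set p} → Dec P → ℕ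
  indicator P? = if does P? then 1 else 0

  module _ {a} {A : Set a} where

    ∈⇒≤sumOver : ∀ {xs : List A} {x} f → x ∈ xs → f x ≤ sumOver xs f
    ∈⇒≤sumOver f (here ≡.refl)      = ℕₚ.m≤m+n _ _
    ∈⇒≤sumOver f (there {x = y} x∈) = ℕₚ.≤-trans (∈⇒≤sumOver f x∈) (ℕₚ.m≤n+m _ (f y))

    module _ {p} {P : A → Set p} (P? : ∀ x → Dec (P x)) where

      count : List A → ℕ
      count xs = sumOver xs (λ x → indicator (P? x))

      count-none : ∀ xs → All (λ x → ¬ P x) xs → count xs ≡ 0
      count-none []       []         = ≡.refl
      count-none (x ∷ xs) (¬px ∷ ¬p) with P? x
      ... | yes px = ⊥-elim (¬px px)
      ... | no  _  = count-none xs ¬p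

      count-≤1 : ∀ {xs} → Unique xs → (∀ {x y} → P x → P y → x ≡ y) → count xs ≤ 1
      count-≤1 []                     unique = z≤n
      count-≤1 {x ∷ xs} (x∉ ∷ uniqxs) unique with P? x
      ... | yes px = ℕₚ.≤-reflexive (≡.cong suc
              (count-none xs (All.map (λ x≢y py → x≢y (unique px py)) x∉)))
      ... | no  _  = count-≤1 uniqxs unique

      count-≥1 : ∀ {xs x} → x ∈ xs → P x → 1 ≤ count xs
      count-≥1 {xs} {x} x∈ px = ℕₚ.≤-trans (1≤ (P? x)) (∈⇒≤sumOver _ x∈)
        where
        1≤ : (d : Dec (P x)) → 1 ≤ indicator d
        1≤ (yes _)  = ℕₚ.≤-refl
        1≤ (no ¬px) = ⊥-elim (¬px px)

  sumOver-const : ∀ {a} {A : Set a} (xs : List A) c → sumOver xs (λ _ → c) ≡ length xs * c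
  sumOver-const []       c = ≡.refl
  sumOver-const (x ∷ xs) c = ≡.cong (c +_) (sumOver-const xs c)

  sumOver-swap : ∀ {a b} {A : Set a} {B : Set b} (xs : List A) (ys : List B) (f : A → B → ℕ) →
                 sumOver xs (λ x → sumOver ys (f x)) ≡ sumOver ys (λ y → sumOver xs (λ x → f x y))
  sumOver-swap []       ys f = ≡.sym (≡.trans (sumOver-const ys 0) (ℕₚ.*-zeroʳ (length ys)))
  sumOver-swap (x ∷ xs) ys f = ≡.trans (≡.cong (sumOver ys (f x) +_) (sumOver-swap xs ys f))
    (≡.sym (sumOver-+ ys (f x) (λ y → sumOver xs (λ x → f x y))))

  sumOver-lookup : ∀ {a} {A : Set a} (xs : List A) f →
                   sumOver (allFin (length xs)) (λ i → f (List.lookup xs i)) ≡ sumOver xs f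
  sumOver-lookup xs f = ≡.cong sum (≡.trans (Listₚ.map-tabulate id (λ i → f (List.lookup xs i)))
    (≡.trans (≡.sym (Listₚ.map-tabulate (List.lookup xs) f))
      (≡.cong (List.map f) (Listₚ.tabulate-lookup xs))))

-- The demand of a task system

-- The schedule S∞ of a dag-job released at time 0 on infinitely many unit-speed
-- processors, and the demand that it forces upon an interval.
module Demand where

  open import Data.Nat.Base using (_+_; _*_; _∸_; _⊓_; _≤_; _<_; pred; s≤s⁻¹)
  open Sums
  open Task

  positive : ℕ → Bool
  positive zero    = false
  positive (suc _) = true

  blocked : (τ : Task) → (Fin (#vertices τ) → ℕ) → Fin (#vertices τ) → Bool
  blocked τ r w = any (λ u → positive (r u) ∧ Vec.lookup (successors τ u) w) (allFin _)

  -- The work of each vertex that S∞ has left at an integral time.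
  remaining : (τ : Task) → ℕ → Fin (#vertices τ) → ℕ
  remaining τ zero    = processingTime τ
  remaining τ (suc y) w =
    if blocked τ (remaining τ y) w then remaining τ y w else pred (remaining τ y w)

  residual : Task → ℕ → ℕ
  residual τ y = sumOver (allFin _) (remaining τ y)

  volume : Task → ℕ
  volume τ = residual τ 0

  -- The work that S∞ does in the last x time units before the deadline.
  lateWork : Task → ℕ → ℕ
  lateWork τ x = residual τ (deadline τ ∸ x)

  -- The same for n dag-jobs released as late and as densely as possible.
  demandOf : Task → ℕ → ℕ → ℕ
  demandOf τ zero    x = 0
  demandOf τ (suc n) x = lateWork τ x + demandOf τ n (x ∸ period τ)

  -- Periods are at least 1, so among `suc x` dag-jobs the last one has an empty window. At x = 0
  -- the single term is `lateWork τ 0`, by which length 0 detects a task that misses its deadline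
  -- even in S∞.
  demand : Task → ℕ → ℕ
  demand τ x = demandOf τ (suc x) x

  totalDemand : TaskSystem → ℕ → ℕ
  totalDemand 𝒯 x = sumOver 𝒯 (λ τ → demand τ x)

  module _ (τ : Task) where

    blocked⇒ : ∀ r w → T (blocked τ r w) → ∃ λ u → Edge τ u w × r u ≢ 0
    blocked⇒ r w b with Membership.find (Anyₚ.any⁻ _ (allFin _) b)
    ... | u , _ , p with r u in eq
    ...   | suc _ = u , Vecₚ.lookup⇒[]= w _ (Equivalence.to Boolₚ.T-≡ p)
                  , λ ru≡0 → ℕₚ.1+n≢0 (≡.trans (≡.sym eq) ru≡0)

    ⇒blocked : ∀ r u w → Edge τ u w → r u ≢ 0 → T (blocked τ r w)
    ⇒blocked r u w e ru≢0 = Anyₚ.any⁺ _ (Membership.lose (∈ₚ.∈-allFin u) at-u)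
      where
      at-u : T (positive (r u) ∧ Vec.lookup (successors τ u) w)
      at-u with r u
      ... | zero  = ⊥-elim (ru≢0 ≡.refl)
      ... | suc _ = Equivalence.from Boolₚ.T-≡ (Vecₚ.[]=⇒lookup e)

    -- Processing times are integers, so S∞ switches jobs only at integral times and unit steps
    -- describe it completely. Finished vertices fall under either case: `pred 0` is 0.
    data Step (y : ℕ) (w : Fin (#vertices τ)) : Set where
      waits : ∀ u → Edge τ u w → remaining τ y u ≢ 0 →
              remaining τ (suc y) w ≡ remaining τ y w → Step y w
      runs  : (∀ u → Edge τ u w → remaining τ y u ≡ 0) →
              remaining τ (suc y) w ≡ pred (remaining τ y w) → Step y w

    step : ∀ y w → Step y w
    step y w with blocked τ (remaining τ y) w in eq
    ... | true =
      let u , e , ru≢0 = blocked⇒ (remaining τ y) w (Equivalence.from Boolₚ.T-≡ eq)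
      in  waits u e ru≢0 (≡.cong (λ b → if b then remaining τ y w else pred (remaining τ y w)) eq)
    ... | false = runs
      (λ u e → decide u e)
      (≡.cong (λ b → if b then remaining τ y w else pred (remaining τ y w)) eq)
      where
      decide : ∀ u → Edge τ u w → remaining τ y u ≡ 0
      decide u e with remaining τ y u ℕₚ.≟ 0
      ... | yes r≡0 = r≡0
      ... | no  r≢0 = ⊥-elim (≡.subst T eq (⇒blocked (remaining τ y) u w e r≢0))

    remaining-suc-≤ : ∀ y w → remaining τ (suc y) w ≤ remaining τ y w
    remaining-suc-≤ y w with step y w
    ... | waits _ _ _ eq = ℕₚ.≤-reflexive eq
    ... | runs _ eq      = ℕₚ.≤-trans (ℕₚ.≤-reflexive eq) ℕₚ.pred[n]≤n

    residual-antitone : ∀ {y z} → y ≤ z → residual τ z ≤ residual τ y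
    residual-antitone y≤z = go (ℕₚ.≤⇒≤′ y≤z)
      where
      go : ∀ {y z} → y ℕ.≤′ z → residual τ z ≤ residual τ y
      go ℕ.≤′-refl            = ℕₚ.≤-refl
      go (ℕ.≤′-step {z} y≤′z) =
        ℕₚ.≤-trans (sumOver-mono (allFin _) (remaining-suc-≤ z)) (go y≤′z)

    lateWork-mono : ∀ {x z} → x ≤ z → lateWork τ x ≤ lateWork τ z
    lateWork-mono x≤z = residual-antitone (ℕₚ.∸-monoʳ-≤ (deadline τ) x≤z)

    lateWork≤volume : ∀ x → lateWork τ x ≤ volume τ
    lateWork≤volume x = residual-antitone {0} {deadline τ ∸ x} z≤n

    demandOf-mono : ∀ {n k x z} → n ≤ k → x ≤ z → demandOf τ n x ≤ demandOf τ k z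
    demandOf-mono z≤n       x≤z = z≤n
    demandOf-mono (s≤s n≤k) x≤z =
      ℕₚ.+-mono-≤ (lateWork-mono x≤z) (demandOf-mono n≤k (ℕₚ.∸-monoˡ-≤ (period τ) x≤z))

    demand-mono : ∀ {x z} → x ≤ z → demand τ x ≤ demand τ z
    demand-mono x≤z = demandOf-mono (s≤s x≤z) x≤z

    period≥1 : 1 ≤ period τ
    period≥1 = ℕ.>-nonZero⁻¹ _ {{period-nonZero τ}}

    suc∸period≤ : ∀ x → suc x ∸ period τ ≤ x
    suc∸period≤ x = ℕₚ.∸-monoʳ-≤ (suc x) period≥1

    -- At time y, S∞ has residual τ (y ∸ r) left of the dag-job released at r.
    releasedResidual : (ℕ → Bool) → ℕ → ℕ → ℕ
    releasedResidual rel y r = if rel r then residual τ (y ∸ r) else 0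

    -- The release dates are visited from the latest down. A date with a release uses up one term of
    -- `demandOf` and, by the separation, shortens the window of all earlier ones by a period; a
    -- date without release uses up none. Truncation of the window at 0 only weakens the condition
    -- on the earlier deadlines.
    released-≤-demandOf :
      ∀ rel → (∀ {r u} → T (rel r) → T (rel u) → r < u → r + period τ ≤ u) →
      ∀ y N n x → N ≤ n → (∀ {r} → r < N → T (rel r) → deadline τ + r ≤ y + x) →
      sumOver (downFrom N) (releasedResidual rel y) ≤ demandOf τ n x
    released-≤-demandOf rel sep y zero    n x _ _ = z≤n
    released-≤-demandOf rel sep y (suc r) (suc n) x (s≤s r≤n) early with rel r in eq
    ... | false = released-≤-demandOf rel sep y r (suc n) x (ℕₚ.m≤n⇒m≤1+n r≤n)
                    (λ u<r → early (ℕₚ.m≤n⇒m≤1+n u<r))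
    ... | true = ℕₚ.+-mono-≤ (residual-antitone late)
                   (released-≤-demandOf rel sep y r n (x ∸ period τ) r≤n earlier)
      where
      rel-r : T (rel r)
      rel-r = Equivalence.from Boolₚ.T-≡ eq

      D+r≤y+x : deadline τ + r ≤ y + x
      D+r≤y+x = early ℕₚ.≤-refl rel-r

      late : deadline τ ∸ x ≤ y ∸ r
      late = ℕₚ.m≤n+o⇒m∸n≤o (deadline τ) x (ℕₚ.≤-trans
        (ℕₚ.m+n≤o⇒m≤o∸n (deadline τ) (ℕₚ.≤-trans D+r≤y+x (ℕₚ.≤-reflexive (ℕₚ.+-comm y x))))
        (ℕₚ.m≤n+o⇒m∸n≤o (x + y) r (ℕₚ.≤-trans (ℕₚ.+-monoʳ-≤ x (ℕₚ.m≤n+m∸n y r))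
          (ℕₚ.≤-reflexive (solve 3 (λ x r z → x :+ (r :+ z) := r :+ (x :+ z)) ≡.refl x r (y ∸ r))))))
        where open Data.Nat.Solver.+-*-Solver

      earlier : ∀ {u} → u < r → T (rel u) → deadline τ + u ≤ y + (x ∸ period τ)
      earlier {u} u<r rel-u = ℕₚ.+-cancelʳ-≤ (period τ) _ _ (begin
        deadline τ + u + period τ        ≡⟨ ℕₚ.+-assoc (deadline τ) u _ ⟩
        deadline τ + (u + period τ)      ≤⟨ ℕₚ.+-monoʳ-≤ (deadline τ) (sep rel-u rel-r u<r) ⟩
        deadline τ + r                   ≤⟨ D+r≤y+x ⟩
        y + x                            ≤⟨ ℕₚ.+-monoʳ-≤ y (ℕₚ.m≤n+m∸n x (period τ)) ⟩
        y + (period τ + (x ∸ period τ))  ≡⟨ ≡.cong (y +_) (ℕₚ.+-comm (period τ) _) ⟩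
        y + ((x ∸ period τ) + period τ)  ≡⟨ ℕₚ.+-assoc y _ _ ⟨
        y + (x ∸ period τ) + period τ    ∎)
        where open ℕₚ.≤-Reasoning

    downFrom-sum-mono : ∀ {N K} → N ≤ K → ∀ f → sumOver (downFrom N) f ≤ sumOver (downFrom K) f
    downFrom-sum-mono N≤K f = go (ℕₚ.≤⇒≤′ N≤K)
      where
      go : ∀ {N K} → N ℕ.≤′ K → sumOver (downFrom N) f ≤ sumOver (downFrom K) f
      go ℕ.≤′-refl          = ℕₚ.≤-refl
      go (ℕ.≤′-step {K} le) = ℕₚ.≤-trans (go le) (ℕₚ.m≤n+m _ (f K))

    -- The hypothesis says that S∞ meets the deadline of τ.
    module _ (lateWork0≡0 : lateWork τ 0 ≡ 0) where

      demandOf0≡0 : ∀ n → demandOf τ n 0 ≡ 0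
      demandOf0≡0 zero    = ≡.refl
      demandOf0≡0 (suc n) =
        ≡.cong₂ _+_ lateWork0≡0 (≡.trans (≡.cong (demandOf τ n) (ℕₚ.0∸n≡0 (period τ))) (demandOf0≡0 n))

      -- Each term shortens the window by at least 1, so x terms exhaust it; the terms after that
      -- are `lateWork τ 0`, which is 0.
      demandOf-stable : ∀ {n k x} → x ≤ n → x ≤ k → demandOf τ n x ≡ demandOf τ k x
      demandOf-stable {zero}  {k}     z≤n _ = ≡.sym (demandOf0≡0 k)
      demandOf-stable {suc n} {zero}  _ z≤n = demandOf0≡0 (suc n)
      demandOf-stable {suc n} {suc k} {zero} _ _ =
        ≡.trans (demandOf0≡0 (suc n)) (≡.sym (demandOf0≡0 (suc k)))
      demandOf-stable {suc n} {suc k} {suc x} (s≤s x≤n) (s≤s x≤k) = ≡.cong (lateWork τ (suc x) +_)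
        (demandOf-stable (ℕₚ.≤-trans (suc∸period≤ x) x≤n) (ℕₚ.≤-trans (suc∸period≤ x) x≤k))

      demand-suc : ∀ x → demand τ (suc x) ≡ lateWork τ (suc x) + demand τ (suc x ∸ period τ)
      demand-suc x = ≡.cong (lateWork τ (suc x) +_)
        (demandOf-stable (ℕₚ.m≤n⇒m≤1+n (suc∸period≤ x)) (ℕₚ.n≤1+n _))

      demand-suc-≤ : ∀ x → demand τ (suc x) ≤ volume τ + demand τ x
      demand-suc-≤ x = ℕₚ.≤-trans (ℕₚ.≤-reflexive (demand-suc x))
        (ℕₚ.+-mono-≤ (lateWork≤volume (suc x)) (demand-mono (suc∸period≤ x)))

      demand-+-≤ : ∀ x h → demand τ (h + x) ≤ h * volume τ + demand τ x
      demand-+-≤ x zero    = ℕₚ.≤-refl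
      demand-+-≤ x (suc h) = begin
        demand τ (suc h + x)                     ≤⟨ demand-suc-≤ (h + x) ⟩
        volume τ + demand τ (h + x)              ≤⟨ ℕₚ.+-monoʳ-≤ (volume τ) (demand-+-≤ x h) ⟩
        volume τ + (h * volume τ + demand τ x)   ≡⟨ ℕₚ.+-assoc (volume τ) _ _ ⟨
        suc h * volume τ + demand τ x            ∎
        where open ℕₚ.≤-Reasoning

      demand≤*volume : ∀ x → demand τ x ≤ x * volume τ
      demand≤*volume x = begin
        demand τ x                  ≡⟨ ≡.cong (demand τ) (ℕₚ.+-identityʳ x) ⟨
        demand τ (x + 0)            ≤⟨ demand-+-≤ 0 x ⟩
        x * volume τ + demand τ 0   ≡⟨ ≡.cong (x * volume τ +_) (demandOf0≡0 1) ⟩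
        x * volume τ + 0            ≡⟨ ℕₚ.+-identityʳ _ ⟩
        x * volume τ                ∎
        where open ℕₚ.≤-Reasoning

      -- While h exceeds the deadline, the first terms of both demands are at most and exactly the
      -- full volume, and cancel. Once h is at most the deadline, its part of the window is worth at
      -- most h volumes, hence at most `deadline τ * volume τ`. The recursion goes down by whole
      -- periods, so it is on a bound n of h.
      demand-subadditive : ∀ x h →
        demand τ (h + x) ≤ demand τ h + (deadline τ * volume τ + demand τ x)
      demand-subadditive x h = go h h ℕₚ.≤-refl
        where
        go : ∀ n h → h ≤ n → demand τ (h + x) ≤ demand τ h + (deadline τ * volume τ + demand τ x)
        go n h h≤n with h ℕₚ.≤? deadline τ
        ... | yes h≤D = ℕₚ.≤-trans (demand-+-≤ x h) (ℕₚ.≤-trans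
                (ℕₚ.+-monoˡ-≤ (demand τ x) (ℕₚ.*-monoˡ-≤ (volume τ) h≤D)) (ℕₚ.m≤n+m _ (demand τ h)))
        go n       zero    h≤n       | no h≰D = ⊥-elim (h≰D z≤n)
        go (suc n) (suc h) (s≤s h≤n) | no h≰D = begin
          demand τ (suc h + x)
            ≡⟨ demand-suc (h + x) ⟩
          lateWork τ (suc h + x) + demand τ (suc h + x ∸ period τ)
            ≤⟨ ℕₚ.+-mono-≤ (lateWork≤volume (suc h + x)) rest ⟩
          volume τ + (demand τ (suc h ∸ period τ) + (deadline τ * volume τ + demand τ x))
            ≡⟨ ℕₚ.+-assoc (volume τ) _ _ ⟨
          volume τ + demand τ (suc h ∸ period τ) + (deadline τ * volume τ + demand τ x)
            ≡⟨ ≡.cong (λ v → v + demand τ (suc h ∸ period τ) + (deadline τ * volume τ + demand τ x))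
                 (≡.cong (residual τ) (ℕₚ.m≤n⇒m∸n≡0 (ℕₚ.<⇒≤ (ℕₚ.≰⇒> h≰D)))) ⟨
          lateWork τ (suc h) + demand τ (suc h ∸ period τ) + (deadline τ * volume τ + demand τ x)
            ≡⟨ ≡.cong (_+ (deadline τ * volume τ + demand τ x)) (demand-suc h) ⟨
          demand τ (suc h) + (deadline τ * volume τ + demand τ x) ∎
          where
          open ℕₚ.≤-Reasoning
          rest : demand τ (suc h + x ∸ period τ) ≤
                 demand τ (suc h ∸ period τ) + (deadline τ * volume τ + demand τ x)
          rest with period τ ℕₚ.≤? suc h
          ... | yes T≤h = ≡.subst
            (λ z → demand τ z ≤ demand τ (suc h ∸ period τ) + (deadline τ * volume τ + demand τ x))
            (≡.sym (ℕₚ.+-∸-comm x T≤h))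
                            (go n (suc h ∸ period τ) (ℕₚ.≤-trans (suc∸period≤ h) h≤n))
          ... | no  T≰h = ℕₚ.≤-trans
            (demand-mono (ℕₚ.m≤n+o⇒m∸n≤o (suc h + x) (period τ)
              (ℕₚ.+-monoˡ-≤ x (ℕₚ.<⇒≤ (ℕₚ.≰⇒> T≰h)))))
            (ℕₚ.≤-trans (ℕₚ.m≤n+m (demand τ x) (deadline τ * volume τ))
              (ℕₚ.m≤n+m _ (demand τ (suc h ∸ period τ))))

    -- The counterpart of `released-≤-demandOf`: if the last deadline is exactly y + x and the
    -- releases recur backwards every period, the terms agree one by one. The condition `x ≤ r`
    -- keeps the release dates nonnegative as long as the window lasts. A term after that would be
    -- `lateWork τ 0`, which the disjunction excludes or makes 0.
    demandOf-≤-released :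
      ∀ rel → (∀ r → T (rel r) → period τ ≤ r → T (rel (r ∸ period τ))) →
      ∀ y n x r → n ≤ 1 ⊎ lateWork τ 0 ≡ 0 → T (rel r) → y + x ≡ deadline τ + r → x ≤ r →
      demandOf τ n x ≤ sumOver (downFrom (suc r)) (releasedResidual rel y)
    demandOf-≤-released rel periodic y zero    x r hyp rel-r eq x≤r = z≤n
    demandOf-≤-released rel periodic y (suc n) x r hyp rel-r eq x≤r =
      ℕₚ.+-mono-≤ (ℕₚ.≤-reflexive (≡.trans (≡.cong (residual τ) same) (≡.sym chosen))) rest
      where
      chosen : releasedResidual rel y r ≡ residual τ (y ∸ r)
      chosen rewrite Equivalence.to Boolₚ.T-≡ rel-r = ≡.refl

      same : deadline τ ∸ x ≡ y ∸ r
      same = begin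
        deadline τ ∸ x               ≡⟨ ℕₚ.[m+n]∸[m+o]≡n∸o r _ _ ⟨
        r + deadline τ ∸ (r + x)     ≡⟨ ≡.cong₂ _∸_ (≡.trans (ℕₚ.+-comm r _) (≡.trans (≡.sym eq) (ℕₚ.+-comm y x))) (ℕₚ.+-comm r x) ⟩
        x + y ∸ (x + r)              ≡⟨ ℕₚ.[m+n]∸[m+o]≡n∸o x _ _ ⟩
        y ∸ r                        ∎
        where open ≡.≡-Reasoning

      hyp′ : n ≤ 1 ⊎ lateWork τ 0 ≡ 0
      hyp′ = Sum.map₁ (ℕₚ.≤-trans (ℕₚ.n≤1+n n)) hyp

      vanishes : ∀ n → suc n ≤ 1 ⊎ lateWork τ 0 ≡ 0 → demandOf τ n 0 ≡ 0
      vanishes zero    _           = ≡.refl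
      vanishes (suc n) (inj₁ 2≤1)  = ⊥-elim (ℕₚ.<⇒≱ 2≤1 (s≤s z≤n))
      vanishes (suc n) (inj₂ f0≡0) = demandOf0≡0 f0≡0 (suc n)

      rest : demandOf τ n (x ∸ period τ) ≤ sumOver (downFrom r) (releasedResidual rel y)
      rest with period τ ℕₚ.≤? x
      ... | no T≰x = ℕₚ.≤-trans (ℕₚ.≤-reflexive (≡.trans
              (≡.cong (demandOf τ n) (ℕₚ.m≤n⇒m∸n≡0 (ℕₚ.<⇒≤ (ℕₚ.≰⇒> T≰x)))) (vanishes n hyp))) z≤n
      ... | yes T≤x = ℕₚ.≤-trans
        (demandOf-≤-released rel periodic y n (x ∸ period τ) (r ∸ period τ) hyp′
          (periodic r rel-r T≤r) eq′ (ℕₚ.∸-monoˡ-≤ (period τ) x≤r))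
        (downFrom-sum-mono below _)
        where
        T≤r : period τ ≤ r
        T≤r = ℕₚ.≤-trans T≤x x≤r

        eq′ : y + (x ∸ period τ) ≡ deadline τ + (r ∸ period τ)
        eq′ = ≡.trans (≡.sym (ℕₚ.+-∸-assoc y T≤x))
                (≡.trans (≡.cong (_∸ period τ) eq) (ℕₚ.+-∸-assoc (deadline τ) T≤r))

        below : suc (r ∸ period τ) ≤ r
        below = ℕₚ.∸-monoʳ-< {r} {period τ} {0} period≥1 T≤r

  slack : TaskSystem → ℕ
  slack 𝒯 = sumOver 𝒯 (λ τ → deadline τ * volume τ)

  totalVolume : TaskSystem → ℕ
  totalVolume 𝒯 = sumOver 𝒯 volume

  totalVolume≤slack : ∀ 𝒯 → totalVolume 𝒯 ≤ slack 𝒯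
  totalVolume≤slack 𝒯 = sumOver-mono 𝒯 λ τ →
    ℕₚ.m≤n*m (volume τ) (deadline τ) {{deadline-nonZero τ}}

  NoOverrun : TaskSystem → Set
  NoOverrun = All (λ τ → lateWork τ 0 ≡ 0)

  totalDemand0⇒noOverrun : ∀ 𝒯 → totalDemand 𝒯 0 ≤ 0 → NoOverrun 𝒯
  totalDemand0⇒noOverrun 𝒯 W0≤0 =
    All.map (λ {τ} eq → ℕₚ.m+n≡0⇒m≡0 (lateWork τ 0) eq) (sumOver≡0 𝒯 _ W0≤0)

  totalDemand-subadditive : ∀ {𝒯} → NoOverrun 𝒯 → ∀ x h →
    totalDemand 𝒯 (h + x) ≤ totalDemand 𝒯 h + (slack 𝒯 + totalDemand 𝒯 x)
  totalDemand-subadditive {𝒯} ok x h = ℕₚ.≤-trans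
    (sumOver-mono-All (All.map (λ {τ} f0≡0 → demand-subadditive τ f0≡0 x h) ok))
    (ℕₚ.≤-reflexive (≡.trans (sumOver-+ 𝒯 _ _) (≡.cong (totalDemand 𝒯 h +_) (sumOver-+ 𝒯 _ _))))

  totalDemand≤*volume : ∀ {𝒯} → NoOverrun 𝒯 → ∀ x → totalDemand 𝒯 x ≤ x * totalVolume 𝒯
  totalDemand≤*volume {𝒯} ok x = ℕₚ.≤-trans
    (sumOver-mono-All (All.map (λ {τ} f0≡0 → demand≤*volume τ f0≡0 x) ok))
    (ℕₚ.≤-reflexive (sumOver-* 𝒯 x volume))

  -- Spreading one slack over more than `n * slack 𝒯` time units raises the demand per unit by less
  -- than 1/n, which is at most ε for the chosen n. The successor makes the horizon positive, so
  -- that subtracting it is a descent.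
  horizon : ℕ → TaskSystem → ℕ
  horizon n 𝒯 = suc (n * slack 𝒯)

  -- Beyond the horizon, subadditivity costs at most slack 𝒯 per horizon.
  demand-everywhere : ∀ n m 𝒯 → (∀ t → t ≤ horizon n 𝒯 → totalDemand 𝒯 t ≤ t * m) →
                      ∀ x → n * totalDemand 𝒯 x ≤ x * (n * m + 1)
  demand-everywhere n m 𝒯 small x = go x x ℕₚ.≤-refl
    where
    H : ℕ
    H = horizon n 𝒯

    ok : NoOverrun 𝒯
    ok = totalDemand0⇒noOverrun 𝒯 (small 0 z≤n)

    n*small : ∀ t → t ≤ H → n * totalDemand 𝒯 t ≤ t * (n * m)
    n*small t t≤H = ℕₚ.≤-trans (ℕₚ.*-monoʳ-≤ n (small t t≤H)) (ℕₚ.≤-reflexive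
      (solve 3 (λ n t m → n :* (t :* m) := t :* (n :* m)) ≡.refl n t m))
      where open Data.Nat.Solver.+-*-Solver

    go : ∀ k x → x ≤ k → n * totalDemand 𝒯 x ≤ x * (n * m + 1)
    go k x x≤k with x ℕₚ.≤? H
    ... | yes x≤H = ℕₚ.≤-trans (n*small x x≤H) (ℕₚ.*-monoʳ-≤ x (ℕₚ.m≤m+n (n * m) 1))
    go zero    x x≤k | no x≰H = ⊥-elim (x≰H (ℕₚ.≤-trans x≤k z≤n))
    go (suc k) x x≤k | no x≰H = begin
      n * totalDemand 𝒯 x
        ≡⟨ ≡.cong (λ z → n * totalDemand 𝒯 z) H+z≡x ⟨
      n * totalDemand 𝒯 (H + z)
        ≤⟨ ℕₚ.*-monoʳ-≤ n (totalDemand-subadditive ok z H) ⟩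
      n * (totalDemand 𝒯 H + (slack 𝒯 + totalDemand 𝒯 z))
        ≡⟨ ℕₚ.*-distribˡ-+ n _ _ ⟩
      n * totalDemand 𝒯 H + n * (slack 𝒯 + totalDemand 𝒯 z)
        ≡⟨ ≡.cong (n * totalDemand 𝒯 H +_) (ℕₚ.*-distribˡ-+ n _ _) ⟩
      n * totalDemand 𝒯 H + (n * slack 𝒯 + n * totalDemand 𝒯 z)
        ≤⟨ ℕₚ.+-mono-≤ (n*small H ℕₚ.≤-refl) (ℕₚ.+-mono-≤ (ℕₚ.n≤1+n _) (go k z z≤k)) ⟩
      H * (n * m) + (H + z * (n * m + 1))
        ≡⟨ solve 3 (λ H z c → H :* c :+ (H :+ z :* (c :+ con 1)) := (H :+ z) :* (c :+ con 1))
             ≡.refl H z (n * m) ⟩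
      (H + z) * (n * m + 1)
        ≡⟨ ≡.cong (_* (n * m + 1)) H+z≡x ⟩
      x * (n * m + 1) ∎
      where
      open ℕₚ.≤-Reasoning
      open Data.Nat.Solver.+-*-Solver

      z : ℕ
      z = x ∸ H

      H+z≡x : H + z ≡ x
      H+z≡x = ℕₚ.m+[n∸m]≡n (ℕₚ.<⇒≤ (ℕₚ.≰⇒> x≰H))

      z≤k : z ≤ k
      z≤k = s≤s⁻¹ (ℕₚ.≤-trans (ℕₚ.∸-monoʳ-< {x} {H} {0} (s≤s z≤n) (ℕₚ.<⇒≤ (ℕₚ.≰⇒> x≰H))) x≤k)

  -- The program compares with t * (m ⊓ suc H), because its running time must
  -- not depend on m.  A violation with m > H can only occur at t = 0.
  Overloaded : TaskSystem → ℕ → Set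
  Overloaded 𝒯 m = ∃ λ t → (t ≡ 0 ⊎ NoOverrun 𝒯) × t * m < totalDemand 𝒯 t

  -- Length 0 is examined first, because without an excess there `NoOverrun` holds. Then each task
  -- contributes at most one volume per time unit, and a capacity of `suc (horizon n 𝒯)` already
  -- covers the total volume; so an excess forces m to be the smaller of the two.
  overload : ∀ n m 𝒯 .{{_ : NonZero n}} t →
             t * (m ⊓ suc (horizon n 𝒯)) < totalDemand 𝒯 t → Overloaded 𝒯 m
  overload n m 𝒯 t excess with totalDemand 𝒯 0 ℕₚ.≤? 0
  ... | no W0≰0 = 0 , inj₁ ≡.refl , ℕₚ.≰⇒> W0≰0
  ... | yes W0≤0 with ℕₚ.≤-total m (suc (horizon n 𝒯))
  ...   | inj₁ m≤H = t , inj₂ (totalDemand0⇒noOverrun 𝒯 W0≤0)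
                   , ≡.subst (λ c → t * c < totalDemand 𝒯 t) (ℕₚ.m≤n⇒m⊓n≡m m≤H) excess
  ...   | inj₂ H≤m = ⊥-elim (ℕₚ.<⇒≱ excess (begin
    totalDemand 𝒯 t                  ≤⟨ totalDemand≤*volume (totalDemand0⇒noOverrun 𝒯 W0≤0) t ⟩
    t * totalVolume 𝒯                ≤⟨ ℕₚ.*-monoʳ-≤ t (ℕₚ.≤-trans (totalVolume≤slack 𝒯) (ℕₚ.m≤n*m (slack 𝒯) n)) ⟩
    t * (n * slack 𝒯)                ≤⟨ ℕₚ.*-monoʳ-≤ t (ℕₚ.≤-trans (ℕₚ.n≤1+n _) (ℕₚ.n≤1+n _)) ⟩
    t * suc (horizon n 𝒯)            ≡⟨ ≡.cong (t *_) (ℕₚ.m≥n⇒m⊓n≡n H≤m) ⟨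
    t * (m ⊓ suc (horizon n 𝒯))      ∎))
    where open ℕₚ.≤-Reasoning

-- A fold language and its compilation

-- A first-order functional language compiled to WHILE.  The only loops are
-- folds along the spine of a read-only tree.  A read-only tree is no deeper
-- than the input, which makes the running time of every term polynomial in the
-- depth of the read-only trees, whatever the other trees are.
module FoldLanguage where

  data Ref (r : ℕ) : Set where
    var   : Fin r → Ref r
    hd tl : Ref r → Ref r

  data Pure (r k : ℕ) : Set where
    ref   : Ref r → Pure r k
    var   : Fin k → Pure r k
    nil   : Pure r k
    cons  : Pure r k → Pure r k → Pure r k
    hd tl : Pure r k → Pure r k

  -- In the body of a fold the read-only variables 0 and 1 are the current
  -- element and the suffix that it heads; variable 0 is the accumulator.
  data Term (r k : ℕ) : Set where
    ret    : Pure r k → Term r k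
    bind   : Term r k → Term r (suc k) → Term r k
    branch : Pure r k → Term r k → Term r k → Term r k
    fold   : Ref r → Term r k → Term (suc (suc r)) (suc k) → Term r k

  foldSpine : (Tree → Tree → Tree) → Tree → Tree → Tree
  foldSpine g nil     a = a
  foldSpine g (l ∙ r) a = foldSpine g r (g (l ∙ r) a)

  ifNode : Tree → Tree → Tree → Tree
  ifNode nil     x y = y
  ifNode (_ ∙ _) x y = x

  evalRef : ∀ {r} → Ref r → Vec Tree r → Tree
  evalRef (var i) ρ = Vec.lookup ρ i
  evalRef (hd d)  ρ = head (evalRef d ρ)
  evalRef (tl d)  ρ = tail (evalRef d ρ)

  evalPure : ∀ {r k} → Pure r k → Vec Tree r → Vec Tree k → Tree
  evalPure (ref d)    ρ γ = evalRef d ρ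
  evalPure (var i)    ρ γ = Vec.lookup γ i
  evalPure nil        ρ γ = nil
  evalPure (cons p q) ρ γ = evalPure p ρ γ ∙ evalPure q ρ γ
  evalPure (hd p)     ρ γ = head (evalPure p ρ γ)
  evalPure (tl p)     ρ γ = tail (evalPure p ρ γ)

  eval : ∀ {r k} → Term r k → Vec Tree r → Vec Tree k → Tree
  eval (ret p)        ρ γ = evalPure p ρ γ
  eval (bind t u)     ρ γ = eval u ρ (eval t ρ γ ∷ γ)
  eval (branch p t u) ρ γ = ifNode (evalPure p ρ γ) (eval t ρ γ) (eval u ρ γ)
  eval (fold d t u)   ρ γ =
    foldSpine (λ s a → eval u (head s ∷ s ∷ ρ) (a ∷ γ)) (evalRef d ρ) (eval t ρ γ)

  -- WHILE variable 0 holds the stack of values and the results, WHILE variable 1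
  -- the stack of read-only trees.

  stack : ∀ {n} → Vec Tree n → Tree
  stack []      = nil
  stack (x ∷ σ) = x ∙ stack σ

  values readOnly : Fin 2
  values   = zero
  readOnly = suc zero

  tails : ∀ {n} → ℕ → Expr n → Expr n
  tails zero    e = e
  tails (suc i) e = tails i (tl e)

  refExpr : ∀ {r} → Ref r → Expr 2
  refExpr (var i) = hd (tails (toℕ i) (var readOnly))
  refExpr (hd d)  = hd (refExpr d)
  refExpr (tl d)  = tl (refExpr d)

  pureExpr : ∀ {r k} → Pure r k → Expr 2
  pureExpr (ref d)    = refExpr d
  pureExpr (var i)    = hd (tails (toℕ i) (var values))
  pureExpr nil        = nil
  pureExpr (cons p q) = cons (pureExpr p) (pureExpr q)
  pureExpr (hd p)     = hd (pureExpr p)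
  pureExpr (tl p)     = tl (pureExpr p)

  push : Fin 2 → Expr 2 → Command 2
  push x e = x ≔ cons e (var x)

  -- At the loop test the suffix is on top of the read-only stack; in the body the current element
  -- lies above it. `advance` removes both and leaves the shorter suffix, while `dropSecond` removes
  -- the value that the new one replaces.
  pop dropSecond advance : Command 2
  pop        = readOnly ≔ tl (var readOnly)
  dropSecond = values ≔ cons (hd (var values)) (tl (tl (var values)))
  advance    = readOnly ≔ cons (tl (hd (tl (var readOnly)))) (tl (tl (var readOnly)))

  compile : ∀ {r k} → Term r k → Command 2
  compile (ret p)        = push values (pureExpr p)
  compile (bind t u)     = compile t ⨾ compile u ⨾ dropSecond
  compile (branch p t u) = cond (pureExpr p) (compile t) (compile u)
  compile (fold d t u)   =
    compile t ⨾ push readOnly (refExpr d) ⨾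
    while (hd (var readOnly))
      (push readOnly (hd (hd (var readOnly))) ⨾ compile u ⨾ dropSecond ⨾ advance) ⨾
    pop

  height : Tree → ℕ
  height nil     = 0
  height (l ∙ r) = suc (height l ℕ.⊔ height r)

  costOf : Command 2 → ℕ
  costOf (x ≔ e) = suc (cost e)
  costOf _       = 0

  -- The 3, as well as the 3 that `time` adds for the last round, is the cost of the loop test
  -- `hd (var readOnly)`.
  bodyTime : ℕ → ℕ
  bodyTime b = 3 ℕ.+ (costOf (push readOnly (hd (hd (var readOnly)))) ℕ.+
                      (b ℕ.+ (costOf dropSecond ℕ.+ costOf advance)))

  time : ∀ {r k} → Term r k → ℕ → ℕ
  time (ret p)        B = costOf (push values (pureExpr p))
  time (bind t u)     B = time t B ℕ.+ (time u B ℕ.+ costOf dropSecond)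
  time (branch p t u) B = suc (cost (pureExpr p)) ℕ.+ (time t B ℕ.+ time u B)
  time (fold d t u)   B =
    time t B ℕ.+ (costOf (push readOnly (refExpr d)) ℕ.+
      ((B ℕ.* bodyTime (time u B) ℕ.+ 3) ℕ.+ costOf pop))

  head-≤ : ∀ {B} t → height t ℕ.≤ B → height (head t) ℕ.≤ B
  head-≤ nil     _ = z≤n
  head-≤ (l ∙ r) h =
    ℕₚ.≤-trans (ℕₚ.m≤n⇒m≤1+n (ℕₚ.m≤m⊔n (height l) (height r))) h

  tail-≤ : ∀ {B} t → height t ℕ.≤ B → height (tail t) ℕ.≤ B
  tail-≤ nil     _ = z≤n
  tail-≤ (l ∙ r) h =
    ℕₚ.≤-trans (ℕₚ.m≤n⇒m≤1+n (ℕₚ.m≤n⊔m (height l) (height r))) h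

  Bounded : ℕ → ∀ {r} → Vec Tree r → Set
  Bounded B = VecAll (λ t → height t ℕ.≤ B)

  evalRef-≤ : ∀ {r B} {ρ : Vec Tree r} (d : Ref r) → Bounded B ρ → height (evalRef d ρ) ℕ.≤ B
  evalRef-≤ (var i) b = VecAllₚ.lookup⁺ b i
  evalRef-≤ {ρ = ρ} (hd d) b = head-≤ (evalRef d ρ) (evalRef-≤ d b)
  evalRef-≤ {ρ = ρ} (tl d) b = tail-≤ (evalRef d ρ) (evalRef-≤ d b)

  tails-lookup : ∀ {m n} (τ : Vec Tree m) (i : Fin m) {σ : Store n} (e : Expr n) →
                 ⟦ e ⟧ σ ≡ stack τ → ⟦ hd (tails (toℕ i) e) ⟧ σ ≡ Vec.lookup τ i
  tails-lookup (x ∷ τ) zero    e eq = ≡.cong head eq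
  tails-lookup (x ∷ τ) (suc i) e eq = tails-lookup τ i (tl e) (≡.cong tail eq)

  state : Tree → Tree → Store 2
  state G E = G ∷ E ∷ []

  refExpr-correct : ∀ {r} (d : Ref r) ρ {G} → ⟦ refExpr d ⟧ (state G (stack ρ)) ≡ evalRef d ρ
  refExpr-correct (var i) ρ = tails-lookup ρ i (var readOnly) ≡.refl
  refExpr-correct (hd d)  ρ = ≡.cong head (refExpr-correct d ρ)
  refExpr-correct (tl d)  ρ = ≡.cong tail (refExpr-correct d ρ)

  pureExpr-correct : ∀ {r k} (p : Pure r k) ρ γ →
                     ⟦ pureExpr p ⟧ (state (stack γ) (stack ρ)) ≡ evalPure p ρ γ
  pureExpr-correct (ref d)    ρ γ = refExpr-correct d ρ
  pureExpr-correct (var i)    ρ γ = tails-lookup γ i (var values) ≡.refl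
  pureExpr-correct nil        ρ γ = ≡.refl
  pureExpr-correct (cons p q) ρ γ = ≡.cong₂ _∙_ (pureExpr-correct p ρ γ) (pureExpr-correct q ρ γ)
  pureExpr-correct (hd p)     ρ γ = ≡.cong head (pureExpr-correct p ρ γ)
  pureExpr-correct (tl p)     ρ γ = ≡.cong tail (pureExpr-correct p ρ γ)

  infix 4 ⟨_,_⟩⇓≤[_]_

  ⟨_,_⟩⇓≤[_]_ : ∀ {n} → Command n → Store n → ℕ → Store n → Set
  ⟨ C , σ ⟩⇓≤[ b ] τ = ∃ λ k → ⟨ C , σ ⟩⇓[ k ] τ × k ℕ.≤ b

  infixr 5 _⨾⇓_

  _⨾⇓_ : ∀ {n} {C D : Command n} {ρ σ τ b c} →
         ⟨ C , ρ ⟩⇓≤[ b ] σ → ⟨ D , σ ⟩⇓≤[ c ] τ → ⟨ C ⨾ D , ρ ⟩⇓≤[ b ℕ.+ c ] τ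
  (k , C⇓ , k≤b) ⨾⇓ (l , D⇓ , l≤c) = k ℕ.+ l , seq C⇓ D⇓ , ℕₚ.+-mono-≤ k≤b l≤c

  assign⇓ : ∀ {n x e} {σ : Store n} → ⟨ x ≔ e , σ ⟩⇓≤[ suc (cost e) ] (σ Vec.[ x ]≔ ⟦ e ⟧ σ)
  assign⇓ = _ , assign , ℕₚ.≤-refl

  cast⇓ : ∀ {n} {C : Command n} {σ τ τ′ b} → τ ≡ τ′ → ⟨ C , σ ⟩⇓≤[ b ] τ → ⟨ C , σ ⟩⇓≤[ b ] τ′
  cast⇓ ≡.refl C⇓ = C⇓

  spine≤height : ∀ {B} l r → height (l ∙ r) ℕ.≤ suc B → height r ℕ.≤ B
  spine≤height l r (s≤s h) = ℕₚ.≤-trans (ℕₚ.m≤n⊔m (height l) (height r)) h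

  -- One bound B serves throughout, since every tree that is pushed on the read-only stack is a
  -- subtree of one that lies there.
  compile-correct : ∀ {r k} (t : Term r k) ρ γ B → Bounded B ρ →
                    ⟨ compile t , state (stack γ) (stack ρ) ⟩⇓≤[ time t B ]
                      state (eval t ρ γ ∙ stack γ) (stack ρ)
  compile-correct (ret p) ρ γ B b =
    cast⇓ (≡.cong (λ x → state (x ∙ stack γ) (stack ρ)) (pureExpr-correct p ρ γ)) assign⇓
  compile-correct (bind t u) ρ γ B b =
    compile-correct t ρ γ B b ⨾⇓ compile-correct u ρ (eval t ρ γ ∷ γ) B b ⨾⇓ assign⇓
  compile-correct (branch p t u) ρ γ B b
    with evalPure p ρ γ in eq
  ... | nil =
    let k , run , k≤ = compile-correct u ρ γ B b
    in  suc (cost (pureExpr p)) ℕ.+ k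
      , cond-false (≡.trans (pureExpr-correct p ρ γ) eq) run
      , ℕₚ.+-monoʳ-≤ (suc (cost (pureExpr p))) (ℕₚ.≤-trans k≤ (ℕₚ.m≤n+m _ (time t B)))
  ... | l ∙ r =
    let k , run , k≤ = compile-correct t ρ γ B b
    in  suc (cost (pureExpr p)) ℕ.+ k
      , cond-true (≡.subst IsNode (≡.sym (≡.trans (pureExpr-correct p ρ γ) eq)) tt) run
      , ℕₚ.+-monoʳ-≤ (suc (cost (pureExpr p))) (ℕₚ.≤-trans k≤ (ℕₚ.m≤m+n _ (time u B)))
  compile-correct {r} {k} (fold d t u) ρ γ B b =
    compile-correct t ρ γ B b ⨾⇓
    cast⇓ (≡.cong (λ x → state _ (x ∙ stack ρ)) (refExpr-correct d ρ)) assign⇓ ⨾⇓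
    loop (evalRef d ρ) (eval t ρ γ) B driver≤B driver≤B ⨾⇓
    assign⇓
    where
    driver≤B : height (evalRef d ρ) ℕ.≤ B
    driver≤B = evalRef-≤ d b

    c : ℕ
    c = bodyTime (time u B)

    -- B prices the body and stays fixed; N bounds the number of rounds left.
    loop : ∀ s a N → height s ℕ.≤ B → height s ℕ.≤ N →
           ⟨ _ , state (a ∙ stack γ) (s ∙ stack ρ) ⟩⇓≤[ N ℕ.* c ℕ.+ 3 ]
             state (foldSpine (λ s a → eval u (head s ∷ s ∷ ρ) (a ∷ γ)) s a ∙ stack γ) (nil ∙ stack ρ)
    loop nil a N _ _ = 3 , while-false ≡.refl , ℕₚ.m≤n+m 3 (N ℕ.* c)
    loop (x ∙ s) a (suc N) h h′ =
      let k , body , k≤ = assign⇓ {e = cons (hd (hd (var readOnly))) (var readOnly)} ⨾⇓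
                          compile-correct u (x ∷ (x ∙ s) ∷ ρ) (a ∷ γ) B
                            (head-≤ (x ∙ s) h ∷ h ∷ b) ⨾⇓
                          assign⇓ {e = cons (hd (var values)) (tl (tl (var values)))} ⨾⇓
                          assign⇓ {e = cons (tl (hd (tl (var readOnly)))) (tl (tl (var readOnly)))}
          l , rest , l≤ = loop s (eval u (x ∷ (x ∙ s) ∷ ρ) (a ∷ γ)) N (tail-≤ (x ∙ s) h)
                            (spine≤height x s h′)
      in  3 ℕ.+ (k ℕ.+ l) , while-true tt body rest
        , ℕₚ.≤-trans (ℕₚ.+-monoʳ-≤ 3 (ℕₚ.+-mono-≤ k≤ l≤))
            (ℕₚ.≤-reflexive (≡.sym (ℕₚ.+-assoc c (N ℕ.* c) 3)))

  -- `Accepts` and `Rejects` speak of some halting run; this identifies it with the run constructed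
  -- from the term.
  deterministic : ∀ {n} {C : Command n} {σ τ τ′ k l} →
                  ⟨ C , σ ⟩⇓[ k ] τ → ⟨ C , σ ⟩⇓[ l ] τ′ → τ ≡ τ′
  deterministic skip skip = ≡.refl
  deterministic assign assign = ≡.refl
  deterministic (seq C⇓ D⇓) (seq C⇓′ D⇓′)
    rewrite deterministic C⇓ C⇓′ = deterministic D⇓ D⇓′
  deterministic (cond-true _ C⇓) (cond-true _ C⇓′) = deterministic C⇓ C⇓′
  deterministic (cond-true e _) (cond-false e≡nil _) = ⊥-elim (≡.subst IsNode e≡nil e)
  deterministic (cond-false e≡nil _) (cond-true e _) = ⊥-elim (≡.subst IsNode e≡nil e)
  deterministic (cond-false _ D⇓) (cond-false _ D⇓′) = deterministic D⇓ D⇓′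
  deterministic (while-true _ C⇓ W⇓) (while-true _ C⇓′ W⇓′)
    rewrite deterministic C⇓ C⇓′ = deterministic W⇓ W⇓′
  deterministic (while-true e _ _) (while-false e≡nil) = ⊥-elim (≡.subst IsNode e≡nil e)
  deterministic (while-false e≡nil) (while-true e _ _) = ⊥-elim (≡.subst IsNode e≡nil e)
  deterministic (while-false _) (while-false _) = ≡.refl

-- Polynomial bounds

module Polynomials where

  open import Data.Nat.Base using (_+_; _*_; _^_; _≤_)
  open FoldLanguage

  -- With base n + 1 a larger exponent never lowers the bound, which sums need, and the additive 1
  -- is absorbed into the constant when bounds are composed.
  PolynomiallyBounded : (ℕ → ℕ) → Set
  PolynomiallyBounded f = ∃₂ λ a d → ∀ n → f n ≤ a * suc n ^ d

  poly-const : ∀ c → PolynomiallyBounded (λ _ → c)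
  poly-const c = c , 0 , λ n → ℕₚ.≤-reflexive (≡.sym (ℕₚ.*-identityʳ c))

  poly-id : PolynomiallyBounded (λ n → n)
  poly-id = 1 , 1 , λ n → ℕₚ.≤-trans (ℕₚ.n≤1+n n) (ℕₚ.≤-reflexive
    (≡.sym (≡.trans (ℕₚ.*-identityˡ _) (ℕₚ.*-identityʳ (suc n)))))

  1≤^ : ∀ n d → 1 ≤ suc n ^ d
  1≤^ n d = ℕₚ.m^n>0 (suc n) d

  interchange : ∀ x y z w → (x * y) * (z * w) ≡ (x * z) * (y * w)
  interchange = solve 4 (λ x y z w → (x :* y) :* (z :* w) := (x :* z) :* (y :* w)) ≡.refl
    where open Data.Nat.Solver.+-*-Solver

  *-^ : ∀ x y d → (x * y) ^ d ≡ x ^ d * y ^ d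
  *-^ x y zero    = ≡.refl
  *-^ x y (suc d) = ≡.trans (≡.cong (x * y *_) (*-^ x y d)) (interchange x y (x ^ d) (y ^ d))

  poly-* : ∀ {f g} → PolynomiallyBounded f → PolynomiallyBounded g →
           PolynomiallyBounded (λ n → f n * g n)
  poly-* {f} {g} (a , d , f≤) (b , e , g≤) = a * b , d + e , λ n →
    begin
      f n * g n                         ≤⟨ ℕₚ.*-mono-≤ (f≤ n) (g≤ n) ⟩
      (a * suc n ^ d) * (b * suc n ^ e) ≡⟨ interchange a (suc n ^ d) b (suc n ^ e) ⟩
      (a * b) * (suc n ^ d * suc n ^ e) ≡⟨ ≡.cong ((a * b) *_) (ℕₚ.^-distribˡ-+-* (suc n) d e) ⟨
      (a * b) * suc n ^ (d + e)         ∎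
    where
    open ℕₚ.≤-Reasoning

  poly-+ : ∀ {f g} → PolynomiallyBounded f → PolynomiallyBounded g →
           PolynomiallyBounded (λ n → f n + g n)
  poly-+ {f} {g} (a , d , f≤) (b , e , g≤) = a + b , d + e , λ n →
    begin
      f n + g n                                   ≤⟨ ℕₚ.+-mono-≤ (f≤ n) (g≤ n) ⟩
      a * suc n ^ d + b * suc n ^ e
        ≤⟨ ℕₚ.+-mono-≤ (ℕₚ.*-monoʳ-≤ a (ℕₚ.^-monoʳ-≤ (suc n) (ℕₚ.m≤m+n d e)))
                       (ℕₚ.*-monoʳ-≤ b (ℕₚ.^-monoʳ-≤ (suc n) (ℕₚ.m≤n+m e d))) ⟩
      a * suc n ^ (d + e) + b * suc n ^ (d + e)   ≡⟨ ℕₚ.*-distribʳ-+ (suc n ^ (d + e)) a b ⟨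
      (a + b) * suc n ^ (d + e)                   ∎
    where open ℕₚ.≤-Reasoning

  poly-∘ : ∀ {f g} → PolynomiallyBounded f → PolynomiallyBounded g →
           PolynomiallyBounded (λ n → f (g n))
  poly-∘ {f} {g} (a , d , f≤) (b , e , g≤) = a * suc b ^ d , e * d , λ n →
    begin
      f (g n)                             ≤⟨ f≤ (g n) ⟩
      a * suc (g n) ^ d                   ≤⟨ ℕₚ.*-monoʳ-≤ a (ℕₚ.^-monoˡ-≤ d (step n)) ⟩
      a * (suc b * suc n ^ e) ^ d         ≡⟨ ≡.cong (a *_) (*-^ (suc b) (suc n ^ e) d) ⟩
      a * (suc b ^ d * (suc n ^ e) ^ d)   ≡⟨ ℕₚ.*-assoc a _ _ ⟨
      a * suc b ^ d * (suc n ^ e) ^ d     ≡⟨ ≡.cong (a * suc b ^ d *_) (ℕₚ.^-*-assoc (suc n) e d) ⟩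
      a * suc b ^ d * suc n ^ (e * d)     ∎
    where
    open ℕₚ.≤-Reasoning
    step : ∀ n → suc (g n) ≤ suc b * suc n ^ e
    step n = ℕₚ.+-mono-≤ (1≤^ n e) (g≤ n)

  time-poly : ∀ {r k} (t : Term r k) → PolynomiallyBounded (time t)
  time-poly (ret p)        = poly-const _
  time-poly (bind t u)     = poly-+ (time-poly t) (poly-+ (time-poly u) (poly-const _))
  time-poly (branch p t u) =
    poly-+ (poly-const (suc (cost (pureExpr p)))) (poly-+ (time-poly t) (time-poly u))
  time-poly (fold d t u)   =
    poly-+ (time-poly t) (poly-+ (poly-const (costOf (push readOnly (refExpr d)))) (poly-+
      (poly-+ (poly-* poly-id
        (poly-+ (poly-const 3) (poly-+ (poly-const (costOf (push readOnly (hd (hd (var readOnly))))))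
          (poly-+ (time-poly u) (poly-const (costOf dropSecond + costOf advance))))))
        (poly-const 3))
      (poly-const (costOf pop))))

-- The test as a term of the fold language, and its value

module SchedulabilityTest where

  open import Data.Nat.Base using (_+_; _*_; _∸_; _⊓_; _≤_; _<_; pred; s≤s⁻¹)
  open FoldLanguage
  open Sums
  open Demand
  open Task

  -- Vertex data are kept in reverse order, so that the entry of the current
  -- vertex of a fold is found by dropping as many entries as vertices follow.
  nth : ∀ {r k} → Fin k → Ref r → Term r k
  nth l s = bind (fold s (ret (var l)) (ret (tl (var 0F)))) (ret (hd (var 0F)))

  blockedBody : ∀ {r k} → (suffix : Fin r) → (state : Fin k) → Term (suc (suc r)) (suc k)
  blockedBody sw rs =
    bind (nth (suc rs) (tl (var 1F)))
    (branch (var 0F)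
      -- The successor bits are stored in vertex order; this fold reverses them, so that `nth` can
      -- find the bit of w by the vertices that follow w.
      (bind (fold (tl (var 0F)) (ret nil) (ret (cons (ref (var 0F)) (var 0F))))
      (bind (nth 0F (tl (var (suc (suc sw)))))
      (branch (var 0F) (ret (cons nil nil)) (ret (var 3F)))))
      (ret (var 1F)))

  blockedTerm : ∀ {r k} → (task suffix : Fin r) → (state : Fin k) → Term r k
  blockedTerm τ sw rs = fold (tl (tl (var τ))) (ret nil) (blockedBody sw rs)

  stepBody : ∀ {r k} → (task : Fin r) → (state : Fin k) → Term (suc (suc r)) (suc k)
  stepBody τ rs =
    bind (nth (suc rs) (tl (var 1F)))
    (bind (blockedTerm (suc (suc τ)) 1F (suc (suc rs)))
    (branch (var 0F) (ret (cons (var 1F) (var 2F))) (ret (cons (tl (var 1F)) (var 2F)))))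

  stepTerm : ∀ {r k} → (task : Fin r) → (state : Fin k) → Term r k
  stepTerm τ rs = fold (tl (tl (var τ))) (ret nil) (stepBody τ rs)

  initialTerm : ∀ {r k} → (task : Fin r) → Term r k
  initialTerm τ = fold (tl (tl (var τ))) (ret nil) (ret (cons (ref (hd (var 0F))) (var 0F)))

  -- The accumulator pairs a counter, initially x, with the state. The first x of the `deadline τ`
  -- rounds only use up the counter, which implements the truncated subtraction `deadline τ ∸ x`.
  simulateBody : ∀ {r k} → (task : Fin r) → Term (suc (suc r)) (suc k)
  simulateBody τ =
    branch (hd (var 0F))
      (ret (cons (tl (hd (var 0F))) (tl (var 0F))))
      (bind (ret (tl (var 0F)))
      (bind (stepTerm (suc (suc τ)) 0F)
      (ret (cons nil (var 0F)))))

  -- Simulates S∞ for the deadline of the task minus x steps.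
  simulateTerm : ∀ {r k} → (task : Fin r) → (x : Fin k) → Term r k
  simulateTerm τ x = bind
    (fold (hd (var τ)) (bind (initialTerm τ) (ret (cons (var (suc x)) (var 0F))))
      (simulateBody τ))
    (ret (tl (var 0F)))

  -- The work left is a computed value and cannot drive a fold. The loop therefore runs along the
  -- processing time, which is at least as large, and moves one unit per round until none is left.
  moveBody : ∀ {r k} → Term (suc (suc r)) (suc k)
  moveBody = branch (hd (var 0F))
    (ret (cons (tl (hd (var 0F))) (cons nil (tl (var 0F)))))
    (ret (var 0F))

  addResidualBody : ∀ {r k} → (state : Fin k) → Term (suc (suc r)) (suc k)
  addResidualBody rs =
    bind (nth (suc rs) (tl (var 1F)))
    (bind (fold (hd (var 0F)) (ret (cons (var 0F) (var 1F))) moveBody)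
    (ret (tl (var 0F))))

  addResidualTerm : ∀ {r k} → (task : Fin r) → (state work : Fin k) → Term r k
  addResidualTerm τ rs W = fold (tl (tl (var τ))) (ret (var W)) (addResidualBody rs)

  addDemandBody : ∀ {r k} → (task : Fin r) → Term (suc (suc r)) (suc k)
  addDemandBody τ =
    bind (ret (hd (var 0F)))
    (bind (simulateTerm (suc (suc τ)) 0F)
    (bind (ret (tl (var 2F)))
    (bind (addResidualTerm (suc (suc τ)) 1F 0F)
    (bind (fold (hd (tl (var (suc (suc τ))))) (ret (var 3F)) (ret (tl (var 0F))))
    (ret (cons (var 0F) (var 1F)))))))

  -- The numeral of t + 1 plays two roles: it drives the t + 1 terms of `demand`, and its tail is
  -- the initial window t.
  addDemandTerm : ∀ {r k} → (task 1+t : Fin r) → (work : Fin k) → Term r k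
  addDemandTerm τ t W = bind
    (fold (var t) (ret (cons (ref (tl (var t))) (var W))) (addDemandBody τ))
    (ret (tl (var 0F)))

  totalDemandTerm : ∀ {r k} → (tasks 1+t : Fin r) → Term r k
  totalDemandTerm 𝒯 t = fold (var 𝒯) (ret nil) (addDemandTerm 0F (suc (suc t)) 0F)

  dropBody : ∀ {r k} → Term (suc (suc r)) (suc k)
  dropBody = branch (hd (var 0F))
    (ret (cons (tl (hd (var 0F))) (tl (tl (var 0F)))))
    (ret (var 0F))

  -- The time must not depend on m, so m is a value. Folding along the limit L and taking a unit of
  -- m in each round, while there is one, subtracts `m ⊓ L`.
  capacityBody : ∀ {r k} → (limit : Fin r) → (m : Fin k) → Term (suc (suc r)) (suc k)
  capacityBody H m = bind
    (fold (var (suc (suc H))) (ret (cons (var (suc m)) (var 0F))) dropBody)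
    (ret (tl (var 0F)))

  excessTerm : ∀ {r k} → (tasks limit 1+t : Fin r) → (m : Fin k) → Term r k
  excessTerm 𝒯 H t m = bind (totalDemandTerm 𝒯 t)
    (fold (tl (var t)) (ret (var 0F)) (capacityBody H (suc m)))

  -- The suffixes of the numeral of `suc (horizon n 𝒯)` are the numerals of t + 1 for t from the
  -- horizon down to 0, so the fold enumerates exactly the lengths to be checked.
  testTerm : Term 3 1
  testTerm =
    fold (var 0F) (ret (cons nil nil))
      (bind (excessTerm 3F 2F 1F 1F)
        (branch (var 0F) (ret nil) (ret (var 1F))))

  -- Products are nested loops around an increment: n, the tasks, the deadline, the vertices, the
  -- processing time. The initial 2 turns `n * slack 𝒯` into `suc (horizon n 𝒯)`.
  limitTerm : Term 2 1
  limitTerm =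
    fold (var 1F) (ret (cons nil (cons nil nil)))
      (fold (var 2F) (ret (var 0F))
        (fold (hd (var 0F)) (ret (var 0F))
          (fold (tl (tl (var 2F))) (ret (var 0F))
            (fold (hd (var 0F)) (ret (var 0F)) (ret (cons nil (var 0F)))))))

  -- The hypothesis on the body keeps the position of x in the list, since `nth` identifies the
  -- current vertex by the length of `post`.
  foldSpine-foldl :
    ∀ {a b} {A : Set a} {B : Set b} (enc : A → Tree) (e : B → Tree) g (h : B → A → B) xs →
    (∀ pre x post b → pre ++ x ∷ post ≡ xs →
      g (enc x ∙ list (List.map enc post)) (e b) ≡ e (h b x)) →
    ∀ b → foldSpine g (list (List.map enc xs)) (e b) ≡ e (foldl h b xs)
  foldSpine-foldl {A = A} enc e g h xs body = go [] xs ≡.refl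
    where
    go : ∀ pre ys → pre ++ ys ≡ xs → ∀ b →
         foldSpine g (list (List.map enc ys)) (e b) ≡ e (foldl h b ys)
    go pre []       eq b = ≡.refl
    go pre (y ∷ ys) eq b = ≡.trans
      (≡.cong (foldSpine g (list (List.map enc ys))) (body pre y ys b eq))
      (go (pre ∷ʳ y) ys (≡.trans (Listₚ.++-assoc pre (y ∷ []) ys) eq) (h b y))

  iterate : ∀ {a} {A : Set a} → ℕ → (A → A) → A → A
  iterate zero    h x = x
  iterate (suc n) h x = iterate n h (h x)

  foldSpine-nat : ∀ {b} {B : Set b} (e : B → Tree) g (h : B → B) →
                  (∀ s b → g s (e b) ≡ e (h b)) →
                  ∀ n b → foldSpine g (nat n) (e b) ≡ e (iterate n h b)
  foldSpine-nat e g h body zero    b = ≡.refl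
  foldSpine-nat e g h body (suc n) b =
    ≡.trans (≡.cong (foldSpine g (nat n)) (body _ b)) (foldSpine-nat e g h body n (h b))

  foldl-sum : ∀ {a} {A : Set a} (f : A → ℕ) xs b → foldl (λ b x → f x + b) b xs ≡ sumOver xs f + b
  foldl-sum f []       b = ≡.refl
  foldl-sum f (x ∷ xs) b = ≡.trans (foldl-sum f xs (f x + b))
    (solve 3 (λ s x b → s :+ (x :+ b) := (x :+ s) :+ b) ≡.refl (sumOver xs f) (f x) b)
    where open Data.Nat.Solver.+-*-Solver

  iterate-+ : ∀ n c b → iterate n (c +_) b ≡ n * c + b
  iterate-+ zero    c b = ≡.refl
  iterate-+ (suc n) c b = ≡.trans (iterate-+ n c (c + b))
    (solve 3 (λ s x b → s :+ (x :+ b) := (x :+ s) :+ b) ≡.refl (n * c) c b)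
    where open Data.Nat.Solver.+-*-Solver

  foldl-any : ∀ {a} {A : Set a} (p : A → Bool) xs b → foldl (λ b x → p x ∨ b) b xs ≡ any p xs ∨ b
  foldl-any p []       b = ≡.refl
  foldl-any p (x ∷ xs) b = ≡.trans (foldl-any p xs (p x ∨ b)) (swap (any p xs) (p x))
    where
    swap : ∀ s x → s ∨ (x ∨ b) ≡ (x ∨ s) ∨ b
    swap true  true  = ≡.refl
    swap true  false = ≡.refl
    swap false true  = ≡.refl
    swap false false = ≡.refl

  reversed : ∀ {a} {A : Set a} → (A → Tree) → List A → Tree
  reversed f xs = list (foldl (λ b x → f x ∷ b) [] xs)

  dropSpine : ∀ {a} {A : Set a} (h : A → Tree) xs ys zs → length xs ≡ length ys →
              foldSpine (λ _ → tail) (list (List.map h xs)) (list (ys ++ zs)) ≡ list zs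
  dropSpine h []       []       zs eq = ≡.refl
  dropSpine h (x ∷ xs) (y ∷ ys) zs eq = dropSpine h xs ys zs (ℕₚ.suc-injective eq)

  foldl-reverse : ∀ {a} {A : Set a} (f : A → Tree) xs b →
                  foldl (λ b x → f x ∷ b) b xs ≡ reverse (List.map f xs) ++ b
  foldl-reverse f []       b = ≡.refl
  foldl-reverse f (x ∷ xs) b = ≡.trans (foldl-reverse f xs (f x ∷ b)) (≡.trans
    (≡.sym (Listₚ.++-assoc (reverse (List.map f xs)) (f x ∷ []) b))
    (≡.cong (_++ b) (≡.sym (Listₚ.unfold-reverse (f x) (List.map f xs)))))

  -- The reversed list starts with the entries of `post`; once as many are dropped, the entry of x
  -- is in front.
  nth-reversed : ∀ {a} {A : Set a} (h f : A → Tree) pre x post {xs} → pre ++ x ∷ post ≡ xs →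
                 head (foldSpine (λ _ → tail) (list (List.map h post)) (reversed f xs)) ≡ f x
  nth-reversed h f pre x post ≡.refl = ≡.trans
    (≡.cong (λ l → head (foldSpine (λ _ → tail) (list (List.map h post)) (list l)))
      (≡.trans (Listₚ.foldl-++ _ [] pre (x ∷ post)) (foldl-reverse f post _)))
    (≡.cong head (dropSpine h post (reverse (List.map f post)) _
      (≡.sym (≡.trans (Listₚ.length-reverse (List.map f post)) (Listₚ.length-map f post)))))

  pairTree : ℕ × ℕ → Tree
  pairTree (a , b) = nat a ∙ nat b

  encVertex : (τ : Task) → Fin (#vertices τ) → Tree
  encVertex τ v = nat (processingTime τ v) ∙ list (List.map bool (Vec.toList (successors τ v)))

  vertices-tree : ∀ τ → tail (tail (encodeTask τ)) ≡ list (List.map (encVertex τ) (allFin _))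
  vertices-tree τ = ≡.cong list (≡.sym (Listₚ.map-tabulate id (encVertex τ)))

  toList-allFin : ∀ {a} {A : Set a} {n} (xs : Vec A n) →
                  Vec.toList xs ≡ List.map (Vec.lookup xs) (allFin n)
  toList-allFin xs = ≡.trans (go xs) (≡.sym (Listₚ.map-tabulate id (Vec.lookup xs)))
    where
    go : ∀ {n} (xs : Vec _ n) → Vec.toList xs ≡ List.tabulate (Vec.lookup xs)
    go []       = ≡.refl
    go (x ∷ xs) = ≡.cong (x ∷_) (go xs)

  reversed-row : ∀ {n} (row : Vec Bool n) →
    foldSpine (λ s a → head s ∙ a) (list (List.map bool (Vec.toList row))) nil ≡
    reversed (λ w → bool (Vec.lookup row w)) (allFin n)
  reversed-row {n} row = ≡.trans
    (≡.cong (λ l → foldSpine (λ s a → head s ∙ a) (list l) nil)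
      (≡.trans (≡.cong (List.map bool) (toList-allFin row)) (≡.sym (Listₚ.map-∘ (allFin n)))))
    (foldSpine-foldl (λ w → bool (Vec.lookup row w)) list _ _ (allFin n) (λ _ _ _ _ _ → ≡.refl) [])

  module _ (τ : Task) where

    private
      V : Set
      V = Fin (#vertices τ)

      vs : List V
      vs = allFin (#vertices τ)

    stateTree : (V → ℕ) → Tree
    stateTree r = reversed (λ v → nat (r v)) vs

    foldVertices :
      ∀ {b} {B : Set b} (e : B → Tree) g (h : B → V → B) {s} → s ≡ encodeTask τ →
      (∀ pre v post b → pre ++ v ∷ post ≡ vs →
        g (encVertex τ v ∙ list (List.map (encVertex τ) post)) (e b) ≡ e (h b v)) →
      ∀ b → foldSpine g (tail (tail s)) (e b) ≡ e (foldl h b vs)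
    foldVertices e g h ≡.refl body b = ≡.trans
      (≡.cong (λ s → foldSpine g s (e b)) (vertices-tree τ))
      (foldSpine-foldl (encVertex τ) e g h vs body b)

    eval-blocked :
      ∀ {r k} (task suffix : Fin r) (state : Fin k) {ρ γ} (r : V → ℕ) pre w post {x} →
      Vec.lookup ρ task ≡ encodeTask τ →
      pre ++ w ∷ post ≡ vs → Vec.lookup ρ suffix ≡ x ∙ list (List.map (encVertex τ) post) →
      Vec.lookup γ state ≡ stateTree r →
      eval (blockedTerm task suffix state) ρ γ ≡ bool (blocked τ r w)
    eval-blocked task sw rs {ρ} {γ} r pre w post eq-τ eq-w eq-sw eq-rs = ≡.trans
      (foldVertices bool _ (λ b u → (positive (r u) ∧ Vec.lookup (successors τ u) w) ∨ b) eq-τ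
        body false)
      (≡.cong bool (≡.trans (foldl-any _ vs false) (Boolₚ.∨-identityʳ _)))
      where
      body : ∀ pre′ u post′ b → pre′ ++ u ∷ post′ ≡ vs →
             eval (blockedBody sw rs)
               (encVertex τ u ∷ (encVertex τ u ∙ list (List.map (encVertex τ) post′)) ∷ ρ)
               (bool b ∷ γ) ≡
             bool ((positive (r u) ∧ Vec.lookup (successors τ u) w) ∨ b)
      body pre′ u post′ b eq-u
        rewrite eq-rs | nth-reversed (encVertex τ) (λ v → nat (r v)) pre′ u post′ eq-u
        with r u
      ... | zero = ≡.refl
      ... | suc _
        rewrite reversed-row (successors τ u) | eq-sw
              | nth-reversed (encVertex τ) (λ w → bool (Vec.lookup (successors τ u) w)) pre w post eq-w
        with Vec.lookup (successors τ u) w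
      ...   | true  = ≡.refl
      ...   | false = ≡.refl

    eval-step :
      ∀ {r k} (task : Fin r) (state : Fin k) {ρ γ} (r : V → ℕ) →
      Vec.lookup ρ task ≡ encodeTask τ → Vec.lookup γ state ≡ stateTree r →
      eval (stepTerm task state) ρ γ ≡
      stateTree (λ w → if blocked τ r w then r w else pred (r w))
    eval-step task rs {ρ} {γ} r eq-τ eq-rs = foldVertices list _ _ eq-τ body []
      where
      body : ∀ pre w post b → pre ++ w ∷ post ≡ vs →
             eval (stepBody task rs)
               (encVertex τ w ∷ (encVertex τ w ∙ list (List.map (encVertex τ) post)) ∷ ρ)
               (list b ∷ γ) ≡
             list (nat (if blocked τ r w then r w else pred (r w)) ∷ b)
      body pre w post b eq-w
        rewrite eval-blocked (suc (suc task)) 1F (suc (suc rs))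
                  {encVertex τ w ∷ (encVertex τ w ∙ list (List.map (encVertex τ) post)) ∷ ρ}
                  {eval (nth (suc rs) (tl (var 1F)))
                     (encVertex τ w ∷ (encVertex τ w ∙ list (List.map (encVertex τ) post)) ∷ ρ)
                     (list b ∷ γ) ∷ list b ∷ γ} r pre w post eq-τ eq-w ≡.refl eq-rs
              | eq-rs | nth-reversed (encVertex τ) (λ v → nat (r v)) pre w post eq-w
        with blocked τ r w
      ... | true = ≡.refl
      ... | false with r w
      ...   | zero  = ≡.refl
      ...   | suc _ = ≡.refl

    eval-initial : ∀ {r k} (task : Fin r) {ρ} {γ : Vec Tree k} → Vec.lookup ρ task ≡ encodeTask τ →
                   eval (initialTerm task) ρ γ ≡ stateTree (remaining τ 0)
    eval-initial task eq-τ = foldVertices list _ _ eq-τ (λ _ _ _ _ _ → ≡.refl) []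

    simulated : ℕ × ℕ → Tree
    simulated (c , y) = nat c ∙ stateTree (remaining τ y)

    simulateStep : ℕ × ℕ → ℕ × ℕ
    simulateStep (zero  , y) = zero , suc y
    simulateStep (suc c , y) = c , y

    iterate-simulateStep : ∀ n c y →
      iterate n simulateStep (c , y) ≡ (c ∸ n , (n ∸ c) + y)
    iterate-simulateStep zero    c       y = ≡.cong (λ z → c , z + y) (≡.sym (ℕₚ.0∸n≡0 c))
    iterate-simulateStep (suc n) zero    y = ≡.trans (iterate-simulateStep n zero (suc y))
      (≡.cong₂ _,_ (ℕₚ.0∸n≡0 n) (ℕₚ.+-suc n y))
    iterate-simulateStep (suc n) (suc c) y = iterate-simulateStep n c y

    eval-simulate : ∀ {r k} (task : Fin r) (x : Fin k) {ρ γ} c →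
                    Vec.lookup ρ task ≡ encodeTask τ → Vec.lookup γ x ≡ nat c →
                    eval (simulateTerm task x) ρ γ ≡ stateTree (remaining τ (deadline τ ∸ c))
    eval-simulate task x {ρ} {γ} c eq-τ eq-x
      rewrite eval-initial task {ρ} {γ} eq-τ | eq-x = ≡.cong tail (≡.trans
        (≡.cong (λ s → foldSpine (λ s a → eval (simulateBody task) (head s ∷ s ∷ ρ) (a ∷ γ)) s
                         (nat c ∙ stateTree (remaining τ 0)))
          (≡.cong head eq-τ))
        (≡.trans
          (foldSpine-nat simulated _ simulateStep body (deadline τ) (c , 0))
          (≡.cong simulated (≡.trans (iterate-simulateStep (deadline τ) c 0)
            (≡.cong (c ∸ deadline τ ,_) (ℕₚ.+-identityʳ _))))))
      where
      body : ∀ s b → eval (simulateBody task) (head s ∷ s ∷ ρ) (simulated b ∷ γ) ≡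
                     simulated (simulateStep b)
      body s (suc c , y) = ≡.refl
      body s (zero  , y) = ≡.cong (nil ∙_) (eval-step (suc (suc task)) 0F {head s ∷ s ∷ ρ}
        {stateTree (remaining τ y) ∷ (nil ∙ stateTree (remaining τ y)) ∷ γ} (remaining τ y) eq-τ ≡.refl)

    move : ℕ × ℕ → ℕ × ℕ
    move (zero  , W) = zero , W
    move (suc c , W) = c , suc W

    iterate-move : ∀ n c W → c ≤ n → proj₂ (iterate n move (c , W)) ≡ c + W
    iterate-move zero    zero    W _ = ≡.refl
    iterate-move (suc n) zero    W _ = iterate-move n zero W z≤n
    iterate-move (suc n) (suc c) W (s≤s c≤n) =
      ≡.trans (iterate-move n c (suc W) c≤n) (ℕₚ.+-suc c W)

    eval-move : ∀ {r k} (ρ : Vec Tree r) (γ : Vec Tree k) s b →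
                eval moveBody (head s ∷ s ∷ ρ) (pairTree b ∷ γ) ≡ pairTree (move b)
    eval-move ρ γ s (zero  , W) = ≡.refl
    eval-move ρ γ s (suc c , W) = ≡.refl

    eval-addResidual :
      ∀ {r k} (task : Fin r) (state work : Fin k) {ρ γ} (r : V → ℕ) W →
      (∀ v → r v ≤ processingTime τ v) →
      Vec.lookup ρ task ≡ encodeTask τ → Vec.lookup γ state ≡ stateTree r →
      Vec.lookup γ work ≡ nat W →
      eval (addResidualTerm task state work) ρ γ ≡ nat (sumOver vs r + W)
    eval-addResidual task rs work {ρ} {γ} r W r≤p eq-τ eq-rs eq-W
      rewrite eq-W = ≡.trans
        (foldVertices nat _ (λ b v → r v + b) eq-τ body W)
        (≡.cong nat (foldl-sum r vs W))
      where
      body : ∀ pre v post b → pre ++ v ∷ post ≡ vs →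
             eval (addResidualBody rs)
               (encVertex τ v ∷ (encVertex τ v ∙ list (List.map (encVertex τ) post)) ∷ ρ)
               (nat b ∷ γ) ≡
             nat (r v + b)
      body pre v post b eq-v
        rewrite eq-rs | nth-reversed (encVertex τ) (λ v → nat (r v)) pre v post eq-v =
        ≡.trans
          (≡.cong tail (foldSpine-nat pairTree _ move (eval-move [] []) (processingTime τ v) (r v , b)))
          (≡.cong nat (iterate-move (processingTime τ v) (r v) b (r≤p v)))

    remaining≤processingTime : ∀ y v → remaining τ y v ≤ processingTime τ v
    remaining≤processingTime zero    v = ℕₚ.≤-refl
    remaining≤processingTime (suc y) v =
      ℕₚ.≤-trans (remaining-suc-≤ τ y v) (remaining≤processingTime y v)

    iterate-pred : ∀ n x → iterate n pred x ≡ x ∸ n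
    iterate-pred zero    x       = ≡.refl
    iterate-pred (suc n) zero    = ≡.trans (iterate-pred n 0) (ℕₚ.0∸n≡0 n)
    iterate-pred (suc n) (suc x) = iterate-pred n x

    tail-nat : ∀ x → tail (nat x) ≡ nat (pred x)
    tail-nat zero    = ≡.refl
    tail-nat (suc x) = ≡.refl

    demandStep : ℕ × ℕ → ℕ × ℕ
    demandStep (x , W) = x ∸ period τ , lateWork τ x + W

    iterate-demandStep : ∀ n x W → proj₂ (iterate n demandStep (x , W)) ≡ demandOf τ n x + W
    iterate-demandStep zero    x W = ≡.refl
    iterate-demandStep (suc n) x W = ≡.trans
      (iterate-demandStep n (x ∸ period τ) (lateWork τ x + W))
      (solve 3 (λ a b c → b :+ (a :+ c) := (a :+ b) :+ c) ≡.refl (lateWork τ x) _ W)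
      where open Data.Nat.Solver.+-*-Solver

    eval-addDemandBody : ∀ {r k} (task : Fin r) {ρ} {γ : Vec Tree k} → Vec.lookup ρ task ≡ encodeTask τ →
      ∀ s b → eval (addDemandBody task) (head s ∷ s ∷ ρ) (pairTree b ∷ γ) ≡ pairTree (demandStep b)
    eval-addDemandBody task {ρ} {γ} eq-τ s (x , W) = ≡.cong₂ _∙_
      (≡.trans
        (≡.cong (λ s → foldSpine (λ _ a → tail a) s (nat x)) (≡.cong (λ s → head (tail s)) eq-τ))
        (≡.trans (foldSpine-nat nat _ pred (λ _ → tail-nat) (period τ) x)
          (≡.cong nat (iterate-pred (period τ) x))))
      (eval-addResidual (suc (suc task)) 1F 0F {head s ∷ s ∷ ρ}
        {nat W ∷ eval (simulateTerm (suc (suc task)) 0F) (head s ∷ s ∷ ρ) (nat x ∷ pairTree (x , W) ∷ γ) ∷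
         nat x ∷ pairTree (x , W) ∷ γ}
        (remaining τ (deadline τ ∸ x)) W (remaining≤processingTime (deadline τ ∸ x)) eq-τ
        (eval-simulate (suc (suc task)) 0F {head s ∷ s ∷ ρ} {nat x ∷ pairTree (x , W) ∷ γ} x eq-τ ≡.refl)
        ≡.refl)

    eval-addDemand : ∀ {r k} (task 1+t : Fin r) (work : Fin k) {ρ γ} t W →
      Vec.lookup ρ task ≡ encodeTask τ → Vec.lookup ρ 1+t ≡ nat (suc t) →
      Vec.lookup γ work ≡ nat W →
      eval (addDemandTerm task 1+t work) ρ γ ≡ nat (demand τ t + W)
    eval-addDemand task 1+t work {ρ} {γ} t W eq-τ eq-t eq-W
      rewrite eq-t | eq-W = ≡.trans
        (≡.cong tail
          (foldSpine-nat pairTree _ demandStep (eval-addDemandBody task {ρ} {γ} eq-τ) (suc t) (t , W)))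
        (≡.cong nat (iterate-demandStep (suc t) t W))

  module _ (𝒯 : TaskSystem) where

    eval-totalDemand : ∀ {r k} (tasks 1+t : Fin r) {ρ} {γ : Vec Tree k} t →
      Vec.lookup ρ tasks ≡ list (List.map encodeTask 𝒯) → Vec.lookup ρ 1+t ≡ nat (suc t) →
      eval (totalDemandTerm tasks 1+t) ρ γ ≡ nat (totalDemand 𝒯 t)
    eval-totalDemand tasks 1+t {ρ} {γ} t eq-𝒯 eq-t rewrite eq-𝒯 = ≡.trans
      (foldSpine-foldl encodeTask nat _ (λ b τ → demand τ t + b) 𝒯
        (λ pre τ post b _ → eval-addDemand τ 0F (suc (suc 1+t)) 0F
          {encodeTask τ ∷ (encodeTask τ ∙ list (List.map encodeTask post)) ∷ ρ} {nat b ∷ γ}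
          t b ≡.refl eq-t ≡.refl) 0)
      (≡.cong nat (≡.trans (foldl-sum (λ τ → demand τ t) 𝒯 0) (ℕₚ.+-identityʳ _)))

    drop : ℕ × ℕ → ℕ × ℕ
    drop (zero  , W) = zero , W
    drop (suc c , W) = c , pred W

    iterate-drop : ∀ n c W → proj₂ (iterate n drop (c , W)) ≡ W ∸ (c ⊓ n)
    iterate-drop zero    c       W       = ≡.cong (W ∸_) (≡.sym (ℕₚ.⊓-zeroʳ c))
    iterate-drop (suc n) zero    W       = iterate-drop n zero W
    iterate-drop (suc n) (suc c) zero    = ≡.trans (iterate-drop n c zero) (ℕₚ.0∸n≡0 (c ⊓ n))
    iterate-drop (suc n) (suc c) (suc W) = iterate-drop n c W

    eval-dropBody : ∀ {r k} (ρ : Vec Tree r) (γ : Vec Tree k) s b →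
                    eval dropBody (head s ∷ s ∷ ρ) (pairTree b ∷ γ) ≡ pairTree (drop b)
    eval-dropBody ρ γ s (zero  , W)     = ≡.refl
    eval-dropBody ρ γ s (suc c , zero)  = ≡.refl
    eval-dropBody ρ γ s (suc c , suc W) = ≡.refl

    eval-capacityBody : ∀ {r k} (limit : Fin r) (m : Fin k) {ρ γ} L M →
      Vec.lookup ρ limit ≡ nat L → Vec.lookup γ m ≡ nat M →
      ∀ s W → eval (capacityBody limit m) (head s ∷ s ∷ ρ) (nat W ∷ γ) ≡ nat (W ∸ (M ⊓ L))
    eval-capacityBody limit m {ρ} {γ} L M eq-L eq-M s W rewrite eq-L | eq-M = ≡.trans
      (≡.cong tail (foldSpine-nat pairTree _ drop (eval-dropBody [] []) L (M , W)))
      (≡.cong nat (iterate-drop L M W))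

    iterate-∸ : ∀ n c W → iterate n (_∸ c) W ≡ W ∸ n * c
    iterate-∸ zero    c W = ≡.refl
    iterate-∸ (suc n) c W = ≡.trans (iterate-∸ n c (W ∸ c)) (ℕₚ.∸-+-assoc W c (n * c))

    eval-excess : ∀ {r k} (tasks limit 1+t : Fin r) (m : Fin k) {ρ γ} L t M →
      Vec.lookup ρ tasks ≡ list (List.map encodeTask 𝒯) → Vec.lookup ρ limit ≡ nat L →
      Vec.lookup ρ 1+t ≡ nat (suc t) → Vec.lookup γ m ≡ nat M →
      eval (excessTerm tasks limit 1+t m) ρ γ ≡ nat (totalDemand 𝒯 t ∸ t * (M ⊓ L))
    eval-excess tasks limit 1+t m {ρ} {γ} L t M eq-𝒯 eq-L eq-t eq-M
      rewrite eval-totalDemand tasks 1+t {ρ} {γ} t eq-𝒯 eq-t | eq-t = ≡.trans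
        (foldSpine-nat nat _ (_∸ (M ⊓ L))
          (eval-capacityBody limit (suc m) {ρ} {nat (totalDemand 𝒯 t) ∷ γ} L M eq-L eq-M)
          t (totalDemand 𝒯 t))
        (≡.cong nat (iterate-∸ t (M ⊓ L) (totalDemand 𝒯 t)))

    -- The fold meets the largest t first. The induction ranges over all accumulators, because an
    -- excess replaces the accumulator by `nil`, from which no later round recovers.
    foldVerdict : ∀ g (excess : ℕ → ℕ) → (∀ t a → g (nat (suc t)) a ≡ ifNode (nat (excess t)) nil a) →
      ∀ L a → (IsNode (foldSpine g (nat L) a) → IsNode a × (∀ t → t < L → excess t ≡ 0)) ×
              (foldSpine g (nat L) a ≡ nil → a ≡ nil ⊎ ∃ λ t → t < L × 0 < excess t)
    foldVerdict g excess eq zero    a = (λ node → node , λ t ()) , inj₁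
    foldVerdict g excess eq (suc L) a rewrite eq L a
      with excess L in eq-L | foldVerdict g excess eq L
    ... | zero | rec =
      (λ node → let a-node , ok = proj₁ (rec a) node in a-node , λ t t<1+L → extend ok t (ℕₚ.m<1+n⇒m<n∨m≡n t<1+L))
      , λ isNil → Sum.map₂ (λ { (t , t<L , p) → t , ℕₚ.m≤n⇒m≤1+n t<L , p }) (proj₂ (rec a) isNil)
      where
      extend : (∀ t → t < L → excess t ≡ 0) → ∀ t → t < L ⊎ t ≡ L → excess t ≡ 0
      extend ok t (inj₁ t<L)    = ok t t<L
      extend ok t (inj₂ ≡.refl) = eq-L
    ... | suc e | rec =
      (λ node → ⊥-elim (proj₁ (proj₁ (rec nil) node)))
      , λ _ → inj₂ (L , ℕₚ.≤-refl , ≡.subst (0 <_) (≡.sym eq-L) (s≤s z≤n))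

    eval-limit : ∀ n (γ : Vec Tree 1) →
      eval limitTerm (list (List.map encodeTask 𝒯) ∷ nat n ∷ []) γ ≡ nat (suc (horizon n 𝒯))
    eval-limit n γ = ≡.trans
      (foldSpine-nat nat _ (slack 𝒯 +_) (λ s b → ≡.trans
        (foldSpine-foldl encodeTask nat _ (λ b τ → deadline τ * volume τ + b) 𝒯
          (λ _ τ _ b _ → ≡.trans
            (foldSpine-nat nat _ (volume τ +_) (λ s b → ≡.trans
              (foldVertices τ nat _ (λ b v → processingTime τ v + b) ≡.refl
                (λ _ v _ b _ → ≡.trans
                  (foldSpine-nat nat _ suc (λ _ _ → ≡.refl) (processingTime τ v) b)
                  (≡.cong nat (iterate-suc (processingTime τ v) b))) b)
              (≡.cong nat (foldl-sum (processingTime τ) (allFin _) b)))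
              (deadline τ) b)
            (≡.cong nat (iterate-+ (deadline τ) (volume τ) b))) b)
        (≡.cong nat (foldl-sum (λ τ → deadline τ * volume τ) 𝒯 b)))
        n 2)
      (≡.cong nat (≡.trans (iterate-+ n (slack 𝒯) 2) (ℕₚ.+-comm _ 2)))
      where
      iterate-suc : ∀ n b → iterate n suc b ≡ n + b
      iterate-suc zero    b = ≡.refl
      iterate-suc (suc n) b = ≡.trans (iterate-suc n (suc b)) (ℕₚ.+-suc n b)

-- The test as a WHILE program, and its running time

module TestProgram where

  open import Data.Nat.Base using (_+_; _*_; _∸_; _⊓_; _≤_; _<_; pred; s≤s⁻¹)
  open FoldLanguage
  open Polynomials
  open Sums
  open Counting
  open Demand
  open SchedulabilityTest
  open Task

  height-nat : ∀ n → height (nat n) ≡ n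
  height-nat zero    = ≡.refl
  height-nat (suc n) = ≡.cong suc (height-nat n)

  height-list : ∀ xs {c} → All (λ x → height x ≤ c) xs → height (list xs) ≤ length xs + c
  height-list []       []        = z≤n
  height-list (x ∷ xs) (h ∷ all) =
    s≤s (ℕₚ.⊔-lub (ℕₚ.≤-trans h (ℕₚ.m≤n+m _ (length xs))) (height-list xs all))

  height-bool : ∀ b → height (bool b) ≤ 1
  height-bool false = z≤n
  height-bool true  = ℕₚ.≤-refl

  module _ (τ : Task) where

    volume≡ : volume τ ≡ sum (List.tabulate (processingTime τ))
    volume≡ = ≡.cong sum (Listₚ.map-tabulate id (processingTime τ))

    volume≤size : volume τ ≤ taskSize τ
    volume≤size = ℕₚ.≤-trans (ℕₚ.≤-reflexive volume≡)
      (ℕₚ.≤-trans (ℕₚ.m≤n+m _ (#vertices τ + #edges τ))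
        (ℕₚ.≤-trans (ℕₚ.m≤m+n _ (deadline τ)) (ℕₚ.m≤m+n _ (period τ))))

    deadline≤size : deadline τ ≤ taskSize τ
    deadline≤size = ℕₚ.≤-trans (ℕₚ.m≤n+m (deadline τ) _) (ℕₚ.m≤m+n _ (period τ))

    period≤size : period τ ≤ taskSize τ
    period≤size = ℕₚ.m≤n+m (period τ) _

    #vertices≤size : #vertices τ ≤ taskSize τ
    #vertices≤size =
      ℕₚ.≤-trans (ℕₚ.m≤m+n (#vertices τ) _) (ℕₚ.≤-trans (ℕₚ.m≤m+n _ _)
        (ℕₚ.≤-trans (ℕₚ.m≤m+n _ (deadline τ)) (ℕₚ.m≤m+n _ (period τ))))

    height-vertex : ∀ {s} → taskSize τ ≤ s → ∀ v → height (encVertex τ v) ≤ suc (s + 1)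
    height-vertex {s} le v = s≤s (ℕₚ.⊔-lub
      (begin
        height (nat (processingTime τ v)) ≡⟨ height-nat (processingTime τ v) ⟩
        processingTime τ v                ≤⟨ ∈⇒≤sumOver (processingTime τ) (∈ₚ.∈-allFin v) ⟩
        volume τ                          ≤⟨ volume≤size ⟩
        taskSize τ                        ≤⟨ le ⟩
        s                                 ≤⟨ ℕₚ.m≤m+n s 1 ⟩
        s + 1                             ∎)
      (begin
        height (list bits)                ≤⟨ height-list bits (Allₚ.map⁺ (All.universal height-bool (Vec.toList (successors τ v)))) ⟩
        length bits + 1
          ≡⟨ ≡.cong (_+ 1) (≡.trans (Listₚ.length-map bool (Vec.toList (successors τ v))) (Vecₚ.length-toList (successors τ v))) ⟩
        #vertices τ + 1                   ≤⟨ ℕₚ.+-monoˡ-≤ 1 (ℕₚ.≤-trans #vertices≤size le) ⟩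
        s + 1                             ∎))
      where
      open ℕₚ.≤-Reasoning
      bits : List Tree
      bits = List.map bool (Vec.toList (successors τ v))

    height-task : ∀ {s} → taskSize τ ≤ s → height (encodeTask τ) ≤ 2 + (s + suc (s + 1))
    height-task {s} le = s≤s (ℕₚ.⊔-lub
      (ℕₚ.m≤n⇒m≤1+n (small deadline≤size))
      (s≤s (ℕₚ.⊔-lub (small period≤size) (begin
        height (tail (tail (encodeTask τ)))
          ≡⟨ ≡.cong height (vertices-tree τ) ⟩
        height (list (List.map (encVertex τ) (allFin _)))
          ≤⟨ height-list (List.map (encVertex τ) (allFin _)) (Allₚ.map⁺ (All.universal (height-vertex le) (allFin _))) ⟩
        length (List.map (encVertex τ) (allFin _)) + suc (s + 1)
          ≡⟨ ≡.cong (_+ suc (s + 1)) (≡.trans (Listₚ.length-map (encVertex τ) (allFin _)) (Listₚ.length-tabulate id)) ⟩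
        #vertices τ + suc (s + 1)
          ≤⟨ ℕₚ.+-monoˡ-≤ (suc (s + 1)) (ℕₚ.≤-trans #vertices≤size le) ⟩
        s + suc (s + 1) ∎))))
      where
      open ℕₚ.≤-Reasoning
      small : ∀ {n} → n ≤ taskSize τ → height (nat n) ≤ s + suc (s + 1)
      small {n} n≤ = ℕₚ.≤-trans (ℕₚ.≤-reflexive (height-nat n))
        (ℕₚ.≤-trans n≤ (ℕₚ.≤-trans le (ℕₚ.m≤m+n s _)))

  module _ (𝒯 : TaskSystem) where

    tasksTree : Tree
    tasksTree = list (List.map encodeTask 𝒯)

    height-tasks : height tasksTree ≤ size 𝒯 + (2 + (size 𝒯 + suc (size 𝒯 + 1)))
    height-tasks = ℕₚ.≤-trans
      (height-list (List.map encodeTask 𝒯) (Allₚ.map⁺ (All.tabulate λ {τ} τ∈ →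
        height-task τ (ℕₚ.≤-trans (∈⇒≤sumOver taskSize τ∈) (ℕₚ.m≤n+m _ (length 𝒯))))))
      (ℕₚ.+-monoˡ-≤ _ (ℕₚ.≤-trans (ℕₚ.≤-reflexive (Listₚ.length-map encodeTask 𝒯)) (ℕₚ.m≤m+n _ _)))

    -- Bounds the depth of the one read-only tree that the program computes, the limit.
    slack≤ : slack 𝒯 ≤ size 𝒯 * size 𝒯
    slack≤ = ℕₚ.≤-trans
      (sumOver-mono-All {xs = 𝒯} (All.tabulate λ {τ} τ∈ → ℕₚ.*-mono-≤
        (ℕₚ.≤-trans (deadline≤size τ) (ℕₚ.≤-trans (∈⇒≤sumOver taskSize τ∈) (ℕₚ.m≤n+m _ (length 𝒯))))
        (volume≤size τ)))
      (ℕₚ.≤-trans (ℕₚ.≤-reflexive (sumOver-* 𝒯 (size 𝒯) taskSize))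
        (ℕₚ.*-monoʳ-≤ (size 𝒯) (ℕₚ.m≤n+m _ (length 𝒯))))

  module _ (n : ℕ) where

    numeral : ℕ → Expr 2
    numeral zero    = nil
    numeral (suc k) = cons nil (numeral k)

    numeral-correct : ∀ k σ → ⟦ numeral k ⟧ σ ≡ nat k
    numeral-correct zero    σ = ≡.refl
    numeral-correct (suc k) σ = ≡.cong (nil ∙_) (numeral-correct k σ)

    setRefs : Command 2
    setRefs = readOnly ≔ cons (tl (var values)) (cons (numeral n) nil)

    -- There are two stages because only read-only trees drive folds: the result of `limitTerm` has
    -- to be moved to the read-only stack before `testTerm` can loop along it. The number m stays on
    -- the stack of values.
    program : Program
    program = record
      { #auxiliary = 1
      ; body =
          setRefs ⨾
          values ≔ cons (hd (var values)) nil ⨾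
          compile limitTerm ⨾
          push readOnly (hd (var values)) ⨾
          values ≔ tl (var values) ⨾
          compile testTerm ⨾
          values ≔ hd (var values)
      }

    verdict : TaskSystem → ℕ → Tree
    verdict 𝒯 m =
      eval testTerm (nat (suc (horizon n 𝒯)) ∷ tasksTree 𝒯 ∷ nat n ∷ []) (nat m ∷ [])

    depth₁ depth₂ runningTime : ℕ → ℕ
    depth₁ s = (s + (2 + (s + suc (s + 1)))) + n
    depth₂ s = depth₁ s + suc (suc (n * (s * s)))
    runningTime s =
      -- The numerals are the costs of the four assignments other than `setRefs`.
      costOf setRefs + (5 + (time limitTerm (depth₁ s) + (5 + (3 + (time testTerm (depth₂ s) + 3)))))

    depth₁-poly : PolynomiallyBounded depth₁
    depth₁-poly = poly-+ (poly-+ poly-id (poly-+ (poly-const 2) (poly-+ poly-id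
      (poly-+ (poly-const 1) (poly-+ poly-id (poly-const 1)))))) (poly-const n)

    depth₂-poly : PolynomiallyBounded depth₂
    depth₂-poly = poly-+ depth₁-poly
      (poly-+ (poly-const 2) (poly-* (poly-const n) (poly-* poly-id poly-id)))

    runningTime-poly : PolynomiallyBounded runningTime
    runningTime-poly = poly-+ (poly-const (costOf setRefs)) (poly-+ (poly-const 5)
      (poly-+ (poly-∘ {time limitTerm} (time-poly limitTerm) depth₁-poly)
      (poly-+ (poly-const 5) (poly-+ (poly-const 3)
      (poly-+ (poly-∘ {time testTerm} (time-poly testTerm) depth₂-poly) (poly-const 3))))))

    program-run : ∀ 𝒯 m →
      ∃ λ σ → ⟨ Program.body program , initial (encode 𝒯 m) ⟩⇓≤[ runningTime (size 𝒯) ] σ ×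
              Vec.head σ ≡ verdict 𝒯 m
    program-run 𝒯 m = _ , run , ≡.refl
      where
      s : ℕ
      s = size 𝒯

      refs₁ : Vec Tree 2
      refs₁ = tasksTree 𝒯 ∷ nat n ∷ []

      bounded₁ : Bounded (depth₁ s) refs₁
      bounded₁ = ℕₚ.≤-trans (height-tasks 𝒯) (ℕₚ.m≤m+n _ n)
               ∷ ℕₚ.≤-trans (ℕₚ.≤-reflexive (height-nat n)) (ℕₚ.m≤n+m n _) ∷ []

      bounded₂ : Bounded (depth₂ s) (nat (suc (horizon n 𝒯)) ∷ refs₁)
      bounded₂ = ℕₚ.≤-trans (ℕₚ.≤-reflexive (height-nat (suc (horizon n 𝒯))))
                   (ℕₚ.≤-trans (s≤s (s≤s (ℕₚ.*-monoʳ-≤ n (slack≤ 𝒯)))) (ℕₚ.m≤n+m _ (depth₁ s)))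
               ∷ VecAll.map (λ h → ℕₚ.≤-trans h (ℕₚ.m≤m+n _ _)) bounded₁

      run : ⟨ Program.body program , initial (encode 𝒯 m) ⟩⇓≤[ runningTime s ]
              state (verdict 𝒯 m) (stack (nat (suc (horizon n 𝒯)) ∷ refs₁))
      run =
        cast⇓ (≡.cong (λ t → state (encode 𝒯 m) (tasksTree 𝒯 ∙ (t ∙ nil)))
          (numeral-correct n (initial (encode 𝒯 m)))) assign⇓ ⨾⇓
        assign⇓ ⨾⇓
        compile-correct limitTerm refs₁ (nat m ∷ []) (depth₁ s) bounded₁ ⨾⇓
        cast⇓ (≡.cong (λ t → state (eval limitTerm refs₁ (nat m ∷ []) ∙ nat m ∙ nil) (t ∙ stack refs₁))
          (eval-limit 𝒯 n (nat m ∷ []))) assign⇓ ⨾⇓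
        assign⇓ ⨾⇓
        compile-correct testTerm (nat (suc (horizon n 𝒯)) ∷ refs₁) (nat m ∷ []) (depth₂ s) bounded₂ ⨾⇓
        assign⇓

    program-polynomial : PseudopolynomialTime program
    program-polynomial =
      let a , d , bound = runningTime-poly
      in  a , d , λ 𝒯 m →
          let σ , (k , run , k≤) , out = program-run 𝒯 m
          in  verdict 𝒯 m , k , σ , run , ℕₚ.≤-trans k≤ (bound (size 𝒯)) , out

    output≡verdict : ∀ 𝒯 m {b y} → HaltsWithin program (encode 𝒯 m) b y → y ≡ verdict 𝒯 m
    output≡verdict 𝒯 m (k , σ , run , _ , out) =
      let σ′ , (_ , run′ , _) , out′ = program-run 𝒯 m
      in  ≡.trans (≡.sym out) (≡.trans (≡.cong Vec.head (deterministic run run′)) out′)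

    verdict-spec : ∀ 𝒯 m →
      let L = suc (horizon n 𝒯)
          excess = λ t → totalDemand 𝒯 t ∸ t * (m ⊓ L)
      in (IsNode (verdict 𝒯 m) → IsNode (nil ∙ nil) × (∀ t → t < L → excess t ≡ 0)) ×
         (verdict 𝒯 m ≡ nil → (nil ∙ nil ≡ nil) ⊎ ∃ λ t → t < L × 0 < excess t)
    verdict-spec 𝒯 m = foldVerdict 𝒯 _ _
      (λ t a → ≡.cong (λ e → ifNode e nil a)
        (eval-excess 𝒯 (suc (suc (suc zero))) (suc (suc zero)) (suc zero) (suc zero)
          {nil ∷ nat (suc t) ∷ nat L ∷ tasksTree 𝒯 ∷ nat n ∷ []} {a ∷ nat m ∷ []}
          L t m ≡.refl ≡.refl ≡.refl ≡.refl))
      L (nil ∙ nil)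
      where
      L : ℕ
      L = suc (horizon n 𝒯)

    -- The capacity `m ⊓ suc (horizon n 𝒯)` that was checked is at most m, so the truncation errs on
    -- the safe side here; only rejection has to justify it.
    accepts⇒ : ∀ 𝒯 m → Accepts program 𝒯 m → ∀ t → t ≤ horizon n 𝒯 → totalDemand 𝒯 t ≤ t * m
    accepts⇒ 𝒯 m (b , y , halts , node) t t≤H = ℕₚ.≤-trans
      (ℕₚ.m∸n≡0⇒m≤n (proj₂ (proj₁ (verdict-spec 𝒯 m)
        (≡.subst IsNode (output≡verdict 𝒯 m halts) node)) t (s≤s t≤H)))
      (ℕₚ.*-monoʳ-≤ t (ℕₚ.m⊓n≤m m _))

    rejects⇒ : .{{_ : NonZero n}} → ∀ 𝒯 m → Rejects program 𝒯 m → Overloaded 𝒯 m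
    rejects⇒ 𝒯 m (b , halts)
      with proj₂ (verdict-spec 𝒯 m) (≡.sym (output≡verdict 𝒯 m halts))
    ... | inj₂ (t , _ , excess) = overload n m 𝒯 t (ℕₚ.m∸n≢0⇒n<m (ℕₚ.>⇒≢ excess))

-- The infinite-processor schedule of given releases

-- S∞ for a whole set of releases, in which every dag-job is served from its
-- release on
module Virtual {𝒯 : TaskSystem} where

  open import Data.Nat.Base using (_+_; _*_; _∸_; _≤_; _<_; pred)
  open Demand
  open Job

  taskOf : Fin (length 𝒯) → Task
  taskOf = List.lookup 𝒯

  -- By truncated subtraction a job has its full work left before its release.
  virtualRemaining : ℕ → Job 𝒯 → ℕ
  virtualRemaining y j = remaining (taskOf (index j)) (y ∸ releaseDate j) (vertex j)

  virtualRemaining-0 : ∀ j → virtualRemaining 0 j ≡ work j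
  virtualRemaining-0 j =
    ≡.cong (λ y → remaining (taskOf (index j)) y (vertex j)) (ℕₚ.0∸n≡0 (releaseDate j))

  data VirtualStep (y : ℕ) (j : Job 𝒯) : Set where
    unreleased : y < releaseDate j →
                 virtualRemaining (suc y) j ≡ virtualRemaining y j → VirtualStep y j
    waits      : ∀ i → Precedes i j → virtualRemaining y i ≢ 0 →
                 virtualRemaining (suc y) j ≡ virtualRemaining y j → VirtualStep y j
    runs       : releaseDate j ≤ y → (∀ {i} → Precedes i j → virtualRemaining y i ≡ 0) →
                 virtualRemaining (suc y) j ≡ pred (virtualRemaining y j) → VirtualStep y j

  virtualStep : ∀ y j → VirtualStep y j
  virtualStep y (job i r v) with r ℕₚ.≤? y
  ... | no r≰y = unreleased (ℕₚ.≰⇒> r≰y) (≡.cong (λ z → remaining (taskOf i) z v)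
          (≡.trans (ℕₚ.m≤n⇒m∸n≡0 (ℕₚ.≰⇒> r≰y)) (≡.sym (ℕₚ.m≤n⇒m∸n≡0 (ℕₚ.<⇒≤ (ℕₚ.≰⇒> r≰y))))))
  ... | yes r≤y with step (taskOf i) (y ∸ r) v
  ...   | waits u e ru≢0 eq = waits (job i r u) (edge e) ru≢0 (≡.trans next eq)
    where
    next : virtualRemaining (suc y) (job i r v) ≡ remaining (taskOf i) (suc (y ∸ r)) v
    next = ≡.cong (λ z → remaining (taskOf i) z v) (ℕₚ.+-∸-assoc 1 r≤y)
  ...   | runs preds eq = runs r≤y (λ { (edge e) → preds _ e }) (≡.trans next eq)
    where
    next : virtualRemaining (suc y) (job i r v) ≡ remaining (taskOf i) (suc (y ∸ r)) v
    next = ≡.cong (λ z → remaining (taskOf i) z v) (ℕₚ.+-∸-assoc 1 r≤y)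

  progress : ℕ → Job 𝒯 → ℕ
  progress y j = virtualRemaining y j ∸ virtualRemaining (suc y) j

  progress-idle : ∀ y j → virtualRemaining (suc y) j ≡ virtualRemaining y j → progress y j ≡ 0
  progress-idle y j eq = ℕₚ.m≤n⇒m∸n≡0 (ℕₚ.≤-reflexive (≡.sym eq))

  virtualRemaining-suc : ∀ y j → virtualRemaining y j ≡ progress y j + virtualRemaining (suc y) j
  virtualRemaining-suc y j = ≡.sym (ℕₚ.m∸n+n≡m (≤-step (virtualStep y j)))
    where
    ≤-step : VirtualStep y j → virtualRemaining (suc y) j ≤ virtualRemaining y j
    ≤-step (unreleased _ eq) = ℕₚ.≤-reflexive eq
    ≤-step (waits _ _ _ eq)  = ℕₚ.≤-reflexive eq
    ≤-step (runs _ _ eq)     = ℕₚ.≤-trans (ℕₚ.≤-reflexive eq) ℕₚ.pred[n]≤n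

  progress≤1 : ∀ y j → progress y j ≤ 1
  progress≤1 y j with virtualStep y j
  ... | unreleased _ eq = ℕₚ.≤-trans (ℕₚ.≤-reflexive (progress-idle y j eq)) z≤n
  ... | waits _ _ _ eq  = ℕₚ.≤-trans (ℕₚ.≤-reflexive (progress-idle y j eq)) z≤n
  ... | runs _ _ eq rewrite eq with virtualRemaining y j
  ...   | zero  = z≤n
  ...   | suc n = ℕₚ.≤-reflexive (ℕₚ.m+n∸n≡m 1 n)

module DagJobs {𝒯 : TaskSystem} (R : Releases 𝒯) (d : ℕ) where

  open import Data.Nat.Base using (_+_; _*_; _∸_; _≤_; _<_; s≤s⁻¹)
  open Sums
  open Counting
  open Demand
  open Task
  open Releases R
  open Job

  open Virtual {𝒯}

  relevant : Fin (length 𝒯) → ℕ → Bool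
  relevant i r = released i r ∧ (r + deadline (taskOf i) ℕ.≤ᵇ d)

  relevant⁻ : ∀ i r → T (relevant i r) → T (released i r) × r + deadline (taskOf i) ≤ d
  relevant⁻ i r t =
    let rel , le = Equivalence.to Boolₚ.T-∧ t in rel , ℕₚ.≤ᵇ⇒≤ _ _ le

  relevant⁺ : ∀ i r → T (released i r) → r + deadline (taskOf i) ≤ d → relevant i r ≡ true
  relevant⁺ i r rel le =
    Equivalence.to Boolₚ.T-≡ (Equivalence.from Boolₚ.T-∧ (rel , ℕₚ.≤⇒≤ᵇ le))

  dagJobs : Fin (length 𝒯) → ℕ → List (Job 𝒯)
  dagJobs i r = if relevant i r then List.map (job i r) (allFin _) else []

  taskJobs : Fin (length 𝒯) → List (Job 𝒯)
  taskJobs i = concatMap (dagJobs i) (downFrom (suc d))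

  jobs : List (Job 𝒯)
  jobs = concatMap taskJobs (allFin _)

  ∈-dagJobs⁻ : ∀ {j} i r → j ∈ dagJobs i r → T (relevant i r) × ∃ λ v → j ≡ job i r v
  ∈-dagJobs⁻ i r j∈ with relevant i r
  ... | true = let v , _ , eq = ∈ₚ.∈-map⁻ (job i r) j∈ in tt , v , eq

  ∈-taskJobs⁻ : ∀ {j} i → j ∈ taskJobs i → ∃₂ λ r v → T (relevant i r) × j ≡ job i r v
  ∈-taskJobs⁻ i j∈ =
    let r , _ , j∈′ = Membership.find (∈ₚ.∈-concatMap⁻ (dagJobs i) {xs = downFrom (suc d)} j∈)
        rel , v , eq = ∈-dagJobs⁻ i r j∈′
    in  r , v , rel , eq

  ∈-jobs⁻ : ∀ {j} → j ∈ jobs → Generated R j × absoluteDeadline j ≤ d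
  ∈-jobs⁻ j∈ with Membership.find (∈ₚ.∈-concatMap⁻ taskJobs {xs = allFin _} j∈)
  ... | i , _ , j∈′ with ∈-taskJobs⁻ i j∈′
  ...   | r , v , rel , ≡.refl = relevant⁻ i r rel

  ∈-jobs⁺ : ∀ {j} → Generated R j → absoluteDeadline j ≤ d → j ∈ jobs
  ∈-jobs⁺ {job i r v} gen le =
    ∈ₚ.∈-concatMap⁺ taskJobs (Membership.lose (∈ₚ.∈-allFin i)
      (∈ₚ.∈-concatMap⁺ (dagJobs i) (Membership.lose
        (∈ₚ.∈-downFrom⁺ (s≤s (ℕₚ.≤-trans (ℕₚ.m≤m+n r _) le))) in-dag)))
    where
    in-dag : job i r v ∈ dagJobs i r
    in-dag rewrite relevant⁺ i r gen le = ∈ₚ.∈-map⁺ (job i r) (∈ₚ.∈-allFin v)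

  -- Without repetitions a processor accounts for at most one entry of the list, on which
  -- `#running-≤` depends.
  unique-jobs : Unique jobs
  unique-jobs = Uniqueₚ.concat⁺
    (Allₚ.map⁺ (All.universal unique-taskJobs (allFin _)))
    (AllPairsₚ.map⁺ (AllPairs.map disjoint (Uniqueₚ.allFin⁺ _)))
    where
    unique-dagJobs : ∀ i r → Unique (dagJobs i r)
    unique-dagJobs i r with relevant i r
    ... | true  = Uniqueₚ.map⁺ (λ { ≡.refl → ≡.refl }) (Uniqueₚ.allFin⁺ _)
    ... | false = []

    unique-taskJobs : ∀ i → Unique (taskJobs i)
    unique-taskJobs i = Uniqueₚ.concat⁺
      (Allₚ.map⁺ (All.universal (unique-dagJobs i) (downFrom (suc d))))
      (AllPairsₚ.map⁺ (AllPairs.map (disjointᵣ i) (Uniqueₚ.downFrom⁺ (suc d))))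
      where
      disjointᵣ : ∀ i {r r′} → r ≢ r′ → ∀ {j} → ¬ (j ∈ dagJobs i r × j ∈ dagJobs i r′)
      disjointᵣ i {r} {r′} r≢r′ (j∈ , j∈′) with ∈-dagJobs⁻ i r j∈ | ∈-dagJobs⁻ i r′ j∈′
      ... | _ , _ , ≡.refl | _ , _ , eq = r≢r′ (≡.cong releaseDate eq)

    disjoint : ∀ {i i′} → i ≢ i′ → ∀ {j} → ¬ (j ∈ taskJobs i × j ∈ taskJobs i′)
    disjoint {i} {i′} i≢i′ (j∈ , j∈′) with ∈-taskJobs⁻ i j∈ | ∈-taskJobs⁻ i′ j∈′
    ... | _ , _ , _ , ≡.refl | _ , _ , _ , eq = i≢i′ (≡.cong index eq)

  virtualWork : ℕ → ℕ
  virtualWork y = sumOver jobs (virtualRemaining y)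

  virtualWork≡ : ∀ y → virtualWork y ≡
    sumOver (allFin _) (λ i → sumOver (downFrom (suc d)) (releasedResidual (taskOf i) (relevant i) y))
  virtualWork≡ y = ≡.trans (sumOver-concatMap taskJobs (allFin _) _)
    (sumOver-cong (allFin _) λ i → ≡.trans
      (sumOver-concatMap (dagJobs i) (downFrom (suc d)) _)
      (sumOver-cong (downFrom (suc d)) (dag i)))
    where
    dag : ∀ i r → sumOver (dagJobs i r) (virtualRemaining y) ≡ releasedResidual (taskOf i) (relevant i) y r
    dag i r with relevant i r
    ... | true  = ≡.cong sum (≡.sym (Listₚ.map-∘ {g = virtualRemaining y} {f = job i r} (allFin _)))
    ... | false = ≡.refl

  -- All these jobs are due by d, so what S∞ has left of them at y is late work for a window of
  -- length d - y. `demandOf-stable` reduces the `suc d` terms, one per possible release date, to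
  -- those of `demand`.
  virtualWork-≤ : NoOverrun 𝒯 → ∀ {y} → y ≤ d → virtualWork y ≤ totalDemand 𝒯 (d ∸ y)
  virtualWork-≤ ok {y} y≤d = begin
    virtualWork y
      ≡⟨ virtualWork≡ y ⟩
    sumOver (allFin _) (λ i → sumOver (downFrom (suc d)) (releasedResidual (taskOf i) (relevant i) y))
      ≤⟨ sumOver-mono (allFin _) (λ i → released-≤-demandOf (taskOf i) (relevant i)
           (λ {r} {u} rel-r rel-u → separated i (proj₁ (relevant⁻ i r rel-r)) (proj₁ (relevant⁻ i u rel-u)))
           y (suc d) (suc d) (d ∸ y) ℕₚ.≤-refl (λ {r} _ → early i r)) ⟩
    sumOver (allFin _) (λ i → demandOf (taskOf i) (suc d) (d ∸ y))
      ≡⟨ sumOver-lookup 𝒯 (λ τ → demandOf τ (suc d) (d ∸ y)) ⟩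
    sumOver 𝒯 (λ τ → demandOf τ (suc d) (d ∸ y))
      ≤⟨ sumOver-mono-All (All.map (λ {τ} f0≡0 → ℕₚ.≤-reflexive (demandOf-stable τ f0≡0
           (ℕₚ.≤-trans (ℕₚ.m∸n≤m d y) (ℕₚ.n≤1+n d)) (ℕₚ.n≤1+n (d ∸ y)))) ok) ⟩
    totalDemand 𝒯 (d ∸ y) ∎
    where
    open ℕₚ.≤-Reasoning
    early : ∀ i r → T (relevant i r) → deadline (taskOf i) + r ≤ y + (d ∸ y)
    early i r rel = ℕₚ.≤-trans (ℕₚ.≤-reflexive (ℕₚ.+-comm _ r))
      (ℕₚ.≤-trans (proj₂ (relevant⁻ i r rel)) (ℕₚ.≤-reflexive (≡.sym (ℕₚ.m+[n∸m]≡n y≤d))))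

-- Work received along a schedule

module Analysis {c ℓ₁ ℓ₂} (𝕂 : ArchimedeanOrderedField c ℓ₁ ℓ₂) where

  open ArchimedeanOrderedField 𝕂
  open OrderedField 𝕂
  open Scheduling 𝕂
  open Sums
  open Counting
  private module ≈-R = Relation.Binary.Reasoning.Setoid setoid

  module _ {a} {A : Set a} where

    total[_]_ : List A → (A → Carrier) → Carrier
    total[ []     ] f = 0#
    total[ x ∷ xs ] f = f x + total[ xs ] f

    total-mono : ∀ (xs : List A) {f g} → (∀ {x} → x ∈ xs → f x ≤ g x) → total[ xs ] f ≤ total[ xs ] g
    total-mono []       f≤g = ≤-refl
    total-mono (x ∷ xs) f≤g = +-mono-≤ (f≤g (here ≡.refl)) (total-mono xs (λ x∈ → f≤g (there x∈)))

    -- Turns a comparison of total work with total processing into the completion of each single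
    -- job, as no job receives more than its work.
    total-tight : ∀ (xs : List A) {f g} → (∀ x → f x ≤ g x) → total[ xs ] g ≤ total[ xs ] f →
                  ∀ {x} → x ∈ xs → g x ≤ f x
    total-tight (y ∷ xs) {f} {g} f≤g tg≤tf (here ≡.refl) = certificate
      (∸≥0 tg≤tf ⊞ ∸≥0 (total-mono xs (λ {x} _ → f≤g x)))
      (solve 4 (λ f g F G → f :- g := ((f :+ F) :- (g :+ G)) :+ (G :- F)) refl
        (f y) (g y) (total[ xs ] f) (total[ xs ] g))
    total-tight (y ∷ xs) {f} {g} f≤g tg≤tf (there x∈) = total-tight xs f≤g (certificate
      (∸≥0 tg≤tf ⊞ ∸≥0 (f≤g y))
      (solve 4 (λ f g F G → F :- G := ((f :+ F) :- (g :+ G)) :+ (g :- f)) refl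
        (f y) (g y) (total[ xs ] f) (total[ xs ] g))) x∈

    total-cong : ∀ (xs : List A) {f g} → (∀ x → f x ≈ g x) → total[ xs ] f ≈ total[ xs ] g
    total-cong []       f≈g = refl
    total-cong (x ∷ xs) f≈g = +-cong (f≈g x) (total-cong xs f≈g)

    total-+ : ∀ (xs : List A) f g → total[ xs ] (λ x → f x + g x) ≈ total[ xs ] f + total[ xs ] g
    total-+ []       f g = sym (+-identityʳ 0#)
    total-+ (x ∷ xs) f g = trans (+-congˡ (total-+ xs f g))
      (solve 4 (λ a b c d → (a :+ b) :+ (c :+ d) := (a :+ c) :+ (b :+ d)) refl
        (f x) (g x) (total[ xs ] f) (total[ xs ] g))

    total-*ʳ : ∀ (xs : List A) f z → total[ xs ] (λ x → f x * z) ≈ total[ xs ] f * z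
    total-*ʳ []       f z = sym (zeroˡ z)
    total-*ʳ (x ∷ xs) f z = trans (+-congˡ (total-*ʳ xs f z)) (sym (distribʳ z (f x) _))

    total-ι : ∀ (xs : List A) f → total[ xs ] (λ x → ι (f x)) ≈ ι (sumOver xs f)
    total-ι []       f = refl
    total-ι (x ∷ xs) f = trans (+-congˡ (total-ι xs f)) (sym (ι-+ (f x) _))

  sumTo : (ℕ → Carrier) → ℕ → Carrier
  sumTo g zero    = 0#
  sumTo g (suc n) = sumTo g n + g n

  sumTo-shift : ∀ g n → g 0 + sumTo (λ k → g (suc k)) n ≈ sumTo g (suc n)
  sumTo-shift g zero    = +-comm (g 0) 0#
  sumTo-shift g (suc n) = trans (sym (+-assoc (g 0) _ _)) (+-congʳ (sumTo-shift g n))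

  sum≈sumTo : ∀ g n → sumᵛ +-rawMonoid {n} (λ k → g (toℕ k)) ≈ sumTo g n
  sum≈sumTo g zero    = refl
  sum≈sumTo g (suc n) =
    trans (+-congˡ (sum≈sumTo (λ k → g (suc k)) n)) (sumTo-shift g n)

  sumTo-cong : ∀ {g h} n → (∀ k → k ℕ.< n → g k ≈ h k) → sumTo g n ≈ sumTo h n
  sumTo-cong zero    g≈h = refl
  sumTo-cong (suc n) g≈h =
    +-cong (sumTo-cong n (λ k k<n → g≈h k (ℕₚ.m≤n⇒m≤1+n k<n))) (g≈h n ℕₚ.≤-refl)

  sumTo-stable : ∀ {g n} k → (∀ i → n ℕ.≤ i → g i ≈ 0#) → sumTo g (k ℕ.+ n) ≈ sumTo g n
  sumTo-stable zero    g≈0 = refl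
  sumTo-stable {n = n} (suc k) g≈0 =
    trans (+-cong (sumTo-stable k g≈0) (g≈0 (k ℕ.+ n) (ℕₚ.m≤n+m n k))) (+-identityʳ _)

  -- The work that S∞ has left at time y + z for 0 ≤ z ≤ 1
  module _ {𝒯 : TaskSystem} where

    open Virtual {𝒯}

    left : ℕ → Job 𝒯 → Carrier → Carrier
    left y j z = ι (virtualRemaining y j) - z * ι (progress y j)

    left-0 : ∀ y j → left y j 0# ≈ ι (virtualRemaining y j)
    left-0 y j = solve 2 (λ r p → r :- :0 :* p := r) refl (ι (virtualRemaining y j)) (ι (progress y j))

    left-1 : ∀ y j → left y j 1# ≈ ι (virtualRemaining (suc y) j)
    left-1 y j = trans
      (+-congʳ (trans (reflexive (≡.cong ι (virtualRemaining-suc y j))) (ι-+ (progress y j) _)))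
      (solve 2 (λ r p → (p :+ r) :- :1 :* p := r) refl
        (ι (virtualRemaining (suc y) j)) (ι (progress y j)))

    left-idle : ∀ y j z → progress y j ≡ 0 → left y j z ≈ ι (virtualRemaining y j)
    left-idle y j z p≡0 = trans
      (+-congˡ (-‿cong (*-congˡ (reflexive (≡.cong ι p≡0)))))
      (solve 2 (λ r z → r :- z :* :0 := r) refl (ι (virtualRemaining y j)) z)

    -- At least 1 is left at time y and the rate is at most 1, so nothing is finished before the
    -- unit of time ends.
    left-positive : ∀ y j {z} → 0# ≤ z → ¬ 1# ≤ z → virtualRemaining y j ≢ 0 → ¬ left y j z ≤ 0#
    left-positive y j {z} 0≤z 1≰z r≢0 l≤0 = 1≰z (certificate
      (∸≥0 l≤0 ⊞ ∸≥0 (ι-mono-≤ (ℕₚ.n≢0⇒n>0 r≢0)) ⊞ (0≤z ⊠ ∸≥0 (ι-mono-≤ (progress≤1 y j))))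
      (solve 3 (λ z r p → z :- :1 := ((:0 :- (r :- z :* p)) :+ (r :- (:1 :+ :0))) :+ z :* ((:1 :+ :0) :- p))
        refl z (ι (virtualRemaining y j)) (ι (progress y j))))

    left-finished : ∀ y j z → virtualRemaining y j ≡ 0 → left y j z ≈ 0#
    left-finished y j z r≡0 = trans (left-idle y j z p≡0) (reflexive (≡.cong ι r≡0))
      where
      p≡0 : progress y j ≡ 0
      p≡0 = ≡.trans (≡.cong (ℕ._∸ virtualRemaining (suc y) j) r≡0)
              (ℕₚ.0∸n≡0 (virtualRemaining (suc y) j))

    left-nonNeg : ∀ y j {z} → z ≤ 1# → 0# ≤ left y j z
    left-nonNeg y j {z} z≤1 = certificate
      (∸≥0 (ι-mono-≤ (ℕₚ.m∸n≤m (virtualRemaining y j) (virtualRemaining (suc y) j))) ⊞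
        (∸≥0 z≤1 ⊠ ι-nonNeg (progress y j)))
      (solve 3 (λ r p z → (r :- z :* p) :- :0 := (r :- p) :+ (:1 :- z) :* p) refl
        (ι (virtualRemaining y j)) (ι (progress y j)) z)

  module OnSchedule {𝒯 : TaskSystem} {m : ℕ} (S : Schedule 𝒯 m) where

    open Schedule S

    cut-mono : ∀ {i k} → i ℕ.≤ k → cut i ≤ cut k
    cut-mono i≤k = go (ℕₚ.≤⇒≤′ i≤k)
      where
      go : ∀ {i k} → i ℕ.≤′ k → cut i ≤ cut k
      go ℕ.≤′-refl          = ≤-refl
      go (ℕ.≤′-step {k} le) = ≤-trans (go le) (proj₁ (cut-increasing k))

    runningTime-late : ∀ j {t} k → t ≤ cut k → runningTime j t k ≈ 0#
    runningTime-late j {t} k t≤ with does (runs? k j)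
    ... | false = refl
    ... | true  = trans
      (+-cong (Min′.x≤y⇒y⊓x≈x (≤-trans t≤ (cut-mono (ℕₚ.n≤1+n k)))) (-‿cong (Min′.x≤y⇒y⊓x≈x t≤)))
      (-‿inverseʳ t)

    -- `received` sums up to whatever index `cut-unbounded` supplies. Pieces that start at t or
    -- later contribute 0, so every index whose cut reaches t gives the same sum.
    received≈ : ∀ s j {t} n → t ≤ cut n → received s j t ≈ s * sumTo (runningTime j t) n
    received≈ s j {t} n t≤ = *-congˡ (trans (sum≈sumTo (runningTime j t) n₀)
      (agree (ℕₚ.≤-total n₀ n)))
      where
      n₀ : ℕ
      n₀ = proj₁ (cut-unbounded t)

      extend : ∀ {i k} → i ℕ.≤ k → t ≤ cut i → sumTo (runningTime j t) i ≈ sumTo (runningTime j t) k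
      extend {i} {k} i≤k t≤i = trans
        (sym (sumTo-stable (k ℕ.∸ i) (λ l i≤l → runningTime-late j l (≤-trans t≤i (cut-mono i≤l)))))
        (reflexive (≡.cong (sumTo (runningTime j t)) (ℕₚ.m∸n+n≡m i≤k)))

      agree : n₀ ℕ.≤ n ⊎ n ℕ.≤ n₀ → sumTo (runningTime j t) n₀ ≈ sumTo (runningTime j t) n
      agree (inj₁ n₀≤n) = extend n₀≤n (proj₂ (cut-unbounded t))
      agree (inj₂ n≤n₀) = sym (extend n≤n₀ t≤)

    received-0 : ∀ s j → received s j 0# ≈ 0#
    received-0 s j = trans (received≈ s j 0 (≈⇒≤ (sym cut-zero))) (zeroʳ s)

    rate : ℕ → Job 𝒯 → ℕ
    rate k j = indicator (runs? k j)

    received-piece : ∀ s j k {a b} → cut k ≤ a → a ≤ b → b ≤ cut (suc k) →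
                     received s j b ≈ received s j a + ι (rate k j) * (s * (b - a))
    received-piece s j k {a} {b} k≤a a≤b b≤k = begin
      received s j b
        ≈⟨ received≈ s j (suc k) b≤k ⟩
      s * (sumTo (runningTime j b) k + runningTime j b k)
        ≈⟨ *-congˡ (+-cong (sumTo-cong k before) last) ⟩
      s * (sumTo (runningTime j a) k + (runningTime j a k + ι (rate k j) * (b - a)))
        ≈⟨ solve 5 (λ s x y r z → s :* (x :+ (y :+ r :* z)) := s :* (x :+ y) :+ r :* (s :* z)) refl
             s (sumTo (runningTime j a) k) (runningTime j a k) (ι (rate k j)) (b - a) ⟩
      s * (sumTo (runningTime j a) k + runningTime j a k) + ι (rate k j) * (s * (b - a))
        ≈⟨ +-congʳ (received≈ s j (suc k) (≤-trans a≤b b≤k)) ⟨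
      received s j a + ι (rate k j) * (s * (b - a)) ∎
      where
      open ≈-R

      before : ∀ i → i ℕ.< k → runningTime j b i ≈ runningTime j a i
      before i i<k with does (runs? i j)
      ... | false = refl
      ... | true  = +-cong (same i<k) (-‿cong (same (ℕₚ.<⇒≤ i<k)))
        where
        same : ∀ {i} → i ℕ.≤ k → cut i ⊓ b ≈ cut i ⊓ a
        same i≤k = trans (Min′.x≤y⇒x⊓y≈x (≤-trans (≤-trans (cut-mono i≤k) k≤a) a≤b))
                    (sym (Min′.x≤y⇒x⊓y≈x (≤-trans (cut-mono i≤k) k≤a)))

      last : runningTime j b k ≈ runningTime j a k + ι (rate k j) * (b - a)
      last with does (runs? k j)
      ... | false = solve 1 (λ z → :0 := :0 :+ :0 :* z) refl (b - a)
      ... | true  = begin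
        cut (suc k) ⊓ b - cut k ⊓ b
          ≈⟨ +-cong (Min′.x≤y⇒y⊓x≈x b≤k) (-‿cong (Min′.x≤y⇒x⊓y≈x (≤-trans k≤a a≤b))) ⟩
        b - cut k
          ≈⟨ solve 3 (λ b a k → b :- k := (a :- k) :+ (:1 :+ :0) :* (b :- a)) refl b a (cut k) ⟩
        (a - cut k) + (1# + 0#) * (b - a)
          ≈⟨ +-congʳ (+-cong (Min′.x≤y⇒y⊓x≈x (≤-trans a≤b b≤k)) (-‿cong (Min′.x≤y⇒x⊓y≈x k≤a))) ⟨
        (cut (suc k) ⊓ a - cut k ⊓ a) + (1# + 0#) * (b - a) ∎

    received-mono : ∀ {s} → 0# ≤ s → ∀ j k {a b} → cut k ≤ a → a ≤ b → b ≤ cut (suc k) →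
                    received s j a ≤ received s j b
    received-mono {s} 0≤s j k {a} {b} k≤a a≤b b≤k = ≤-trans
      (certificate (ι-nonNeg (rate k j) ⊠ (0≤s ⊠ ∸≥0 a≤b))
        (solve 3 (λ x r z → (x :+ r :* z) :- x := r :* z) refl
          (received s j a) (ι (rate k j)) (s * (b - a))))
      (≈⇒≤ (sym (received-piece s j k k≤a a≤b b≤k)))

    RunsIn : ℕ → Job 𝒯 → Set
    RunsIn k j = ∃ λ p → run k p ≡ just j

    rate-idle : ∀ {k j} → ¬ RunsIn k j → rate k j ≡ 0
    rate-idle {k} {j} idle with runs? k j
    ... | yes runs = ⊥-elim (idle runs)
    ... | no  _    = ≡.refl

    rate-running : ∀ {k j} → RunsIn k j → rate k j ≡ 1
    rate-running {k} {j} runs with runs? k j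
    ... | yes _   = ≡.refl
    ... | no idle = ⊥-elim (idle runs)

    received-idle : ∀ s j k {a b} → ¬ RunsIn k j → cut k ≤ a → a ≤ b → b ≤ cut (suc k) →
                    received s j b ≈ received s j a
    received-idle s j k {a} {b} idle k≤a a≤b b≤k = trans (received-piece s j k k≤a a≤b b≤k)
      (trans (+-congˡ (*-congʳ (reflexive (≡.cong ι (rate-idle idle)))))
        (solve 2 (λ x z → x :+ :0 :* z := x) refl (received s j a) (s * (b - a))))

    received-running : ∀ s j k {a b} → RunsIn k j → cut k ≤ a → a ≤ b → b ≤ cut (suc k) →
                       received s j b ≈ received s j a + s * (b - a)
    received-running s j k {a} {b} runs k≤a a≤b b≤k = trans (received-piece s j k k≤a a≤b b≤k)
      (+-congˡ (trans (*-congʳ (reflexive (≡.cong ι (rate-running runs))))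
        (solve 1 (λ z → (:1 :+ :0) :* z := z) refl (s * (b - a)))))

    rate≤1 : ∀ k j → rate k j ℕ.≤ 1
    rate≤1 k j with runs? k j
    ... | yes _ = ℕₚ.≤-refl
    ... | no  _ = z≤n

    runsAt-piece : ∀ {p t j k} → RunsAt p t j → cut k ≤ t → t < cut (suc k) → run k p ≡ just j
    runsAt-piece {k = k} (i , i≤t , t<i , eq) k≤t t<k with ℕₚ.<-cmp i k
    ... | tri≈ _ ≡.refl _ = eq
    ... | tri< i<k _ _ = ⊥-elim (<⇒≰ t<i (≤-trans (cut-mono i<k) k≤t))
    ... | tri> _ _ k<i = ⊥-elim (<⇒≰ t<k (≤-trans (cut-mono k<i) i≤t))

    #running : List (Job 𝒯) → ℕ → ℕ
    #running J k = count (runs? k) J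

    private
      runsOn? : ∀ k p j → Dec (run k p ≡ just j)
      runsOn? k p j = Maybeₚ.≡-dec _≟_ (run k p) (just j)

    -- Double counting of pairs of a processor and a job that it runs: each running job has a
    -- processor, and each processor at most one job.
    #running-≤ : ∀ {J} → Unique J → ∀ k → #running J k ℕ.≤ m
    #running-≤ {J} unique k = begin
      #running J k
        ≤⟨ sumOver-mono J (λ j → bound j) ⟩
      sumOver J (λ j → sumOver (allFin m) (λ p → indicator (runsOn? k p j)))
        ≡⟨ sumOver-swap J (allFin m) _ ⟩
      sumOver (allFin m) (λ p → count (runsOn? k p) J)
        ≤⟨ sumOver-mono (allFin m) (λ p → count-≤1 (runsOn? k p) unique
             (λ eq eq′ → Maybeₚ.just-injective (≡.trans (≡.sym eq) eq′))) ⟩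
      sumOver (allFin m) (λ _ → 1)
        ≡⟨ ≡.trans (sumOver-const (allFin m) 1) (ℕₚ.*-identityʳ _) ⟩
      length (allFin m)
        ≡⟨ Listₚ.length-tabulate id ⟩
      m ∎
      where
      open ℕₚ.≤-Reasoning
      bound : ∀ j → rate k j ℕ.≤ sumOver (allFin m) (λ p → indicator (runsOn? k p j))
      bound j with runs? k j
      ... | no  _        = z≤n
      ... | yes (p , eq) = count-≥1 (λ p → runsOn? k p j) (∈ₚ.∈-allFin p) eq

    -- The same double counting the other way round; by `run-injective` a job accounts for one
    -- processor only.
    #running-≥ : ∀ {J} k → (∀ p → ∃ λ j → j ∈ J × run k p ≡ just j) → m ℕ.≤ #running J k
    #running-≥ {J} k busy = begin
      m
        ≡⟨ Listₚ.length-tabulate id ⟨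
      length (allFin m)
        ≡⟨ ≡.trans (sumOver-const (allFin m) 1) (ℕₚ.*-identityʳ _) ⟨
      sumOver (allFin m) (λ _ → 1)
        ≤⟨ sumOver-mono (allFin m) (λ p → let j , j∈ , eq = busy p in count-≥1 (runsOn? k p) j∈ eq) ⟩
      sumOver (allFin m) (λ p → count (runsOn? k p) J)
        ≡⟨ sumOver-swap J (allFin m) _ ⟨
      sumOver J (λ j → sumOver (allFin m) (λ p → indicator (runsOn? k p j)))
        ≤⟨ sumOver-mono J bound ⟩
      #running J k ∎
      where
      open ℕₚ.≤-Reasoning
      bound : ∀ j → sumOver (allFin m) (λ p → indicator (runsOn? k p j)) ℕ.≤ rate k j
      bound j with runs? k j
      ... | yes _   = count-≤1 (λ p → runsOn? k p j) (Uniqueₚ.allFin⁺ m) (run-injective k)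
      ... | no idle = ℕₚ.≤-reflexive (count-none (λ p → runsOn? k p j) (allFin m)
                        (All.universal (λ p eq → idle (p , eq)) (allFin m)))

    total-received-piece : ∀ s J k {a b} → cut k ≤ a → a ≤ b → b ≤ cut (suc k) →
      total[ J ] (λ j → received s j b) ≈
      total[ J ] (λ j → received s j a) + ι (#running J k) * (s * (b - a))
    total-received-piece s J k {a} {b} k≤a a≤b b≤k = begin
      total[ J ] (λ j → received s j b)
        ≈⟨ total-cong J (λ j → received-piece s j k k≤a a≤b b≤k) ⟩
      total[ J ] (λ j → received s j a + ι (rate k j) * (s * (b - a)))
        ≈⟨ total-+ J _ _ ⟩
      total[ J ] (λ j → received s j a) + total[ J ] (λ j → ι (rate k j) * (s * (b - a)))
        ≈⟨ +-congˡ (total-*ʳ J (λ j → ι (rate k j)) (s * (b - a))) ⟩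
      total[ J ] (λ j → received s j a) + total[ J ] (λ j → ι (rate k j)) * (s * (b - a))
        ≈⟨ +-congˡ (*-congʳ (total-ι J (rate k))) ⟩
      total[ J ] (λ j → received s j a) + ι (#running J k) * (s * (b - a)) ∎
      where open ≈-R

    -- Lying in one piece and in one unit of time, a span sees no change of rate, neither in the
    -- schedule nor in S∞.
    record Span (k n : ℕ) (a b : Time) : Set (ℓ₁ ⊔ ℓ₂) where
      field
        cut≤a : cut k ≤ a
        a<b   : a < b
        b≤cut : b ≤ cut (suc k)
        n≤a   : ι n ≤ a
        b≤1+n : b ≤ ι (suc n)

      a≤b : a ≤ b
      a≤b = proj₁ a<b

    -- Context switches and integers cut the interval into finitely many spans. This takes the place
    -- of a continuity argument, for which the field lacks completeness.
    time-induction :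
      ∀ {p} (P : Time → Set p) {y d} → y ℕ.≤ d →
      (∀ {k n a b} → y ℕ.≤ n → n ℕ.< d → Span k n a b → P a → P b) →
      P (ι y) → P (ι d)
    time-induction P {y} y≤d step base = go (ℕₚ.≤⇒≤′ y≤d) step
      where
      unit : ∀ n → (∀ {k a b} → Span k n a b → P a → P b) → P (ι n) → P (ι (suc n))
      unit n step base =
        let f , f≥ = cut-unbounded (ι (suc n))
        in  pieces f 0 (≤-respˡ-≈ (sym cut-zero) (ι-nonNeg n)) ≤-refl n<1+n
              (≡.subst (λ i → ι (suc n) ≤ cut i) (≡.sym (ℕₚ.+-identityʳ f)) f≥) base
        where
        n<1+n : ι n < ι (suc n)
        n<1+n = ≰⇒> (λ 1+n≤n → ℕₚ.1+n≰n (ι-cancel-≤ {suc n} {n} 1+n≤n))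

        -- The fuel f counts the pieces up to a cut known to lie at or beyond the end of the unit;
        -- pieces that end before a are skipped.
        pieces : ∀ f k {a} → cut k ≤ a → ι n ≤ a → a < ι (suc n) → ι (suc n) ≤ cut (f ℕ.+ k) →
                 P a → P (ι (suc n))
        pieces f k {a} k≤a n≤a a<1+n end Pa with ι (suc n) ≤? cut (suc k)
        ... | yes 1+n≤k = step {k} (record
          { cut≤a = k≤a ; a<b = a<1+n ; b≤cut = 1+n≤k ; n≤a = n≤a ; b≤1+n = ≤-refl }) Pa
        pieces zero k k≤a n≤a a<1+n end Pa | no 1+n≰k =
          ⊥-elim (1+n≰k (≤-trans end (cut-mono (ℕₚ.n≤1+n k))))
        pieces (suc f) k {a} k≤a n≤a a<1+n end Pa | no 1+n≰k with cut (suc k) ≤? a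
        ... | yes k≤a′ = pieces f (suc k) k≤a′ n≤a a<1+n end′ Pa
          where
          end′ : ι (suc n) ≤ cut (f ℕ.+ suc k)
          end′ = ≡.subst (λ i → ι (suc n) ≤ cut i) (≡.sym (ℕₚ.+-suc f k)) end
        ... | no k≰a = pieces f (suc k) ≤-refl (≤-trans n≤a (≰⇒≥ k≰a)) (≰⇒> 1+n≰k) end′
          (step {k} (record { cut≤a = k≤a ; a<b = ≰⇒> k≰a ; b≤cut = ≤-refl ; n≤a = n≤a
                            ; b≤1+n = ≰⇒≥ 1+n≰k }) Pa)
          where
          end′ : ι (suc n) ≤ cut (f ℕ.+ suc k)
          end′ = ≡.subst (λ i → ι (suc n) ≤ cut i) (≡.sym (ℕₚ.+-suc f k)) end

      go : ∀ {d} → y ℕ.≤′ d → (∀ {k n a b} → y ℕ.≤ n → n ℕ.< d → Span k n a b → P a → P b) → P (ι d)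
      go ℕ.≤′-refl          step = base
      go (ℕ.≤′-step {n} le) step =
        unit n (step (ℕₚ.≤′⇒≤ le) ℕₚ.≤-refl) (go le (λ y≤ n< → step y≤ (ℕₚ.m≤n⇒m≤1+n n<)))

    received-mono-ι : ∀ {s} → 0# ≤ s → ∀ j {y d} → y ℕ.≤ d → received s j (ι y) ≤ received s j (ι d)
    received-mono-ι {s} 0≤s j {y} y≤d = time-induction (λ t → received s j (ι y) ≤ received s j t) y≤d
      (λ {k} _ _ span y≤a → let open Span span in ≤-trans y≤a (received-mono 0≤s j k cut≤a a≤b b≤cut))
      ≤-refl

-- Infeasibility of overloaded systems

-- The releases that realise totalDemand 𝒯 t: all tasks release dag-jobs as
-- densely as possible, with a deadline at latest.
module WorstCase (𝒯 : TaskSystem) (t : ℕ) where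

  open import Data.Nat.Base using (_+_; _*_; _∸_; _≤_; _<_)
  open Sums
  open Counting
  open Demand
  open Task
  open Virtual {𝒯}

  -- The last t time units start at `origin`. It is at least every relative deadline, so the
  -- dag-jobs with a nonempty window are released at nonnegative times.
  origin latest : ℕ
  origin  = sumOver 𝒯 deadline
  latest = origin + t

  lastRelease : Fin (length 𝒯) → ℕ
  lastRelease i = latest ∸ deadline (taskOf i)

  deadline≤origin : ∀ i → deadline (taskOf i) ≤ origin
  deadline≤origin i = ∈⇒≤sumOver {xs = 𝒯} deadline (∈ₚ.∈-lookup {xs = 𝒯} i)

  deadline+lastRelease : ∀ i → deadline (taskOf i) + lastRelease i ≡ latest
  deadline+lastRelease i = ℕₚ.m+[n∸m]≡n (ℕₚ.≤-trans (deadline≤origin i) (ℕₚ.m≤m+n origin t))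

  isReleased : Fin (length 𝒯) → ℕ → Bool
  isReleased i r = (r ℕ.≤ᵇ lastRelease i) ∧ isYes (period (taskOf i) ∣? (lastRelease i ∸ r))

  isReleased⁻ : ∀ i r → T (isReleased i r) →
                r ≤ lastRelease i × period (taskOf i) ∣ lastRelease i ∸ r
  isReleased⁻ i r rel =
    let r≤ , div = Equivalence.to Boolₚ.T-∧ rel in ℕₚ.≤ᵇ⇒≤ _ _ r≤ , toWitness div

  isReleased⁺ : ∀ i r → r ≤ lastRelease i → period (taskOf i) ∣ lastRelease i ∸ r →
                T (isReleased i r)
  isReleased⁺ i r r≤ div = Equivalence.from Boolₚ.T-∧ (ℕₚ.≤⇒≤ᵇ r≤ , fromWitness div)

  releases : Releases 𝒯
  releases = record { released = isReleased ; separated = separated }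
    where
    separated : ∀ i {r u} → T (isReleased i r) → T (isReleased i u) → r < u →
                r + period (taskOf i) ≤ u
    separated i {r} {u} rel-r rel-u r<u = begin
      r + period (taskOf i) ≤⟨ ℕₚ.+-monoʳ-≤ r (∣⇒≤ {{ℕ.>-nonZero (ℕₚ.m<n⇒0<n∸m r<u)}} T∣u∸r) ⟩
      r + (u ∸ r)           ≡⟨ ℕₚ.m+[n∸m]≡n (ℕₚ.<⇒≤ r<u) ⟩
      u                     ∎
      where
      open ℕₚ.≤-Reasoning
      u≤ = proj₁ (isReleased⁻ i u rel-u)

      sum≡ : (lastRelease i ∸ u) + (u ∸ r) ≡ lastRelease i ∸ r
      sum≡ = ≡.trans (≡.sym (ℕₚ.+-∸-assoc (lastRelease i ∸ u) (ℕₚ.<⇒≤ r<u)))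
        (≡.cong (_∸ r) (ℕₚ.m∸n+n≡m u≤))

      T∣u∸r : period (taskOf i) ∣ u ∸ r
      T∣u∸r = ∣m+n∣m⇒∣n
        (≡.subst (period (taskOf i) ∣_) (≡.sym sum≡) (proj₂ (isReleased⁻ i r rel-r)))
        (proj₂ (isReleased⁻ i u rel-u))

  open DagJobs releases latest

  relevant-released : ∀ i r → T (isReleased i r) → T (relevant i r)
  relevant-released i r rel = Equivalence.from Boolₚ.T-≡ (relevant⁺ i r rel (begin
    r + deadline (taskOf i)             ≤⟨ ℕₚ.+-monoˡ-≤ _ (proj₁ (isReleased⁻ i r rel)) ⟩
    lastRelease i + deadline (taskOf i) ≡⟨ ℕₚ.+-comm (lastRelease i) _ ⟩
    deadline (taskOf i) + lastRelease i ≡⟨ deadline+lastRelease i ⟩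
    latest                              ∎))
    where open ℕₚ.≤-Reasoning

  totalDemand≤virtualWork : t ≡ 0 ⊎ NoOverrun 𝒯 → totalDemand 𝒯 t ≤ virtualWork origin
  totalDemand≤virtualWork hyp = begin
    totalDemand 𝒯 t
      ≡⟨ sumOver-lookup 𝒯 (λ τ → demand τ t) ⟨
    sumOver (allFin _) (λ i → demand (taskOf i) t)
      ≤⟨ sumOver-mono (allFin _) perTask ⟩
    sumOver (allFin _) (λ i → sumOver (downFrom (suc latest)) (releasedResidual (taskOf i) (relevant i) origin))
      ≡⟨ virtualWork≡ origin ⟨
    virtualWork origin ∎
    where
    open ℕₚ.≤-Reasoning

    perTask : ∀ i → demand (taskOf i) t ≤
              sumOver (downFrom (suc latest)) (releasedResidual (taskOf i) (relevant i) origin)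
    perTask i = ℕₚ.≤-trans
      (demandOf-≤-released (taskOf i) (relevant i) periodic origin (suc t) t (lastRelease i)
        (Sum.map (λ t≡0 → s≤s (ℕₚ.≤-reflexive t≡0)) (λ ok → All.lookup ok (∈ₚ.∈-lookup {xs = 𝒯} i)) hyp)
        (relevant-released i (lastRelease i) (isReleased⁺ i (lastRelease i) ℕₚ.≤-refl
          (≡.subst (period (taskOf i) ∣_) (≡.sym (ℕₚ.n∸n≡0 (lastRelease i))) (_ ∣0))))
        (≡.sym (deadline+lastRelease i))
        (ℕₚ.m+n≤o⇒m≤o∸n t (ℕₚ.≤-trans (ℕₚ.+-monoʳ-≤ t (deadline≤origin i))
          (ℕₚ.≤-reflexive (ℕₚ.+-comm t origin)))))
      (downFrom-sum-mono (taskOf i) (s≤s (ℕₚ.m∸n≤m latest (deadline (taskOf i))))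
        (releasedResidual (taskOf i) (relevant i) origin))
      where
      periodic : ∀ r → T (relevant i r) → period (taskOf i) ≤ r → T (relevant i (r ∸ period (taskOf i)))
      periodic r rel T≤r =
        let r≤ , div = isReleased⁻ i r (proj₁ (relevant⁻ i r rel))
        in  relevant-released i (r ∸ period (taskOf i))
              (isReleased⁺ i (r ∸ period (taskOf i)) (ℕₚ.≤-trans (ℕₚ.m∸n≤m r (period (taskOf i))) r≤)
              (≡.subst (period (taskOf i) ∣_) (shift r≤) (∣m∣n⇒∣m+n div ∣-refl)))
        where
        shift : r ≤ lastRelease i →
                (lastRelease i ∸ r) + period (taskOf i) ≡ lastRelease i ∸ (r ∸ period (taskOf i))
        shift r≤ = begin-equality
          (lastRelease i ∸ r) + period (taskOf i)  ≡⟨ ℕₚ.+-comm (lastRelease i ∸ r) _ ⟩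
          period (taskOf i) + (lastRelease i ∸ r)  ≡⟨ ℕₚ.+-∸-assoc (period (taskOf i)) r≤ ⟨
          (period (taskOf i) + lastRelease i) ∸ r
            ≡⟨ ≡.cong₂ _∸_ ≡.refl (≡.sym (ℕₚ.m+[n∸m]≡n T≤r)) ⟩
          (period (taskOf i) + lastRelease i) ∸ (period (taskOf i) + (r ∸ period (taskOf i)))
            ≡⟨ ℕₚ.[m+n]∸[m+o]≡n∸o (period (taskOf i)) _ _ ⟩
          lastRelease i ∸ (r ∸ period (taskOf i))  ∎

module Infeasibility {c ℓ₁ ℓ₂} (𝕂 : ArchimedeanOrderedField c ℓ₁ ℓ₂) where

  open ArchimedeanOrderedField 𝕂
  open OrderedField 𝕂
  open Scheduling 𝕂
  open Analysis 𝕂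
  open Sums
  open Counting
  open Demand
  private module ≈-R = Relation.Binary.Reasoning.Setoid setoid

  -- No schedule on unit-speed processors is ahead of S∞.
  module _ {𝒯 : TaskSystem} {m : ℕ} (R : Releases 𝒯) (S : Schedule 𝒯 m) (valid : Valid R 1# S) where

    open Schedule S
    open OnSchedule S
    open Virtual {𝒯}
    open Job
    open Valid valid

    -- A valid schedule may keep running a completed job, so what a job receives can exceed its
    -- work. The first alternative, that S∞ has finished the job, covers this.
    Behind : ℕ → Time → Job 𝒯 → Set ℓ₂
    Behind n t j = left n j (t - ι n) ≤ 0# ⊎ received 1# j t + left n j (t - ι n) ≤ ι (work j)

    AllBehind : ℕ → Time → Set ℓ₂
    AllBehind n t = ∀ j → Generated R j → Behind n t j

    -- Where S∞ waits for a predecessor i, it has work of i left during the whole unit. Were j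
    -- ready, i would be completed, and either alternative of `Behind` would leave S∞ nothing of i;
    -- so j does not run. Where S∞ runs j, its speed 1 is at least that of the schedule.
    behind-step : ∀ {k n a b} → Span k n a b → AllBehind n a → AllBehind n b
    behind-step {k} {n} {a} {b} span behind j gen = byStep (virtualStep n j)
      where
      open Span span

      r : Carrier
      r = ι (rate k j)

      idle : virtualRemaining (suc n) j ≡ virtualRemaining n j →
             ¬ RunsIn k j → Behind n b j
      idle eq blocked = Sum.map
        (λ l≤0 → ≤-trans (≈⇒≤ (sym same)) l≤0)
        (λ r+l≤w → ≤-trans (≈⇒≤ (+-cong unchanged (sym same))) r+l≤w)
        (behind j gen)
        where
        same : left n j (a - ι n) ≈ left n j (b - ι n)
        same = trans (left-idle n j _ (progress-idle n j eq)) (sym (left-idle n j _ (progress-idle n j eq)))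

        unchanged : received 1# j b ≈ received 1# j a
        unchanged with runs? k j
        ... | yes j-runs = ⊥-elim (blocked j-runs)
        ... | no  ¬runs  = received-idle 1# j k ¬runs cut≤a a≤b b≤cut

      ready : RunsIn k j → Ready R 1# S a j
      ready (p , eq) = running-ready (p , k , cut≤a , <-≤-trans a<b b≤cut , eq)

      byStep : VirtualStep n j → Behind n b j
      byStep (unreleased n<r eq) = idle eq λ j-runs →
        <⇒≰ a<b (≤-trans b≤1+n (≤-trans (ι-mono-≤ n<r) (Ready.released (ready j-runs))))
      byStep (waits i prec r≢0 eq) = idle eq λ j-runs →
        left-positive n i (∸≥0 n≤a)
          (λ 1≤a-n → <⇒≰ a<b (≤-trans b≤1+n (certificate (∸≥0 1≤a-n)
            (solve 2 (λ a n → a :- (:1 :+ n) := (a :- n) :- :1) refl a (ι n)))))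
          r≢0 (done (ready j-runs))
        where
        done : Ready R 1# S a j → left n i (a - ι n) ≤ 0#
        done rdy with behind i (gen′ prec)
          where
          gen′ : Precedes i j → Generated R i
          gen′ (edge _) = gen
        ... | inj₁ l≤0   = l≤0
        ... | inj₂ r+l≤w = certificate (∸≥0 r+l≤w ⊞ ∸≥0 (Ready.predecessorsCompleted rdy prec))
          (solve 3 (λ l w r → :0 :- l := (w :- (r :+ l)) :+ (r :- w)) refl
            (left n i (a - ι n)) (ι (work i)) (received 1# i a))
      byStep (runs _ _ eq) with virtualRemaining n j ℕₚ.≟ 0
      ... | yes r≡0 = inj₁ (≈⇒≤ (left-finished n j _ r≡0))
      ... | no r≢0 = Sum.map
        (λ l≤0 → ≤-trans (certificate (∸≥0 a≤b) (solve 4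
          (λ r a b n → (r :- (a :- n) :* (:1 :+ :0)) :- (r :- (b :- n) :* (:1 :+ :0)) := b :- a)
          refl (ι (virtualRemaining n j)) a b (ι n)))
          (≤-trans (≈⇒≤ (active a)) l≤0) |> λ le → ≤-trans (≈⇒≤ (sym (active b))) le)
        (λ r+l≤w → certificate (∸≥0 r+l≤w ⊞ (∸≥0 (ι-mono-≤ (rate≤1 k j)) ⊠ ∸≥0 a≤b))
          (trans (+-congˡ (-‿cong (+-cong (received-piece 1# j k cut≤a a≤b b≤cut) (sym (active b)))))
            (trans (solve 7 (λ w x ρ r a b n →
                w :- (x :+ ρ :* (:1 :* (b :- a)) :+ (r :- (b :- n) :* (:1 :+ :0))) :=
                (w :- (x :+ (r :- (a :- n) :* (:1 :+ :0)))) :+ ((:1 :+ :0) :- ρ) :* (b :- a)) refl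
                (ι (work j)) (received 1# j a) r (ι (virtualRemaining n j)) a b (ι n))
              (+-congʳ (+-congˡ (-‿cong (+-congˡ (active a))))))))
        (behind j gen)
        where
        p≡1 : progress n j ≡ 1
        p≡1 with virtualRemaining n j
        ... | zero  = ⊥-elim (r≢0 ≡.refl)
        ... | suc x = ≡.trans (≡.cong (suc x ℕ.∸_) eq) (ℕₚ.m+n∸n≡m 1 x)

        active : ∀ t → ι (virtualRemaining n j) - (t - ι n) * (1# + 0#) ≈ left n j (t - ι n)
        active t = +-congˡ (-‿cong (*-congˡ (sym (reflexive (≡.cong ι p≡1)))))

    behind-start : AllBehind 0 (ι 0)
    behind-start j gen = inj₂ (≈⇒≤ (trans
      (+-cong (received-0 1# j) (trans (+-congˡ (-‿cong (*-congʳ (-‿inverseʳ 0#)))) (left-0 0 j)))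
      (trans (+-identityˡ _) (reflexive (≡.cong ι (virtualRemaining-0 j))))))

    behind-next : ∀ {n} → AllBehind n (ι (suc n)) → AllBehind (suc n) (ι (suc n))
    behind-next {n} behind j gen = Sum.map
      (≤-trans (≈⇒≤ same)) (≤-trans (≈⇒≤ (+-congˡ same))) (behind j gen)
      where
      same : left (suc n) j (ι (suc n) - ι (suc n)) ≈ left n j (ι (suc n) - ι n)
      same = begin
        left (suc n) j (ι (suc n) - ι (suc n))
          ≈⟨ +-congˡ (-‿cong (*-congʳ (-‿inverseʳ (ι (suc n))))) ⟩
        left (suc n) j 0#
          ≈⟨ left-0 (suc n) j ⟩
        ι (virtualRemaining (suc n) j)
          ≈⟨ left-1 n j ⟨
        left n j 1#
          ≈⟨ +-congˡ (-‿cong (*-congʳ (solve 1 (λ n → (:1 :+ n) :- n := :1) refl (ι n)))) ⟨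
        left n j (ι (suc n) - ι n) ∎
        where open ≈-R

    behind-at : ∀ n → AllBehind n (ι n)
    behind-at zero    = behind-start
    behind-at (suc n) = behind-next (time-induction (AllBehind n) (ℕₚ.n≤1+n n) within (behind-at n))
      where
      within : ∀ {k i a b} → n ℕ.≤ i → i ℕ.< suc n → Span k i a b → AllBehind n a → AllBehind n b
      within n≤i i<1+n span with ℕₚ.≤-antisym n≤i (ℕₚ.m<1+n⇒m≤n i<1+n)
      ... | ≡.refl = behind-step span

    module _ {y d : ℕ} (y≤d : y ℕ.≤ d) where

      open DagJobs R d using (jobs; ∈-jobs⁻; unique-jobs; virtualWork)

      private
        Served : Time → Set ℓ₂
        Served t = total[ jobs ] (λ j → received 1# j t) ≤
                   total[ jobs ] (λ j → received 1# j (ι y)) + ι m * (t - ι y)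

        served : Served (ι d)
        served = time-induction Served y≤d (λ _ _ span → serve span)
          (≈⇒≤ (solve 3 (λ x m y → x := x :+ m :* (y :- y)) refl _ (ι m) (ι y)))
          where
          serve : ∀ {k n a b} → Span k n a b → Served a → Served b
          serve {k} {n} {a} {b} span cap =
            ≤-trans (≈⇒≤ (total-received-piece 1# jobs k cut≤a a≤b b≤cut))
              (certificate (∸≥0 cap ⊞ (∸≥0 (ι-mono-≤ (#running-≤ unique-jobs k)) ⊠ ∸≥0 a≤b))
                (solve 7 (λ y₀ m b y x r a →
                  (y₀ :+ m :* (b :- y)) :- (x :+ r :* (:1 :* (b :- a))) :=
                  ((y₀ :+ m :* (a :- y)) :- x) :+ (m :- r) :* (b :- a)) refl
                  (total[ jobs ] (λ j → received 1# j (ι y))) (ι m) b (ι y)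
                  (total[ jobs ] (λ j → received 1# j a)) (ι (#running jobs k)) a))
            where open Span span

      -- By d these jobs have received all their work. At y each still lacked at least what S∞ had
      -- left of it, and m unit-speed processors provide at most m (d - y) in between.
      virtualWork≤capacity : virtualWork y ℕ.≤ (d ℕ.∸ y) ℕ.* m
      virtualWork≤capacity = ι-cancel-≤ (certificate
        (∸≥0 served ⊞ ∸≥0 worked)
        (trans (+-cong (trans (ι-* (d ℕ.∸ y) m) (*-congʳ d-y)) (-‿cong (sym (total-ι jobs (virtualRemaining y)))))
          (solve 6 (λ d y m v r₀ r → (d :- y) :* m :- v :=
              ((r₀ :+ m :* (d :- y)) :- r) :+ (r :- (v :+ r₀))) refl
            (ι d) (ι y) (ι m) (total[ jobs ] (λ j → ι (virtualRemaining y j)))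
            (total[ jobs ] (λ j → received 1# j (ι y))) (total[ jobs ] (λ j → received 1# j (ι d))))))
        where
        d-y : ι (d ℕ.∸ y) ≈ ι d - ι y
        d-y = trans (solve 2 (λ x y → x := (x :+ y) :- y) refl (ι (d ℕ.∸ y)) (ι y))
          (+-congʳ (trans (sym (ι-+ (d ℕ.∸ y) y)) (reflexive (≡.cong ι (ℕₚ.m∸n+n≡m y≤d)))))

        worked : total[ jobs ] (λ j → ι (virtualRemaining y j)) + total[ jobs ] (λ j → received 1# j (ι y)) ≤
                 total[ jobs ] (λ j → received 1# j (ι d))
        worked = ≤-trans (≈⇒≤ (sym (total-+ jobs _ _))) (total-mono jobs λ {j} j∈ →
          let gen , early = ∈-jobs⁻ j∈ in
          work-done j gen early)
          where
          late : ∀ j → Generated R j → absoluteDeadline j ℕ.≤ d → ι (work j) ≤ received 1# j (ι d)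
          late j gen early = ≤-trans (meetsDeadlines j gen) (received-mono-ι 0≤1 j early)

          at-y : ∀ j → left y j (ι y - ι y) ≈ ι (virtualRemaining y j)
          at-y j = trans (+-congˡ (-‿cong (*-congʳ (-‿inverseʳ (ι y))))) (left-0 y j)

          work-done : ∀ j → Generated R j → absoluteDeadline j ℕ.≤ d →
                      ι (virtualRemaining y j) + received 1# j (ι y) ≤ received 1# j (ι d)
          work-done j gen early with behind-at y j gen
          ... | inj₁ l≤0 = ≤-trans (certificate (∸≥0 (≤-trans (≈⇒≤ (sym (at-y j))) l≤0))
                (solve 2 (λ v r → r :- (v :+ r) := :0 :- v) refl (ι (virtualRemaining y j)) (received 1# j (ι y))))
                (received-mono-ι 0≤1 j y≤d)
          ... | inj₂ r+l≤w = ≤-trans (≤-trans (≈⇒≤ (trans (+-comm _ _) (+-congˡ (sym (at-y j))))) r+l≤w)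
                (late j gen early)

  overloaded⇒infeasible : ∀ 𝒯 m → Overloaded 𝒯 m → Infeasible 𝒯 m 1#
  overloaded⇒infeasible 𝒯 m (t , hyp , excess) feasible =
    let S , valid = feasible releases
    in  ℕₚ.<⇒≱ excess (ℕₚ.≤-trans (totalDemand≤virtualWork hyp)
          (≡.subst (λ z → virtualWork origin ℕ.≤ z ℕ.* m) (ℕₚ.m+n∸m≡n origin t)
            (virtualWork≤capacity releases S valid (ℕₚ.m≤m+n origin t))))
    where
    open WorstCase 𝒯 t
    open DagJobs releases latest using (virtualWork)

-- EDF on faster processors

module EDFAnalysis {c ℓ₁ ℓ₂} (𝕂 : ArchimedeanOrderedField c ℓ₁ ℓ₂) where

  open ArchimedeanOrderedField 𝕂
  open OrderedField 𝕂
  open Scheduling 𝕂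
  open Analysis 𝕂
  open Sums
  open Counting
  open Demand
  open Job
  private module ≈-R = Relation.Binary.Reasoning.Setoid setoid

  module OnEDF {𝒯 : TaskSystem} {m : ℕ} (R : Releases 𝒯) (α : Carrier) (0<α : 0# < α)
               (S : Schedule 𝒯 m) (edf : EDF R α S) (d : ℕ) where

    open Schedule S
    open OnSchedule S
    open Virtual {𝒯}
    open DagJobs R d
    open EDF edf

    0≤α : 0# ≤ α
    0≤α = proj₁ 0<α

    -- A job stops running as soon as it is completed.
    received≤work : ∀ j n → received α j (ι n) ≤ ι (work j)
    received≤work j n = time-induction (λ t → received α j t ≤ ι (work j)) (z≤n {n})
      (λ _ _ span → bounded span)
      (≤-trans (≈⇒≤ (received-0 α j)) (ι-nonNeg (work j)))
      where
      bounded : ∀ {k n a b} → Span k n a b → received α j a ≤ ι (work j) → received α j b ≤ ι (work j)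
      bounded {k} {n} {a} {b} span ra≤w with runs? k j | received α j b ≤? ι (work j)
      ... | no idle | _ = ≤-trans (≈⇒≤ (received-idle α j k idle cut≤a a≤b b≤cut)) ra≤w
        where open Span span
      ... | yes _        | yes rb≤w = rb≤w
      ... | yes (p , eq) | no  rb≰w = ⊥-elim (proj₂ (running-available
              (p , k , ≤-trans cut≤a a≤t , <-≤-trans t<b b≤cut , eq)) completed)
        where
        open Span span

        -- At t the job has received exactly its work. If it received more by b, it would run at t
        -- although completed.
        δ t : Carrier
        δ = α ⁻¹ * (ι (work j) - received α j a)
        t = a + δ

        αδ : α * δ ≈ ι (work j) - received α j a
        αδ = trans (sym (*-assoc α (α ⁻¹) _))
          (trans (*-congʳ (⁻¹-inverseʳ (>⇒≉0 0<α))) (*-identityˡ _))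

        a≤t : a ≤ t
        a≤t = certificate (⁻¹-nonNeg 0<α ⊠ ∸≥0 ra≤w)
          (solve 2 (λ a δ → (a :+ δ) :- a := δ) refl a δ)

        α[t-a] : α * (t - a) ≈ ι (work j) - received α j a
        α[t-a] = trans (*-congˡ (solve 2 (λ a δ → (a :+ δ) :- a := δ) refl a δ)) αδ

        t<b : t < b
        t<b = ≰⇒> λ b≤t → rb≰w (≤-trans
          (≈⇒≤ (received-running α j k (p , eq) cut≤a a≤b b≤cut))
          (certificate (0≤α ⊠ ∸≥0 b≤t)
            (trans (+-congʳ (sym (trans (+-congˡ α[t-a])
                (solve 2 (λ x w → x :+ (w :- x) := w) refl (received α j a) (ι (work j))))))
              (solve 5 (λ x α t a b → (x :+ α :* (t :- a)) :- (x :+ α :* (b :- a)) := α :* (t :- b)) refl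
                (received α j a) α t a b))))

        completed : ι (work j) ≤ received α j t
        completed = ≈⇒≤ (sym (trans
          (received-running α j k (p , eq) cut≤a a≤t (≤-trans (proj₁ t<b) b≤cut))
          (trans (+-congˡ α[t-a])
            (solve 2 (λ x w → x :+ (w :- x) := w) refl (received α j a) (ι (work j))))))

    Busy : ℕ → Set
    Busy k = ∀ p → ∃ λ j → j ∈ jobs × run k p ≡ just j

    busy? : ∀ k → Dec (Busy k)
    busy? k = all? decide
      where
      decide : ∀ p → Dec (∃ λ j → j ∈ jobs × run k p ≡ just j)
      decide p with run k p
      ... | nothing = no λ ()
      ... | just j with T? (Releases.released R (index j) (releaseDate j)) | absoluteDeadline j ℕₚ.≤? d
      ...   | yes gen | yes early = yes (j , ∈-jobs⁺ gen early , ≡.refl)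
      ...   | no ¬gen | _ = no λ { (j , j∈ , ≡.refl) → ¬gen (proj₁ (∈-jobs⁻ j∈)) }
      ...   | yes _   | no late = no λ { (j , j∈ , ≡.refl) → late (proj₂ (∈-jobs⁻ j∈)) }

    -- If the job did not run, EDF would keep every processor on a job due no later, hence due by d,
    -- and the piece would be busy.
    available⇒runs : ∀ {k} → ¬ Busy k → ∀ {t j} → cut k ≤ t → t < cut (suc k) → 0# ≤ t →
                     j ∈ jobs → Available R α S t j → RunsIn k j
    available⇒runs {k} ¬busy {t} {j} k≤t t<k 0≤t j∈ avail with runs? k j
    ... | yes j-runs = j-runs
    ... | no idle = ⊥-elim (¬busy λ p →
      let i , runs-i , i≤j = earliest-deadline 0≤t avail
                               (λ { (p , runs-j) → idle (p , runsAt-piece runs-j k≤t t<k) }) p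
          gen = Ready.generated (proj₁ (running-available (p , runs-i)))
      in  i , ∈-jobs⁺ gen (ℕₚ.≤-trans i≤j (proj₂ (∈-jobs⁻ j∈))) , runsAt-piece runs-i k≤t t<k)

    -- At time t, EDF has left no more of any job than S∞ at time y + z.
    Ahead : Time → ℕ → Carrier → Set (c ⊔ ℓ₂)
    Ahead t y z = Lift c (∀ {j} → j ∈ jobs → ι (work j) ≤ received α j t + left y j z)

    sumReceived : Time → Carrier
    sumReceived t = total[ jobs ] (λ j → received α j t)

    sumLeft : ℕ → Carrier → Carrier
    sumLeft y z = total[ jobs ] (λ j → left y j z)

    sumWork : Carrier
    sumWork = total[ jobs ] (λ j → ι (work j))

    ahead-step :
      ∀ {k n y a b z z′} → cut k ≤ a → a < cut (suc k) → a ≤ b → b ≤ cut (suc k) → ι n ≤ a →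
      ¬ Busy k → y ℕ.≤ n → z ≤ z′ → z′ ≤ 1# →
      (∀ {j} → j ∈ jobs → RunsIn k j → z′ - z ≤ α * (b - a)) →
      Ahead a y z → Ahead b y z′
    ahead-step {k} {n} {y} {a} {b} {z} {z′} k≤a a<k a≤b b≤k n≤a ¬busy y≤n z≤z′ z′≤1 slow (lift ahead) =
      lift λ {j} j∈ → ahead′ j j∈
      where
      ahead′ : ∀ j → j ∈ jobs → ι (work j) ≤ received α j b + left y j z′
      ahead′ j j∈ with runs? k j | ι (work j) ≤? received α j a
      ... | yes j-runs | _ = ≤-trans
        (certificate
          (∸≥0 (ahead j∈) ⊞ ∸≥0 (slow j∈ j-runs) ⊞ (∸≥0 z≤z′ ⊠ ∸≥0 (ι-mono-≤ (progress≤1 y j))))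
          (solve 7 (λ w x e r p z z′ →
            ((x :+ e) :+ (r :- z′ :* p)) :- w :=
            (((x :+ (r :- z :* p)) :- w) :+ (e :- (z′ :- z))) :+ (z′ :- z) :* ((:1 :+ :0) :- p)) refl
            (ι (work j)) (received α j a) (α * (b - a)) (ι (virtualRemaining y j)) (ι (progress y j)) z z′))
        (≈⇒≤ (+-congʳ (sym (received-running α j k j-runs k≤a a≤b b≤k))))
      ... | no _ | yes completed = ≤-trans completed (≤-trans
        (received-mono 0≤α j k k≤a a≤b b≤k)
        (certificate (left-nonNeg y j z′≤1)
          (solve 2 (λ x l → (x :+ l) :- x := l) refl (received α j b) (left y j z′))))
      ... | no idle | no incomplete = byStep (virtualStep y j)
        where
        waiting : progress y j ≡ 0 → ι (work j) ≤ received α j b + left y j z′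
        waiting p≡0 = ≤-trans (ahead j∈) (+-mono-≤ (received-mono 0≤α j k k≤a a≤b b≤k)
          (≈⇒≤ (trans (left-idle y j z p≡0) (sym (left-idle y j z′ p≡0)))))

        byStep : VirtualStep y j → ι (work j) ≤ received α j b + left y j z′
        byStep (unreleased _ eq) = waiting (progress-idle y j eq)
        byStep (waits _ _ _ eq)  = waiting (progress-idle y j eq)
        byStep (runs r≤y finished _) = ⊥-elim (idle (available⇒runs ¬busy k≤a a<k
          (≤-trans (ι-nonNeg n) n≤a) j∈ (record
            { generated = proj₁ (∈-jobs⁻ j∈)
            ; released = ≤-trans (ι-mono-≤ (ℕₚ.≤-trans r≤y y≤n)) n≤a
            ; predecessorsCompleted = completed
            } , incomplete)))
          where
          sibling : ∀ {i} → Precedes i j → i ∈ jobs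
          sibling (edge _) = let gen , early = ∈-jobs⁻ j∈ in ∈-jobs⁺ gen early

          completed : ∀ {i} → Precedes i j → ι (work i) ≤ received α i a
          completed {i} prec = ≤-trans (ahead (sibling prec)) (≈⇒≤
            (trans (+-congˡ (left-finished y i z (finished prec))) (+-identityʳ _)))

    -- The invariant at time t.  S∞ at time θ = y + z, which is at most t, has not
    -- overtaken EDF at time t; since time t₀ = y₀ + z₀, EDF has been working at
    -- full capacity except while S∞ advanced from t₀ to θ at the speed of EDF.
    record Invariant (t : Time) (y : ℕ) : Set (c ⊔ ℓ₂) where
      field
        y₀     : ℕ
        z₀ z   : Carrier
        0≤z₀   : 0# ≤ z₀
        z₀≤1   : z₀ ≤ 1#
        0≤z    : 0# ≤ z
        z≤1    : z ≤ 1#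
        t₀≤θ   : ι y₀ + z₀ ≤ ι y + z
        θ≤t    : ι y + z ≤ t
        ahead  : Ahead t y z
        served : sumWork + α * ι m * (t - (ι y₀ + z₀)) ≤
                 sumLeft y₀ z₀ + sumReceived t + (ι m - 1#) * ((ι y + z) - (ι y₀ + z₀))

    -- With θ, t₀ and t equal, `served` is `Ahead` summed over all jobs.
    restart : ∀ {t y z} → 0# ≤ z → z ≤ 1# → ι y + z ≈ t → Ahead t y z → Invariant t y
    restart {t} {y} {z} 0≤z z≤1 θ≈t (lift ahead) = record
      { y₀ = y ; z₀ = z ; z = z ; 0≤z₀ = 0≤z ; z₀≤1 = z≤1 ; 0≤z = 0≤z ; z≤1 = z≤1
      ; t₀≤θ = ≤-refl ; θ≤t = ≈⇒≤ θ≈t ; ahead = lift ahead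
      ; served = ≤-trans (≈⇒≤ (trans (+-congˡ (*-congˡ (+-congʳ (sym θ≈t))))
            (solve 3 (λ w e θ → w :+ e :* (θ :- θ) := w) refl sumWork (α * ι m) (ι y + z))))
          (≤-trans (total-mono jobs ahead) (≈⇒≤ (trans (total-+ jobs _ _)
            (solve 4 (λ r l e θ → r :+ l := (l :+ r) :+ e :* (θ :- θ)) refl
              (sumReceived t) (sumLeft y z) (ι m - 1#) (ι y + z)))))
      }

    carry : ∀ {t y} (inv : Invariant t y) → Invariant.z inv ≈ 1# → Invariant t (suc y)
    carry {t} {y} inv z≈1 = record
      { y₀ = y₀ ; z₀ = z₀ ; z = 0# ; 0≤z₀ = 0≤z₀ ; z₀≤1 = z₀≤1 ; 0≤z = ≤-refl ; z≤1 = 0≤1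
      ; t₀≤θ = ≤-trans t₀≤θ (≈⇒≤ same) ; θ≤t = ≤-trans (≈⇒≤ (sym same)) θ≤t
      ; ahead = lift λ {j} j∈ → ≤-trans (lower ahead j∈) (≈⇒≤ (+-congˡ (trans
          (+-congˡ (-‿cong (*-congʳ z≈1))) (trans (left-1 y j) (sym (left-0 (suc y) j))))))
      ; served = ≤-trans served (≈⇒≤ (+-congˡ (*-congˡ (+-congʳ same))))
      }
      where
      open Invariant inv
      same : ι y + z ≈ ι (suc y) + 0#
      same = trans (+-congˡ z≈1) (solve 1 (λ y → y :+ :1 := (:1 :+ y) :+ :0) refl (ι y))

    -- While θ rests, the left side of `served` grows by α m (b - a), and m running jobs supply at
    -- least as much on the right.
    busy-step : ∀ {k n a b y} → Span k n a b → Busy k → Invariant a y → Invariant b y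
    busy-step {k} {n} {a} {b} {y} span busy inv = record
      { y₀ = y₀ ; z₀ = z₀ ; z = z ; 0≤z₀ = 0≤z₀ ; z₀≤1 = z₀≤1 ; 0≤z = 0≤z ; z≤1 = z≤1
      ; t₀≤θ = t₀≤θ ; θ≤t = ≤-trans θ≤t a≤b
      ; ahead = lift λ {j} j∈ → ≤-trans (lower ahead j∈)
          (+-monoˡ-≤ (left y j z) (received-mono 0≤α j k cut≤a a≤b b≤cut))
      ; served = ≤-trans
          (certificate (∸≥0 served ⊞ (∸≥0 (ι-mono-≤ (#running-≥ k busy)) ⊠ (0≤α ⊠ ∸≥0 a≤b)))
            (solve 10 (λ w α m a b t₀ l r θ ρ →
              ((l :+ (r :+ ρ :* (α :* (b :- a)))) :+ (m :- :1) :* (θ :- t₀)) :- (w :+ α :* m :* (b :- t₀)) :=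
              (((l :+ r) :+ (m :- :1) :* (θ :- t₀)) :- (w :+ α :* m :* (a :- t₀))) :+ (ρ :- m) :* (α :* (b :- a)))
              refl sumWork α (ι m) a b (ι y₀ + z₀) (sumLeft y₀ z₀) (sumReceived a) (ι y + z)
              (ι (#running jobs k))))
          (≈⇒≤ (+-congʳ (+-congˡ (sym (total-received-piece α jobs k cut≤a a≤b b≤cut)))))
      }
      where
      open Span span
      open Invariant inv

    module _ {k : ℕ} (¬busy : ¬ Busy k) where

      -- As no relevant job runs, nothing limits the speed of θ: it passes f whole units at the
      -- fixed time a, and then moves on to b, where t₀ restarts.
      jump : ∀ {n a b} → Span k n a b → ∀ f {y z} → f ℕ.+ y ≡ n → (∀ {j} → j ∈ jobs → ¬ RunsIn k j) →
             z ≤ 1# → ι y + z ≤ a → Ahead a y z → Invariant b n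
      jump {n} {a} {b} span zero {y} {z} ≡.refl none z≤1 θ≤a ahead =
        restart (∸≥0 (≤-trans n≤a a≤b)) z′≤1
          (solve 2 (λ n b → n :+ (b :- n) := b) refl (ι n) b)
          (ahead-step cut≤a (<-≤-trans a<b b≤cut) a≤b b≤cut n≤a ¬busy ℕₚ.≤-refl
            (certificate (∸≥0 θ≤a ⊞ ∸≥0 a≤b)
              (solve 4 (λ n z a b → (b :- n) :- z := (a :- (n :+ z)) :+ (b :- a)) refl (ι n) z a b))
            z′≤1 (λ j∈ j-runs → ⊥-elim (none j∈ j-runs)) ahead)
        where
        open Span span
        z′≤1 : b - ι n ≤ 1#
        z′≤1 = certificate (∸≥0 b≤1+n)
          (solve 2 (λ n b → :1 :- (b :- n) := (:1 :+ n) :- b) refl (ι n) b)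
      jump {n} {a} span (suc f) {y} {z} eq none z≤1 θ≤a ahead =
        jump span f (≡.trans (ℕₚ.+-suc f y) eq) none 0≤1
          (≤-trans (≈⇒≤ (+-identityʳ _)) (≤-trans (ι-mono-≤ y<n) n≤a))
          (lift λ {j} j∈ → ≤-trans (lower full j∈) (≈⇒≤ (+-congˡ (trans (left-1 y j) (sym (left-0 (suc y) j))))))
        where
        open Span span
        y<n : y ℕ.< n
        y<n = ≡.subst (y ℕ.<_) eq (s≤s (ℕₚ.m≤n+m y f))
        full : Ahead a y 1#
        full = ahead-step cut≤a (<-≤-trans a<b b≤cut) ≤-refl (≤-trans a≤b b≤cut) n≤a ¬busy
          (ℕₚ.<⇒≤ y<n) z≤1 ≤-refl (λ j∈ j-runs → ⊥-elim (none j∈ j-runs)) ahead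

      -- The gain of θ is worth (m - 1) α (b - a) in `served`, and one running job adds the missing
      -- α (b - a).
      advance-to : ∀ {n a b y} → cut k ≤ a → a < cut (suc k) → a ≤ b → b ≤ cut (suc k) → ι n ≤ a →
                   1 ℕ.≤ #running jobs k → y ℕ.≤ n → (inv : Invariant a y) →
                   let z′ = Invariant.z inv + α * (b - a) in
                   z′ ≤ 1# → ι y + z′ ≤ b → Invariant b y
      advance-to {n} {a} {b} {y} k≤a a<k a≤b b≤k n≤a some y≤n inv z′≤1 θ′≤b = record
        { y₀ = y₀ ; z₀ = z₀ ; z = z + α * (b - a) ; 0≤z₀ = 0≤z₀ ; z₀≤1 = z₀≤1
        ; 0≤z = 0≤z ⊞ e≥0 ; z≤1 = z′≤1
        ; t₀≤θ = ≤-trans t₀≤θ (+-monoʳ-≤ (ι y) z≤z′)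
        ; θ≤t = θ′≤b
        ; ahead = ahead-step k≤a a<k a≤b b≤k n≤a ¬busy y≤n z≤z′ z′≤1
            (λ _ _ → ≈⇒≤ (solve 2 (λ z e → (z :+ e) :- z := e) refl z (α * (b - a)))) ahead
        ; served = ≤-trans
          (certificate (∸≥0 served ⊞ (∸≥0 (ι-mono-≤ some) ⊠ e≥0))
            (solve 11 (λ w α m a b t₀ l r y z ρ →
              ((l :+ (r :+ ρ :* (α :* (b :- a)))) :+ (m :- :1) :* ((y :+ (z :+ α :* (b :- a))) :- t₀)) :-
                (w :+ α :* m :* (b :- t₀)) :=
              (((l :+ r) :+ (m :- :1) :* ((y :+ z) :- t₀)) :- (w :+ α :* m :* (a :- t₀))) :+
                (ρ :- (:1 :+ :0)) :* (α :* (b :- a)))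
              refl sumWork α (ι m) a b (ι y₀ + z₀) (sumLeft y₀ z₀) (sumReceived a) (ι y) z
              (ι (#running jobs k))))
          (≈⇒≤ (+-congʳ (+-congˡ (sym (total-received-piece α jobs k k≤a a≤b b≤k)))))
        }
        where
        open Invariant inv
        e≥0 : 0# ≤ α * (b - a)
        e≥0 = 0≤α ⊠ ∸≥0 a≤b
        z≤z′ : z ≤ z + α * (b - a)
        z≤z′ = certificate e≥0 (solve 2 (λ z e → (z :+ e) :- z := e) refl z (α * (b - a)))

      -- Since θ can lag behind and be faster than the clock, it may cross integers within a span,
      -- and S∞ changes its rates there. The number f counts the units between θ and the current
      -- one.
      advance : ∀ {n} f {a b y} → Span k n a b → 1 ℕ.≤ #running jobs k → f ℕ.+ y ≡ n →
                Invariant a y → ∃ (Invariant b)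
      advance {n} zero {a} {b} span some ≡.refl inv = capped (z + α * (b - a) ≤? b - ι n)
        where
        open Span span
        open Invariant inv

        z′≤1 : b - ι n ≤ 1#
        z′≤1 = certificate (∸≥0 b≤1+n)
          (solve 2 (λ n b → :1 :- (b :- n) := (:1 :+ n) :- b) refl (ι n) b)

        capped : Dec (z + α * (b - a) ≤ b - ι n) → ∃ (Invariant b)
        capped (yes below) = n , advance-to cut≤a (<-≤-trans a<b b≤cut) a≤b b≤cut n≤a some ℕₚ.≤-refl inv
          (≤-trans below z′≤1)
          (certificate (∸≥0 below) (solve 3 (λ b n x → b :- (n :+ x) := (b :- n) :- x) refl
            b (ι n) (z + α * (b - a))))
        -- At speed α, θ would overtake the clock in this span. It is set to b, a smaller advance,
        -- and t₀ restarts.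
        capped (no above) = n , restart (∸≥0 (≤-trans n≤a a≤b)) z′≤1
          (solve 2 (λ n b → n :+ (b :- n) := b) refl (ι n) b)
          (ahead-step cut≤a (<-≤-trans a<b b≤cut) a≤b b≤cut n≤a ¬busy ℕₚ.≤-refl
            (certificate (∸≥0 θ≤t ⊞ ∸≥0 a≤b)
              (solve 4 (λ n z a b → (b :- n) :- z := (a :- (n :+ z)) :+ (b :- a)) refl (ι n) z a b))
            z′≤1
            (λ _ _ → certificate (∸≥0 (≰⇒≥ above))
              (solve 3 (λ x z e → e :- (x :- z) := (z :+ e) :- x) refl (b - ι n) z (α * (b - a))))
            ahead)
      advance {n} (suc f) {a} {b} {y} span some eq inv = crossing (z + α * (b - a) ≤? 1#)
        where
        open Span span
        open Invariant inv

        y<n : y ℕ.< n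
        y<n = ≡.subst (y ℕ.<_) eq (s≤s (ℕₚ.m≤n+m y f))

        θ′≤ : ∀ {z t} → z ≤ 1# → a ≤ t → ι y + z ≤ t
        θ′≤ z≤1 a≤t = ≤-trans (≤-trans (+-monoʳ-≤ (ι y) z≤1) (≈⇒≤ (sym (ι-suc y))))
          (≤-trans (ι-mono-≤ y<n) (≤-trans n≤a a≤t))

        crossing : Dec (z + α * (b - a) ≤ 1#) → ∃ (Invariant b)
        crossing (yes below) = y , advance-to cut≤a (<-≤-trans a<b b≤cut) a≤b b≤cut n≤a some
          (ℕₚ.<⇒≤ y<n) inv below (θ′≤ below a≤b)
        crossing (no above) = advance f
          (record { cut≤a = ≤-trans cut≤a a≤a′ ; a<b = a′<b ; b≤cut = b≤cut
                  ; n≤a = ≤-trans n≤a a≤a′ ; b≤1+n = b≤1+n })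
          some (≡.trans (ℕₚ.+-suc f y) eq)
          (carry (advance-to cut≤a (<-≤-trans a<b b≤cut) a≤a′ (≤-trans (proj₁ a′<b) b≤cut) n≤a some
            (ℕₚ.<⇒≤ y<n) inv (≈⇒≤ reaches-1) (θ′≤ (≈⇒≤ reaches-1) a≤a′)) reaches-1)
          where
          -- The time that θ needs at speed α to reach the next integer.
          δ a′ : Carrier
          δ  = α ⁻¹ * (1# - z)
          a′ = a + δ

          a≤a′ : a ≤ a′
          a≤a′ = certificate (⁻¹-nonNeg 0<α ⊠ ∸≥0 z≤1)
            (solve 2 (λ a δ → (a :+ δ) :- a := δ) refl a δ)

          reaches-1 : z + α * (a′ - a) ≈ 1#
          reaches-1 = trans
            (+-congˡ (trans (*-congˡ (solve 2 (λ a δ → (a :+ δ) :- a := δ) refl a δ))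
              (trans (sym (*-assoc α (α ⁻¹) _)) (*-congʳ (⁻¹-inverseʳ (>⇒≉0 0<α))))))
            (solve 1 (λ z → z :+ :1 :* (:1 :- z) := :1) refl z)

          a′<b : a′ < b
          a′<b = ≰⇒> λ b≤a′ → above (≤-trans
            (certificate (0≤α ⊠ ∸≥0 b≤a′)
              (solve 5 (λ z α a a′ b → (z :+ α :* (a′ :- a)) :- (z :+ α :* (b :- a)) := α :* (a′ :- b))
                refl z α a a′ b))
            (≈⇒≤ reaches-1))

    θ-unit : ∀ {k n a b y} → Span k n a b → Invariant a y → y ℕ.≤ n
    θ-unit {y = y} span inv = ℕₚ.m<1+n⇒m≤n (ℕₚ.≰⇒> λ 1+n≤y → <⇒≰ a<b
      (≤-trans b≤1+n (≤-trans (ι-mono-≤ 1+n≤y)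
        (≤-trans (≤-respˡ-≈ (+-identityʳ (ι y)) (+-monoʳ-≤ (ι y) 0≤z)) θ≤t))))
      where
      open Span span
      open Invariant inv

    invariant-step : ∀ {k n a b} → Span k n a b → ∃ (Invariant a) → ∃ (Invariant b)
    invariant-step {k} {n} span (y , inv) with busy? k | 1 ℕₚ.≤? #running jobs k
    ... | yes busy | _        = y , busy-step span busy inv
    ... | no ¬busy | yes some =
      advance ¬busy (n ℕ.∸ y) span some (ℕₚ.m∸n+n≡m (θ-unit span inv)) inv
    ... | no ¬busy | no none  =
      n , jump ¬busy span (n ℕ.∸ y) (ℕₚ.m∸n+n≡m (θ-unit span inv))
            (λ j∈ j-runs → none (count-≥1 (runs? k) j∈ j-runs)) z≤1 θ≤t ahead
      where open Invariant inv

    invariant-start : ∃ (Invariant (ι 0))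
    invariant-start = 0 , restart ≤-refl 0≤1 (+-identityʳ 0#) (lift λ {j} j∈ → ≈⇒≤ (sym (trans
      (+-cong (received-0 α j) (left-0 0 j))
      (trans (+-identityˡ _) (reflexive (≡.cong ι (virtualRemaining-0 j)))))))

    invariant-end : ∃ (Invariant (ι d))
    invariant-end = time-induction (λ t → ∃ (Invariant t)) (z≤n {d})
      (λ _ _ span → invariant-step span) invariant-start

    module _ (0<m : 1 ℕ.≤ m)
             (light : ∀ y → y ℕ.≤ d → ι (virtualWork y) ≤ (α * ι m - ι m + 1#) * (ι d - ι y)) where

      private
        κ : Carrier
        κ = α * ι m - ι m + 1#

        -- `light` is available at integers only. Between them both sides are linear in z, so it
        -- interpolates; for y = d the bound at y is already 0.
        sumLeft-≤ : ∀ y {z} → 0# ≤ z → z ≤ 1# → ι y + z ≤ ι d → 0# ≤ κ →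
                    sumLeft y z ≤ κ * (ι d - (ι y + z))
        sumLeft-≤ y {z} 0≤z z≤1 θ≤d 0≤κ = bound (suc y ℕₚ.≤? d)
          where
          interpolate : sumLeft y z ≈ (1# - z) * ι (virtualWork y) + z * ι (virtualWork (suc y))
          interpolate = trans
            (total-cong jobs λ j → trans
              (trans (solve 3 (λ r p z → r :- z :* p := r :+ p :* (:0 :- z)) refl
                (ι (virtualRemaining y j)) (ι (progress y j)) z)
                (+-congˡ (*-congʳ (trans (solve 2 (λ p s → p := (p :+ s) :- s) refl
                    (ι (progress y j)) (ι (virtualRemaining (suc y) j)))
                  (+-congʳ (trans (sym (ι-+ (progress y j) _))
                    (sym (reflexive (≡.cong ι (virtualRemaining-suc y j))))))))))
              (solve 3 (λ r s z → r :+ (r :- s) :* (:0 :- z) := r :* (:1 :- z) :+ s :* z) refl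
                (ι (virtualRemaining y j)) (ι (virtualRemaining (suc y) j)) z))
            (trans (total-+ jobs _ _) (+-cong
              (trans (total-*ʳ jobs _ _) (trans (*-congʳ (total-ι jobs (virtualRemaining y))) (*-comm _ _)))
              (trans (total-*ʳ jobs _ _) (trans (*-congʳ (total-ι jobs (virtualRemaining (suc y)))) (*-comm _ _)))))

          bound : Dec (suc y ℕ.≤ d) → sumLeft y z ≤ κ * (ι d - (ι y + z))
          bound (yes y<d) = ≤-trans (≈⇒≤ interpolate) (certificate
            ((∸≥0 z≤1 ⊠ ∸≥0 (light y (ℕₚ.<⇒≤ y<d))) ⊞ (0≤z ⊠ ∸≥0 (light (suc y) y<d)))
            (solve 6 (λ κ d y z v w →
              κ :* (d :- (y :+ z)) :- ((:1 :- z) :* v :+ z :* w) :=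
              (:1 :- z) :* (κ :* (d :- y) :- v) :+ z :* (κ :* (d :- (:1 :+ y)) :- w)) refl
              κ (ι d) (ι y) z (ι (virtualWork y)) (ι (virtualWork (suc y)))))
          bound (no y≮d) = ≤-trans
            (≤-trans (total-mono jobs λ {j} _ → certificate (0≤z ⊠ ι-nonNeg (progress y j))
                (solve 2 (λ r e → r :- (r :- e) := e) refl (ι (virtualRemaining y j)) (z * ι (progress y j))))
              (≈⇒≤ (total-ι jobs (virtualRemaining y))))
            (≤-trans (light y y≤d) (≤-trans
              (certificate (0≤κ ⊠ ∸≥0 (ι-mono-≤ d≤y))
                (solve 3 (λ κ d y → :0 :- κ :* (d :- y) := κ :* (y :- d)) refl κ (ι d) (ι y)))
              (0≤κ ⊠ ∸≥0 θ≤d)))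
            where
            d≤y : d ℕ.≤ y
            d≤y = ℕₚ.m<1+n⇒m≤n (ℕₚ.≰⇒> y≮d)
            y≤d : y ℕ.≤ d
            y≤d = ι-cancel-≤ {y} {d} (≤-trans (≤-respˡ-≈ (+-identityʳ (ι y)) (+-monoʳ-≤ (ι y) 0≤z)) θ≤d)

      -- As θ ≤ d and m ≥ 1, the term for θ in `served` costs at most (m - 1) (d - t₀). The
      -- remaining κ (d - t₀) covers what S∞ had left at t₀.
      sumWork≤sumReceived : 0# ≤ κ → sumWork ≤ sumReceived (ι d)
      sumWork≤sumReceived 0≤κ =
        let y , inv = invariant-end
            open Invariant inv
        in  certificate
          (∸≥0 served ⊞ ∸≥0 (sumLeft-≤ y₀ 0≤z₀ z₀≤1 (≤-trans t₀≤θ θ≤t) 0≤κ) ⊞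
            (∸≥0 (ι-mono-≤ 0<m) ⊠ ∸≥0 θ≤t))
          (solve 8 (λ w α m d t₀ l r θ →
            r :- w :=
            ((((l :+ r) :+ (m :- :1) :* (θ :- t₀)) :- (w :+ α :* m :* (d :- t₀))) :+
              ((α :* m :- m :+ :1) :* (d :- t₀) :- l)) :+ (m :- (:1 :+ :0)) :* (d :- θ))
            refl sumWork α (ι m) (ι d) (ι y₀ + z₀) (sumLeft y₀ z₀) (sumReceived (ι d)) (ι y + z))

      all-completed : 0# ≤ κ → ∀ {j} → j ∈ jobs → ι (work j) ≤ received α j (ι d)
      all-completed 0≤κ = total-tight jobs (λ j → received≤work j d) (sumWork≤sumReceived 0≤κ)

-- The speed bound and the choice of the precision

module Schedulability {c ℓ₁ ℓ₂} (𝕂 : ArchimedeanOrderedField c ℓ₁ ℓ₂) where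

  open ArchimedeanOrderedField 𝕂
  open OrderedField 𝕂
  open Scheduling 𝕂
  open EDFAnalysis 𝕂
  open Sums
  open Demand
  open Job

  speed : ℕ → Carrier → Carrier
  speed m ε = ((1# + 1#) - (ι m) ⁻¹) + ε

  module _ {m : ℕ} (0<m : 1 ℕ.≤ m) {ε : Carrier} (0<ε : 0# < ε) where

    private
      α κ : Carrier
      α = speed m ε
      κ = α * ι m - ι m + 1#

    0<ιm : 0# < ι m
    0<ιm = ≰⇒> λ ιm≤0 → ℕₚ.<⇒≱ 0<m (ι-cancel-≤ {m} {0} ιm≤0)

    1≤α : 1# ≤ α
    1≤α = certificate (∸≥0 inverse≤1 ⊞ proj₁ 0<ε)
      (solve 2 (λ i ε → (((:1 :+ :1) :- i) :+ ε) :- :1 := (:1 :- i) :+ ε) refl (ι m ⁻¹) ε)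
      where
      inverse≤1 : (ι m) ⁻¹ ≤ 1#
      inverse≤1 = ≤-respʳ-≈ (⁻¹-inverseʳ (>⇒≉0 0<ιm)) (certificate
        (⁻¹-nonNeg 0<ιm ⊠ ∸≥0 (ι-mono-≤ 0<m))
        (solve 2 (λ m i → m :* i :- i := i :* (m :- (:1 :+ :0))) refl (ι m) (ι m ⁻¹)))

    0<α : 0# < α
    0<α = ≰⇒> λ α≤0 → 1≰0 (≤-trans 1≤α α≤0)

    -- The 1/m in the speed, times m, cancels the final 1 of κ; without ε, the speed 2 - 1/m gives
    -- exactly m.
    κ≈ : κ ≈ ι m + ε * ι m
    κ≈ = trans
      (solve 3 (λ m i ε → (((:1 :+ :1) :- i) :+ ε) :* m :- m :+ :1 := (m :+ ε :* m) :+ (:1 :- m :* i))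
        refl (ι m) (ι m ⁻¹) ε)
      (trans (+-congˡ (trans (+-congˡ (-‿cong (⁻¹-inverseʳ (>⇒≉0 0<ιm)))) (-‿inverseʳ 1#)))
        (+-identityʳ _))

    0≤κ : 0# ≤ κ
    0≤κ = ≤-trans (ι-nonNeg m ⊞ (proj₁ 0<ε ⊠ ι-nonNeg m)) (≈⇒≤ (sym κ≈))

    light⇒schedulable :
      ∀ {n 𝒯} → 1# ≤ ι n * ε → NoOverrun 𝒯 →
      (∀ x → n ℕ.* totalDemand 𝒯 x ℕ.≤ x ℕ.* (n ℕ.* m ℕ.+ 1)) → EDFSchedulable 𝒯 m α
    light⇒schedulable {n} {𝒯} 1≤nε ok demand≤ R S edf j gen =
      all-completed 0<m light 0≤κ (∈-jobs⁺ gen ℕₚ.≤-refl)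
      where
      d : ℕ
      d = absoluteDeadline j

      open DagJobs R d
      open OnEDF R α 0<α S edf d

      0<ιn : 0# < ι n
      0<ιn = ≰⇒> λ ιn≤0 → 1≰0 (≤-trans 1≤nε (certificate (∸≥0 ιn≤0 ⊠ proj₁ 0<ε)
        (solve 2 (λ n ε → :0 :- n :* ε := (:0 :- n) :* ε) refl (ι n) ε)))

      light : ∀ y → y ℕ.≤ d → ι (virtualWork y) ≤ κ * (ι d - ι y)
      light y y≤d = *-cancelˡ-≤ 0<ιn (≤-trans (≤-trans
        (≈⇒≤ (sym (ι-* n (virtualWork y))))
        (≤-trans (ι-mono-≤ (ℕₚ.≤-trans (ℕₚ.*-monoʳ-≤ n (virtualWork-≤ ok y≤d)) (demand≤ x)))
          (≈⇒≤ (trans (ι-* x _) (*-cong d-y (trans (ι-+ (n ℕ.* m) 1) (+-congʳ (ι-* n m))))))))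
        (≤-trans
          -- The factor n clears the denominator: n (1 + ε) m exceeds n m + 1 by (m - 1) + (n ε - 1)
          -- m, which is nonnegative.
          (certificate
            (0≤x ⊠ (∸≥0 (ι-mono-≤ 0<m) ⊞ (∸≥0 1≤nε ⊠ ι-nonNeg m)))
            (solve 4 (λ n m ε x →
              n :* ((m :+ ε :* m) :* x) :- x :* (n :* m :+ (:1 :+ :0)) :=
              x :* ((m :- (:1 :+ :0)) :+ (n :* ε :- :1) :* m)) refl (ι n) (ι m) ε (ι d - ι y)))
          (≈⇒≤ (*-congˡ (*-congʳ (sym κ≈))))))
        where
        x : ℕ
        x = d ℕ.∸ y

        0≤x : 0# ≤ ι d - ι y
        0≤x = ∸≥0 (ι-mono-≤ y≤d)

        d-y : ι x ≈ ι d - ι y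
        d-y = trans (solve 2 (λ x y → x := (x :+ y) :- y) refl (ι x) (ι y))
          (+-congʳ (trans (sym (ι-+ x y)) (reflexive (≡.cong ι (ℕₚ.m∸n+n≡m y≤d)))))

theorem2 : ∀ {c ℓ₁ ℓ₂} (𝕂 : ArchimedeanOrderedField c ℓ₁ ℓ₂) →
    let open ArchimedeanOrderedField 𝕂
        open Scheduling 𝕂
    in
    (ε : Carrier) → 0# < ε →
    ∃ λ (P : Program) →
      PseudopolynomialTime P ×
      (∀ (𝒯 : TaskSystem) (m : ℕ) .{{_ : NonZero m}} →
        (Accepts P 𝒯 m → EDFSchedulable 𝒯 m (((1# + 1#) - (ι m) ⁻¹) + ε)) ×
        (Rejects P 𝒯 m → Infeasible 𝒯 m 1#))
theorem2 𝕂 ε 0<ε =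
  TestProgram.program n , TestProgram.program-polynomial n , λ 𝒯 m → accepted 𝒯 m , rejected 𝒯 m
  where
  open ArchimedeanOrderedField 𝕂
  open OrderedField 𝕂
  open Scheduling 𝕂

  n₀ n : ℕ
  n₀ = proj₁ (archimedean (ε ⁻¹))
  -- The successor makes n nonzero, which the treatment of rejection requires; it is still at least
  -- 1/ε.
  n  = suc n₀

  1≤nε : 1# ≤ ι n * ε
  1≤nε = ≤-trans (≈⇒≤ (sym (⁻¹-inverseʳ (>⇒≉0 0<ε))))
    (≤-trans (*-monoˡ-≤ (proj₁ 0<ε) (≤-trans (proj₂ (archimedean (ε ⁻¹))) (ι-mono-≤ (ℕₚ.n≤1+n n₀))))
      (≈⇒≤ (*-comm ε (ι n))))

  accepted : ∀ 𝒯 m .{{_ : NonZero m}} → Accepts (TestProgram.program n) 𝒯 m →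
             EDFSchedulable 𝒯 m (((1# + 1#) - (ι m) ⁻¹) + ε)
  accepted 𝒯 m accepts = Schedulability.light⇒schedulable 𝕂 (ℕ.>-nonZero⁻¹ m) 0<ε {n} 1≤nε
    (Demand.totalDemand0⇒noOverrun 𝒯 (small 0 z≤n)) (Demand.demand-everywhere n m 𝒯 small)
    where small = TestProgram.accepts⇒ n 𝒯 m accepts

  rejected : ∀ 𝒯 m .{{_ : NonZero m}} → Rejects (TestProgram.program n) 𝒯 m → Infeasible 𝒯 m 1#
  rejected 𝒯 m rejects =
    Infeasibility.overloaded⇒infeasible 𝕂 𝒯 m (TestProgram.rejects⇒ n 𝒯 m rejects)
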